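{- For every integer $q\ge2$ and every real $\varepsilon>0$ there is $n_0=n_0(q,\varepsilon)$ such that the following holds. Let $G$ be a satisfiable regular $q$-CSP instance on $n\ge n_0$ vertices, and let $f_{\mathrm{start}}$ and $f_{\mathrm{end}}$ be a pair of its satisfying assignments. Then there exists a polynomial-length reconfiguration sequence $\vec f$ from $f_{\mathrm{start}}$ to $f_{\mathrm{end}}$ such that $$\mathrm{val}_G(\vec f)\ge\frac{1}{2^{q-1}}-\varepsilon .$$ Moreover, such an $\vec f$ can be found in deterministic polynomial time (for fixed $q$ and $\varepsilon$). In particular, for every integer $q\ge2$ and every sufficiently small real $\varepsilon>0$, there exists a deterministic polynomial-time $\left(\frac{1}{2^{q-1}}-\varepsilon\right)$-factor approximation algorithm for Maxmin $q$-CSP Reconfiguration on regular $q$-CSP instances.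
   Context: A $q$-CSP instance is a quadruple $G=(V,E,\Sigma,\Psi)$, where $(V,E)$ is a $q$-uniform hypergraph, $\Sigma$ is a finite set (the alphabet), and $\Psi=(\psi_e)_{e\in E}$ is a collection of constraints $\psi_e:\Sigma^e\to\{0,1\}$, each given as a circuit. It is regular if every vertex belongs to the same number of hyperedges. An assignment is a function $f:V\to\Sigma$; it satisfies $e\in E$ if $\psi_e(f|_e)=1$, and satisfies $G$ if it satisfies all $e\in E$. $G$ is satisfiable if it has a satisfying assignment. The value $\mathrm{val}_G(f)$ is the fraction of hyperedges satisfied by $f$ (taken to be $1$ if $E=\emptyset$). A reconfiguration sequence from $f_{\mathrm{start}}$ to $f_{\mathrm{end}}$ is a sequence $\vec f=(f^{(1)},\ldots,f^{(T)})$ of assignments with $f^{(1)}=f_{\mathrm{start}}$, $f^{(T)}=f_{\mathrm{end}}$, in which every two consecutive assignments differ on at most one vertex; its length is $T$. Its value is $\mathrm{val}_G(\vec f)=\min_{1\le t\le T}\mathrm{val}_G(f^{(t)})$. Maxmin $q$-CSP Reconfiguration: given a satisfiable $q$-CSP instance $G$ and a pair of its satisfying assignments $f_{\mathrm{start}},f_{\mathrm{end}}$, find a reconfiguration sequence $\vec f$ from $f_{\mathrm{start}}$ to $f_{\mathrm{end}}$ maximizing $\mathrm{val}_G(\vec f)$. A $\rho$-factor approximation algorithm outputs a reconfiguration sequence whose value is at least $\rho$ times the maximum. -}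

module Defs where

open import Data.Bool.Base using (Bool; true; false; T; if_then_else_) renaming (not to notᵇ; _∧_ to _∧ᵇ_; _∨_ to _∨ᵇ_)
open import Data.Fin.Base using (Fin; toℕ)
open import Data.Fin.Properties using () renaming (_≟_ to _≟ᶠ_)
open import Data.Fin.Subset using (Subset; ∣_∣; _∈_)
open import Data.Fin.Subset.Properties using (_∈?_)
open import Data.Integer.Base using (+_)
open import Data.List.Base as List using (List; []; _∷_; length; filter; filterᵇ)
open import Data.List.Membership.Propositional using () renaming (_∈_ to _∈ˡ_)
open import Data.List.NonEmpty as List⁺ using (List⁺; _∷_)
open import Data.List.Relation.Unary.All as All using (All)
open import Data.List.Relation.Unary.Linked using (Linked)
open import Data.List.Relation.Unary.Unique.Propositional using (Unique)
open import Data.Nat.Base as ℕ using (ℕ; zero; suc; _∸_; _^_)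
import Data.Nat.Properties as ℕ
open import Data.Product.Base using (Σ; ∃; ∃-syntax; _×_; _,_)
open import Data.Rational.Base as ℚ using (ℚ; 0ℚ; 1ℚ; ½; _/_)
import Data.Rational.Properties as ℚ
import Data.Rational.Solver as ℚSolver
open import Data.Vec.Base as Vec using (Vec; []; _∷_; lookup)
open import Function.Base using (id; _∘_)
open import Relation.Binary.PropositionalEquality using (_≡_; _≢_; refl; sym; cong; subst)
open import Relation.Nullary.Decidable using (⌊_⌋)

------------------------------------------------------------------------
-- Real numbers, as Cauchy sequences of rationals with a modulus.

record ℝ : Set where
  field
    seq    : ℕ → ℚ
    cauchy : ∀ δ → 0ℚ ℚ.< δ → ∃[ N ] (∀ i j → N ℕ.≤ i → N ℕ.≤ j → ℚ.∣ seq i ℚ.- seq j ∣ ℚ.≤ δ)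

open ℝ

infix 4 _≤ᴿ_ _<ᴿ_
infixl 6 _-ᴿ_
infixl 7 _·ᴿ_

_≤ᴿ_ : ℝ → ℝ → Set
x ≤ᴿ y = ∀ δ → 0ℚ ℚ.< δ → ∃[ N ] (∀ i → N ℕ.≤ i → seq x i ℚ.≤ seq y i ℚ.+ δ)

_<ᴿ_ : ℝ → ℝ → Set
x <ᴿ y = ∃[ δ ] 0ℚ ℚ.< δ × ∃[ N ] (∀ i → N ℕ.≤ i → seq x i ℚ.+ δ ℚ.≤ seq y i)

fromℚ : ℚ → ℝ
seq    (fromℚ r) _ = r
cauchy (fromℚ r) δ 0<δ =
  0 , λ _ _ _ _ → subst (ℚ._≤ δ) (sym (cong ℚ.∣_∣ (ℚ.+-inverseʳ r))) (ℚ.<⇒≤ 0<δ)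

0ᴿ : ℝ
0ᴿ = fromℚ 0ℚ

_-ᴿ_ : ℝ → ℝ → ℝ
seq    (x -ᴿ y) i = seq x i ℚ.- seq y i
cauchy (x -ᴿ y) δ 0<δ = combine (cauchy x δ/2 0<δ/2) (cauchy y δ/2 0<δ/2)
  where
  δ/2 : ℚ
  δ/2 = ½ ℚ.* δ

  0<δ/2 : 0ℚ ℚ.< δ/2
  0<δ/2 = subst (ℚ._< δ/2) (ℚ.*-zeroʳ ½) (ℚ.*-monoʳ-<-pos ½ 0<δ)

  halves : δ/2 ℚ.+ δ/2 ≡ δ
  halves = let open ℚSolver.+-*-Solver in
    solve 1 (λ d → con ½ :* d :+ con ½ :* d := d) refl δ

  regroup : ∀ a b c d → (a ℚ.- b) ℚ.- (c ℚ.- d) ≡ (a ℚ.- c) ℚ.- (b ℚ.- d)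
  regroup = let open ℚSolver.+-*-Solver in
    solve 4 (λ a b c d → (a :- b) :- (c :- d) := (a :- c) :- (b :- d)) refl

  Close : (ℕ → ℚ) → ℚ → ℕ → Set
  Close s η N = ∀ i j → N ℕ.≤ i → N ℕ.≤ j → ℚ.∣ s i ℚ.- s j ∣ ℚ.≤ η

  combine : ∃ (Close (seq x) δ/2) → ∃ (Close (seq y) δ/2) →
            ∃ (Close (λ i → seq x i ℚ.- seq y i) δ)
  combine (M , cx) (N , cy) = M ℕ.⊔ N , λ i j MN≤i MN≤j →
    let open ℚ.≤-Reasoning
        dx = seq x i ℚ.- seq x j
        dy = seq y i ℚ.- seq y j
    in begin
      ℚ.∣ (seq x i ℚ.- seq y i) ℚ.- (seq x j ℚ.- seq y j) ∣
        ≡⟨ cong ℚ.∣_∣ (regroup (seq x i) (seq y i) (seq x j) (seq y j)) ⟩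
      ℚ.∣ dx ℚ.- dy ∣
        ≤⟨ ℚ.∣p-q∣≤∣p∣+∣q∣ dx dy ⟩
      ℚ.∣ dx ∣ ℚ.+ ℚ.∣ dy ∣
        ≤⟨ ℚ.+-mono-≤ (cx i j (ℕ.m⊔n≤o⇒m≤o M N MN≤i) (ℕ.m⊔n≤o⇒m≤o M N MN≤j))
                      (cy i j (ℕ.m⊔n≤o⇒n≤o M N MN≤i) (ℕ.m⊔n≤o⇒n≤o M N MN≤j)) ⟩
      δ/2 ℚ.+ δ/2
        ≡⟨ halves ⟩
      δ ∎

-- Multiplication of a real by a rational.
_·ᴿ_ : ℝ → ℚ → ℝ
seq    (x ·ᴿ r) i = seq x i ℚ.* r
cauchy (x ·ᴿ r) δ 0<δ = scale (cauchy x η 0<η)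
  where
  b : ℚ
  b = 1ℚ ℚ.+ ℚ.∣ r ∣

  instance
    b>0 : ℚ.Positive b
    b>0 = ℚ.positive (ℚ.<-≤-trans (ℚ.positive⁻¹ 1ℚ)
      (subst (ℚ._≤ b) (ℚ.+-identityʳ 1ℚ) (ℚ.+-monoʳ-≤ 1ℚ (ℚ.0≤∣p∣ r))))

    b≢0 : ℚ.NonZero b
    b≢0 = ℚ.pos⇒nonZero b

    1/b>0 : ℚ.Positive (ℚ.1/ b)
    1/b>0 = ℚ.1/pos⇒pos b

    ∣r∣≥0 : ℚ.NonNegative ℚ.∣ r ∣
    ∣r∣≥0 = ℚ.∣-∣-nonNeg r

  η : ℚ
  η = ℚ.1/ b ℚ.* δ

  0<η : 0ℚ ℚ.< η
  0<η = subst (ℚ._< η) (ℚ.*-zeroʳ (ℚ.1/ b)) (ℚ.*-monoʳ-<-pos (ℚ.1/ b) 0<δ)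

  instance
    η≥0 : ℚ.NonNegative η
    η≥0 = ℚ.nonNegative (ℚ.<⇒≤ 0<η)

  ∣r∣≤b : ℚ.∣ r ∣ ℚ.≤ b
  ∣r∣≤b = subst (ℚ._≤ b) (ℚ.+-identityˡ ℚ.∣ r ∣)
    (ℚ.+-monoˡ-≤ ℚ.∣ r ∣ (ℚ.<⇒≤ (ℚ.positive⁻¹ 1ℚ)))

  factor : ∀ a c → a ℚ.* r ℚ.- c ℚ.* r ≡ (a ℚ.- c) ℚ.* r
  factor a c = let open ℚSolver.+-*-Solver in
    solve 3 (λ a c r → a :* r :- c :* r := (a :- c) :* r) refl a c r

  η*b : η ℚ.* b ≡ δ
  η*b = let open ℚ.≤-Reasoning in begin-equality
    (ℚ.1/ b ℚ.* δ) ℚ.* b  ≡⟨ cong (ℚ._* b) (ℚ.*-comm (ℚ.1/ b) δ) ⟩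
    (δ ℚ.* ℚ.1/ b) ℚ.* b  ≡⟨ ℚ.*-assoc δ (ℚ.1/ b) b ⟩
    δ ℚ.* (ℚ.1/ b ℚ.* b)  ≡⟨ cong (δ ℚ.*_) (ℚ.*-inverseˡ b) ⟩
    δ ℚ.* 1ℚ              ≡⟨ ℚ.*-identityʳ δ ⟩
    δ                     ∎

  scale : ∃[ N ] (∀ i j → N ℕ.≤ i → N ℕ.≤ j → ℚ.∣ seq x i ℚ.- seq x j ∣ ℚ.≤ η) →
          ∃[ N ] (∀ i j → N ℕ.≤ i → N ℕ.≤ j → ℚ.∣ seq x i ℚ.* r ℚ.- seq x j ℚ.* r ∣ ℚ.≤ δ)
  scale (N , cx) = N , λ i j N≤i N≤j → let open ℚ.≤-Reasoning in begin
    ℚ.∣ seq x i ℚ.* r ℚ.- seq x j ℚ.* r ∣      ≡⟨ cong ℚ.∣_∣ (factor (seq x i) (seq x j)) ⟩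
    ℚ.∣ (seq x i ℚ.- seq x j) ℚ.* r ∣          ≡⟨ ℚ.∣p*q∣≡∣p∣*∣q∣ (seq x i ℚ.- seq x j) r ⟩
    ℚ.∣ seq x i ℚ.- seq x j ∣ ℚ.* ℚ.∣ r ∣      ≤⟨ ℚ.*-monoʳ-≤-nonNeg ℚ.∣ r ∣ (cx i j N≤i N≤j) ⟩
    η ℚ.* ℚ.∣ r ∣                              ≤⟨ ℚ.*-monoˡ-≤-nonNeg η ∣r∣≤b ⟩
    η ℚ.* b                                    ≡⟨ η*b ⟩
    δ                                          ∎

------------------------------------------------------------------------
-- Circuits.  Vertices are Fin n and symbols are Fin k throughout.

-- Σ^e, the functions from the hyperedge e to the alphabet.
Local : ∀ {n} → Subset n → ℕ → Set
Local e k = ∀ v → v ∈ e → Fin k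

-- Symbols enter a circuit one-hot: `input v _ a` is the bit [x v = a].
-- The other gates name earlier gates, index zero being the latest one.
data Gate {n} (e : Subset n) (k m : ℕ) : Set where
  const : Bool → Gate e k m
  input : (v : Fin n) → v ∈ e → Fin k → Gate e k m
  not   : Fin m → Gate e k m
  and   : Fin m → Fin m → Gate e k m
  or    : Fin m → Fin m → Gate e k m

data Gates {n} (e : Subset n) (k : ℕ) : ℕ → Set where
  []  : Gates e k 0
  _▷_ : ∀ {m} → Gates e k m → Gate e k m → Gates e k (suc m)

-- The latest gate is the output.
Circuit : ∀ {n} → Subset n → ℕ → Set
Circuit e k = ∃[ m ] Gates e k (suc m)

module _ {n k} {e : Subset n} (x : Local e k) where

  gateValue : ∀ {m} → Gate e k m → Vec Bool m → Bool
  gateValue (const b)     bs = b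
  gateValue (input v i a) bs = ⌊ x v i ≟ᶠ a ⌋
  gateValue (not g)       bs = notᵇ (lookup bs g)
  gateValue (and g h)     bs = lookup bs g ∧ᵇ lookup bs h
  gateValue (or g h)      bs = lookup bs g ∨ᵇ lookup bs h

  gateValues : ∀ {m} → Gates e k m → Vec Bool m
  gateValues []       = []
  gateValues (gs ▷ g) = gateValue g (gateValues gs) ∷ gateValues gs

  ⟦_⟧ : Circuit e k → Bool
  ⟦ _ , gs ⟧ = Vec.head (gateValues gs)

------------------------------------------------------------------------
-- Constraint satisfaction

-- E is a list without repetitions, and Ψ is indexed by it.
record CSP (q n k : ℕ) : Set where
  field
    edges   : List (Subset n)
    simple  : Unique edges
    uniform : All (λ e → ∣ e ∣ ≡ q) edges
    Ψ       : All (λ e → Circuit e k) edges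

open CSP public

module _ {q n k} (G : CSP q n k) where

  degree : Fin n → ℕ
  degree v = length (filter (v ∈?_) (edges G))

  Regular : Set
  Regular = ∃[ d ] (∀ v → degree v ≡ d)

Assignment : ℕ → ℕ → Set
Assignment n k = Vec (Fin k) n

_↾_ : ∀ {n k} → Assignment n k → (e : Subset n) → Local e k
(f ↾ e) v _ = lookup f v

fraction : ℕ → ℕ → ℚ
fraction s zero      = 1ℚ
fraction s m@(suc _) = + s / m

module _ {q n k} (G : CSP q n k) where

  Satisfies : Assignment n k → Set
  Satisfies f = ∀ {e} (e∈E : e ∈ˡ edges G) → T (⟦ f ↾ e ⟧ (All.lookup (Ψ G) e∈E))

  Satisfiable : Set
  Satisfiable = ∃ Satisfies

  val : Assignment n k → ℚ
  val f = fraction (length (filterᵇ id (All.reduce (λ {e} → ⟦ f ↾ e ⟧) (Ψ G))))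
                   (length (edges G))

------------------------------------------------------------------------
-- Reconfiguration

DifferAtMostOnce : ∀ {n k} → Assignment n k → Assignment n k → Set
DifferAtMostOnce f g =
  ∀ u v → lookup f u ≢ lookup g u → lookup f v ≢ lookup g v → u ≡ v

record _Reconfigures_to_ {n k} (f⃗ : List⁺ (Assignment n k)) (f g : Assignment n k) : Set where
  field
    starts : List⁺.head f⃗ ≡ f
    ends   : List⁺.last f⃗ ≡ g
    steps  : Linked DifferAtMostOnce (List⁺.toList f⃗)

seqVal : ∀ {q n k} → CSP q n k → List⁺ (Assignment n k) → ℚ
seqVal G f⃗ = List⁺.foldr₁ ℚ._⊓_ (List⁺.map (val G) f⃗)

record Instance (q : ℕ) : Set where
  field
    n k         : ℕ
    G           : CSP q n k
    start end   : Assignment n k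
    satisfiable : Satisfiable G
    start-sat   : Satisfies G start
    end-sat     : Satisfies G end

open Instance public

Sequence : ∀ {q} → Instance q → Set
Sequence I = List⁺ (Assignment (n I) (k I))

IsReconfiguration : ∀ {q} (I : Instance q) → Sequence I → Set
IsReconfiguration I f⃗ = f⃗ Reconfigures start I to end I

-- 1 / 2^(q-1) - ε
threshold : ℕ → ℝ → ℝ
threshold q ε = fromℚ (_/_ (+ 1) (2 ^ (q ∸ 1)) {{ℕ.m^n≢0 2 (q ∸ 1)}}) -ᴿ ε

-- The value is at least ρ times that of every reconfiguration sequence; since
-- only finitely many values occur, for ρ ≥ 0 this is at least ρ times the maximum.
_IsApproximate_ : ∀ {q} {I : Instance q} → Sequence I → ℝ → Set
_IsApproximate_ {I = I} f⃗ ρ =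
  ∀ g⃗ → IsReconfiguration I g⃗ → ρ ·ᴿ seqVal (G I) g⃗ ≤ᴿ fromℚ (seqVal (G I) f⃗)

-- Polynomials with natural coefficients, constant term first.
Polynomial : Set
Polynomial = List ℕ

_⟨_⟩ : Polynomial → ℕ → ℕ
[]      ⟨ x ⟩ = 0
(a ∷ p) ⟨ x ⟩ = a ℕ.+ x ℕ.* p ⟨ x ⟩

------------------------------------------------------------------------
-- Polynomial time.  The machine model is the first-order call-by-value
-- functional language over binary trees (pure first-order Lisp, or Jones's
-- language F), whose polynomial-time functions are those of Turing machines.
-- Each syntax node evaluated costs one step.  This is an honest unit cost:
-- trees are immutable, so every construct only copies, follows or allocates
-- a pointer, and there is no built-in arithmetic or equality on trees.  Sharing
-- cannot hide the size of an answer either: the suffixes of a list are distinct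
-- trees, so each element of an output list costs a step of its own.

data Tree : Set where
  leaf : Tree
  node : Tree → Tree → Tree

size : Tree → ℕ
size leaf       = 1
size (node s t) = suc (size s ℕ.+ size t)

-- Exp m k: expressions over m unary function symbols and k variables.
data Exp (m k : ℕ) : Set where
  var  : Fin k → Exp m k
  leaf : Exp m k
  node : Exp m k → Exp m k → Exp m k
  case : Exp m k → Exp m k → Exp m (suc (suc k)) → Exp m k
  bind : Exp m k → Exp m (suc k) → Exp m k
  call : Fin m → Exp m k → Exp m k

record Program : Set where
  field
    {#functions} : ℕ
    bodies       : Vec (Exp #functions 1) #functions
    main         : Exp #functions 1

-- Given function bodies B and environment ρ, e evaluates to t in c steps.
-- At most one rule applies to each expression and values of its subexpressions,
-- so evaluation is deterministic.
data _∣_⊢_⇓_[_] {m} (B : Vec (Exp m 1) m) {k} (ρ : Vec Tree k) :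
                Exp m k → Tree → ℕ → Set where

  var : ∀ i → B ∣ ρ ⊢ var i ⇓ lookup ρ i [ 1 ]

  leaf : B ∣ ρ ⊢ leaf ⇓ leaf [ 1 ]

  node : ∀ {e₁ e₂ t₁ t₂ c₁ c₂} →
         B ∣ ρ ⊢ e₁ ⇓ t₁ [ c₁ ] → B ∣ ρ ⊢ e₂ ⇓ t₂ [ c₂ ] →
         B ∣ ρ ⊢ node e₁ e₂ ⇓ node t₁ t₂ [ suc (c₁ ℕ.+ c₂) ]

  case-leaf : ∀ {e e₁ e₂ t c c′} →
              B ∣ ρ ⊢ e ⇓ leaf [ c ] → B ∣ ρ ⊢ e₁ ⇓ t [ c′ ] →
              B ∣ ρ ⊢ case e e₁ e₂ ⇓ t [ suc (c ℕ.+ c′) ]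

  case-node : ∀ {e e₁ e₂ l r t c c′} →
              B ∣ ρ ⊢ e ⇓ node l r [ c ] → B ∣ l ∷ r ∷ ρ ⊢ e₂ ⇓ t [ c′ ] →
              B ∣ ρ ⊢ case e e₁ e₂ ⇓ t [ suc (c ℕ.+ c′) ]

  bind : ∀ {e e′ s t c c′} →
         B ∣ ρ ⊢ e ⇓ s [ c ] → B ∣ s ∷ ρ ⊢ e′ ⇓ t [ c′ ] →
         B ∣ ρ ⊢ bind e e′ ⇓ t [ suc (c ℕ.+ c′) ]

  call : ∀ {g e s t c c′} →
         B ∣ ρ ⊢ e ⇓ s [ c ] → B ∣ s ∷ [] ⊢ lookup B g ⇓ t [ c′ ] →
         B ∣ ρ ⊢ call g e ⇓ t [ suc (c ℕ.+ c′) ]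

_Maps_to_In_Steps : Program → Tree → Tree → ℕ → Set
P Maps s to t In c Steps = bodies ∣ s ∷ [] ⊢ main ⇓ t [ c ]
  where open Program P

------------------------------------------------------------------------
-- Encodings.  Numbers are in unary; as V and Σ are listed explicitly in the
-- input, this changes input and output sizes only polynomially.

encℕ : ℕ → Tree
encℕ zero    = leaf
encℕ (suc i) = node leaf (encℕ i)

encFin : ∀ {i} → Fin i → Tree
encFin = encℕ ∘ toℕ

encBool : Bool → Tree
encBool b = if b then node leaf leaf else leaf

encList : List Tree → Tree
encList []       = leaf
encList (t ∷ ts) = node t (encList ts)

encSubset : ∀ {n} → Subset n → Tree
encSubset e = encList (List.map encBool (Vec.toList e))

encAssignment : ∀ {n k} → Assignment n k → Tree
encAssignment f = encList (List.map encFin (Vec.toList f))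

encGate : ∀ {n} {e : Subset n} {k m} → Gate e k m → Tree
encGate (const b)     = node (encℕ 0) (encBool b)
encGate (input v _ a) = node (encℕ 1) (node (encFin v) (encFin a))
encGate (not g)       = node (encℕ 2) (encFin g)
encGate (and g h)     = node (encℕ 3) (node (encFin g) (encFin h))
encGate (or g h)      = node (encℕ 4) (node (encFin g) (encFin h))

encGates : ∀ {n} {e : Subset n} {k m} → Gates e k m → Tree
encGates []       = leaf
encGates (gs ▷ g) = node (encGate g) (encGates gs)

encCSP : ∀ {q n k} → CSP q n k → Tree
encCSP {_} {n} {k} G = node (encℕ n) (node (encℕ k) (encList
  (All.reduce (λ {e} (_ , gs) → node (encSubset e) (encGates gs)) (Ψ G))))

encInstance : ∀ {q} → Instance q → Tree
encInstance I =
  node (encCSP (G I)) (node (encAssignment (start I)) (encAssignment (end I)))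

encSequence : ∀ {q} (I : Instance q) → Sequence I → Tree
encSequence I f⃗ = encList (List.map encAssignment (List⁺.toList f⃗))

-- On every instance satisfying Promise, some program outputs a sequence
-- satisfying Goal, in time polynomial in the size of the encoded instance.
FoundInPolynomialTime : ∀ {q} → (Instance q → Set) → ((I : Instance q) → Sequence I → Set) → Set
FoundInPolynomialTime {q} Promise Goal =
  Σ Program λ P → ∃[ p ] (∀ (I : Instance q) → Promise I →
    ∃[ f⃗ ] ∃[ c ] P Maps encInstance I to encSequence I f⃗ In c Steps
                 × c ℕ.≤ p ⟨ size (encInstance I) ⟩
                 × Goal I f⃗)

{-# OPTIONS --safe #-}
module Submission where

-- Colour the vertices with K = q κ colours and reassign them one colour class after another.
-- While colour j is being processed, every hyperedge whose colours are all below j or all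
-- above j is still satisfied.  Under a uniformly random colouring the expected fraction of
-- such hyperedges is (j/K)^q + ((K-1-j)/K)^q, which by convexity is 2^(1-q) up to O(1/κ).
--
-- The colouring is chosen greedily instead.  For each j, and each of the two kinds of
-- hyperedges, the conditional expectation of their number given the colours chosen so far
-- is a martingale whose increments are at most the degree d.  So some choice of the next
-- colour increases the sum of the squared deviations from the initial values by at most
-- 2K d^2, and after n steps this sum is at most 2K n d^2 = 2K (q m)^2 / n by regularity:
-- the deviations are o(m) for all j simultaneously.  Multiplying by K^q keeps everything
-- in ℕ.
--
-- For the approximation factor, the instances with fewer than n₀ vertices are solved
-- exactly.  They have polynomially many assignments, and for each threshold s a closed
-- walk through all assignments of value at least s that are reachable from the start is
-- grown by inserting detours.

-- One colouring has to serve every j, and a sum of squares is what lets a single greedy choice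
-- watch all 2K counts: averaged over the next colour, the squared distance of a martingale from its
-- initial value grows by exactly the mean squared increment, because the cross term vanishes.
--
-- The conditional expectations are exact and cheap because an uncoloured vertex carries the average
-- weight of the K colours. The expected number of hyperedges of a kind is then a sum of products of
-- q table entries, linear in the weight of each vertex. With q and K fixed these numbers are
-- polynomially bounded, so unary arithmetic can afford them.
--
-- The number κ is the denominator of a positive rational δ that bounds ε from below. Measured
-- against 2^(q-1) times the value, there are two losses of 1/κ each: one for the hyperedges that
-- touch colour j, one for the deviations. Together they lower the value by 2/(2^(q-1) κ), which is
-- at most 1/κ since q is at least 2.

open import Data.Bool.Base as Bool using (Bool; true; false; if_then_else_)
import Data.Bool.Properties as Bool
open import Data.Empty using (⊥-elim)
open import Data.Fin.Base using (Fin; zero; suc; toℕ; fromℕ<; _↑ˡ_; _↑ʳ_)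
import Data.Fin.Properties as Fin
open import Data.Fin.Subset as Subset using (Subset; ∣_∣)
import Data.Fin.Subset.Properties as Subset
open import Data.Integer.Base as ℤ using (+[1+_]) renaming (+_ to ι_)
import Data.Integer.Properties as ℤ
open import Data.List.Base as List using (List; []; _∷_; _++_; map; foldr; filter; filterᵇ; replicate; upTo; downFrom; applyUpTo; concat; initLast; _∷ʳ′_)
import Data.List.Membership.DecPropositional as DecMembership
open import Data.List.Membership.Propositional using (_∈_; _∉_)
import Data.List.Membership.Propositional.Properties as ∈
open import Data.List.NonEmpty as List⁺ using (List⁺; _∷_)
open import Data.List.NonEmpty using (length)
import Data.List.Properties as List
open import Data.List.Relation.Binary.Subset.Propositional using (_⊆_)
open import Data.List.Relation.Unary.All as All using (All; []; _∷_)
import Data.List.Relation.Unary.All.Properties as All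
open import Data.List.Relation.Unary.AllPairs using ([]; _∷_)
open import Data.List.Relation.Unary.Any using (here; there)
open import Data.List.Relation.Unary.Linked using (Linked; []; [-]; _∷_)
open import Data.List.Relation.Unary.Unique.Propositional using (Unique)
import Data.List.Relation.Unary.Unique.Propositional.Properties as Unique
open import Data.Nat.Base as ℕ using (zero; suc; _+_; _*_; _∸_; _^_; _<_; z≤n; s≤s; pred; _<ᵇ_; _≡ᵇ_; ∣_-_∣; NonZero; >-nonZero; ≢-nonZero)
open import Data.Nat.Base using (ℕ; _≤_)
open import Data.Nat.DivMod using (_%_; _/_; [m+kn]%n≡m%n; m<n⇒m%n≡m; m<n*o⇒m/o<n; m≡m%n+[m/n]*n; m%n<n)
open import Data.Nat.GeneralisedArithmetic using (fold)
open import Data.Nat.ListAction using (sum; product)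
import Data.Nat.Properties as ℕ
open import Data.Nat.Solver using (module +-*-Solver)
open import Data.Product.Base using (_,_; proj₁; proj₂)
open import Data.Product.Base using (Σ; ∃-syntax; _×_)
open import Data.Rational.Base as ℚ using (ℚ; mkℚ; 0ℚ; 1ℚ; *≤*; fromℚᵘ; toℚᵘ)
import Data.Rational.Properties as ℚ
import Data.Rational.Solver as ℚSolver
open import Data.Rational.Unnormalised.Base as ℚᵘ using (mkℚᵘ; *≤*)
import Data.Rational.Unnormalised.Properties as ℚᵘ
open import Data.Sum.Base using (_⊎_; inj₁; inj₂)
open import Data.Unit.Base using (⊤; tt)
open import Data.Vec.Base as Vec using (Vec; []; _∷_; lookup)
import Data.Vec.Properties as Vec
open import Function.Base using (id; _∘_)
open import Relation.Binary.Definitions using (tri<; tri≈; tri>)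
open import Relation.Binary.PropositionalEquality
open import Relation.Nullary.Decidable.Core using (yes; no; does; ⌊_⌋)
open import Defs

open DecMembership ℕ._≟_ using (_∈?_)
open Gate
open ℝ

-- Polynomial bounds

infixl 6 _⊕_
infixl 7 _⊗_

-- Expressions instead of coefficient lists: composition and monotonicity, used whenever programs
-- are chained, become structural recursions. Only the final time bound is converted to the lists of
-- the statement.
data Pol : Set where
  con     : ℕ → Pol
  X       : Pol
  _⊕_ _⊗_ : Pol → Pol → Pol

⟪_⟫ : Pol → ℕ → ℕ
⟪ con a ⟫ x = a
⟪ X ⟫ x     = x
⟪ p ⊕ r ⟫ x = ⟪ p ⟫ x + ⟪ r ⟫ x
⟪ p ⊗ r ⟫ x = ⟪ p ⟫ x * ⟪ r ⟫ x

⟪⟫-mono : ∀ p {x y} → x ≤ y → ⟪ p ⟫ x ≤ ⟪ p ⟫ y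
⟪⟫-mono (con a) h = ℕ.≤-refl
⟪⟫-mono X       h = h
⟪⟫-mono (p ⊕ r) h = ℕ.+-mono-≤ (⟪⟫-mono p h) (⟪⟫-mono r h)
⟪⟫-mono (p ⊗ r) h = ℕ.*-mono-≤ (⟪⟫-mono p h) (⟪⟫-mono r h)

infixr 9 _⊚_

_⊚_ : Pol → Pol → Pol
con a   ⊚ s = con a
X       ⊚ s = s
(p ⊕ r) ⊚ s = p ⊚ s ⊕ r ⊚ s
(p ⊗ r) ⊚ s = (p ⊚ s) ⊗ (r ⊚ s)

⟪⊚⟫ : ∀ p s x → ⟪ p ⊚ s ⟫ x ≡ ⟪ p ⟫ (⟪ s ⟫ x)
⟪⊚⟫ (con a) s x = refl
⟪⊚⟫ X       s x = refl
⟪⊚⟫ (p ⊕ r) s x = cong₂ _+_ (⟪⊚⟫ p s x) (⟪⊚⟫ r s x)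
⟪⊚⟫ (p ⊗ r) s x = cong₂ _*_ (⟪⊚⟫ p s x) (⟪⊚⟫ r s x)

plus : Polynomial → Polynomial → Polynomial
plus []      r       = r
plus (a ∷ p) []      = a ∷ p
plus (a ∷ p) (b ∷ r) = a + b ∷ plus p r

scale : ℕ → Polynomial → Polynomial
scale a = List.map (a *_)

times : Polynomial → Polynomial → Polynomial
times []      r = []
times (a ∷ p) r = plus (scale a r) (0 ∷ times p r)

plus-⟨⟩ : ∀ p r x → plus p r ⟨ x ⟩ ≡ p ⟨ x ⟩ + r ⟨ x ⟩
plus-⟨⟩ []      r       x = refl
plus-⟨⟩ (a ∷ p) []      x = sym (ℕ.+-identityʳ _)
plus-⟨⟩ (a ∷ p) (b ∷ r) x rewrite plus-⟨⟩ p r x =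
  solve 5 (λ a b x p r → a :+ b :+ x :* (p :+ r) := a :+ x :* p :+ (b :+ x :* r)) refl
    a b x (p ⟨ x ⟩) (r ⟨ x ⟩)
  where open +-*-Solver

scale-⟨⟩ : ∀ a p x → scale a p ⟨ x ⟩ ≡ a * p ⟨ x ⟩
scale-⟨⟩ a []      x = sym (ℕ.*-zeroʳ a)
scale-⟨⟩ a (b ∷ p) x rewrite scale-⟨⟩ a p x =
  solve 4 (λ a b x p → a :* b :+ x :* (a :* p) := a :* (b :+ x :* p)) refl a b x (p ⟨ x ⟩)
  where open +-*-Solver

times-⟨⟩ : ∀ p r x → times p r ⟨ x ⟩ ≡ p ⟨ x ⟩ * r ⟨ x ⟩
times-⟨⟩ []      r x = refl
times-⟨⟩ (a ∷ p) r x
  rewrite plus-⟨⟩ (scale a r) (0 ∷ times p r) x | scale-⟨⟩ a r x | times-⟨⟩ p r x =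
  solve 4 (λ a x p r → a :* r :+ x :* (p :* r) := (a :+ x :* p) :* r) refl a x (p ⟨ x ⟩) (r ⟨ x ⟩)
  where open +-*-Solver

toPolynomial : Pol → Polynomial
toPolynomial (con a) = a ∷ []
toPolynomial X       = 0 ∷ 1 ∷ []
toPolynomial (p ⊕ r) = plus (toPolynomial p) (toPolynomial r)
toPolynomial (p ⊗ r) = times (toPolynomial p) (toPolynomial r)

toPolynomial-⟨⟩ : ∀ p x → toPolynomial p ⟨ x ⟩ ≡ ⟪ p ⟫ x
toPolynomial-⟨⟩ (con a) x = solve 2 (λ a x → a :+ x :* con 0 := a) refl a x
  where open +-*-Solver
toPolynomial-⟨⟩ X x = solve 1 (λ x → x :* (con 1 :+ x :* con 0) := x) refl x
  where open +-*-Solver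
toPolynomial-⟨⟩ (p ⊕ r) x =
  trans (plus-⟨⟩ (toPolynomial p) _ x) (cong₂ _+_ (toPolynomial-⟨⟩ p x) (toPolynomial-⟨⟩ r x))
toPolynomial-⟨⟩ (p ⊗ r) x =
  trans (times-⟨⟩ (toPolynomial p) _ x) (cong₂ _*_ (toPolynomial-⟨⟩ p x) (toPolynomial-⟨⟩ r x))

-- Renaming of functions and variables in expressions

⇑ : ∀ {k l} → (Fin k → Fin l) → Fin (suc k) → Fin (suc l)
⇑ θ zero    = zero
⇑ θ (suc i) = suc (θ i)

rename : ∀ {m m′ k k′} → (Fin m → Fin m′) → (Fin k → Fin k′) → Exp m k → Exp m′ k′
rename φ θ (var i)        = var (θ i)
rename φ θ leaf           = leaf
rename φ θ (node e e₁)    = node (rename φ θ e) (rename φ θ e₁)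
rename φ θ (case e e₁ e₂) = case (rename φ θ e) (rename φ θ e₁) (rename φ (⇑ (⇑ θ)) e₂)
rename φ θ (bind e e₁)    = bind (rename φ θ e) (rename φ (⇑ θ) e₁)
rename φ θ (call g e)     = call (φ g) (rename φ θ e)

module _ {m₁ m₂ m₃} (φ : Fin m₂ → Fin m₃) (φ′ : Fin m₁ → Fin m₂) where

  -- Needed when function bodies that are already linked are shifted once more to make room for a
  -- recursive function. The variable renamings are compared pointwise because lifting under binders
  -- commutes with composition only pointwise.
  rename-∘ : ∀ {k₁ k₂ k₃} {θ : Fin k₂ → Fin k₃} {θ′ : Fin k₁ → Fin k₂} {θ″ : Fin k₁ → Fin k₃} →
             (∀ i → θ (θ′ i) ≡ θ″ i) →
             ∀ e → rename φ θ (rename φ′ θ′ e) ≡ rename (φ ∘ φ′) θ″ e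
  rename-∘ h (var i)        = cong var (h i)
  rename-∘ h leaf           = refl
  rename-∘ h (node e e₁)    = cong₂ node (rename-∘ h e) (rename-∘ h e₁)
  rename-∘ h (case e e₁ e₂) = trans
    (cong₂ (λ d d₁ → case d d₁ _) (rename-∘ h e) (rename-∘ h e₁))
    (cong (case _ _) (rename-∘ (λ { zero → refl ; (suc zero) → refl
                                  ; (suc (suc i)) → cong (λ j → suc (suc j)) (h i) }) e₂))
  rename-∘ h (bind e e₁)    =
    cong₂ bind (rename-∘ h e) (rename-∘ (λ { zero → refl ; (suc i) → cong suc (h i) }) e₁)
  rename-∘ h (call g e)     = cong (call _) (rename-∘ h e)

Extends : ∀ {m m′} → (Fin m → Fin m′) → Vec (Exp m 1) m → Vec (Exp m′ 1) m′ → Set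
Extends φ B B′ = ∀ g → lookup B′ (φ g) ≡ rename φ id (lookup B g)

module _ {m m′} {φ : Fin m → Fin m′} {B B′} (B⊆B′ : Extends φ B B′) where

  -- Linking leaves the shape of every expression unchanged, so even the number of steps is
  -- preserved exactly.
  rename-⇓ : ∀ {k k′} {θ : Fin k → Fin k′} {ρ : Vec Tree k} {ρ′} {e t c} →
             (∀ i → lookup ρ′ (θ i) ≡ lookup ρ i) →
             B ∣ ρ ⊢ e ⇓ t [ c ] → B′ ∣ ρ′ ⊢ rename φ θ e ⇓ t [ c ]
  rename-⇓ {θ = θ} {ρ′ = ρ′} h (var i) =
    subst (λ t → B′ ∣ ρ′ ⊢ var (θ i) ⇓ t [ 1 ]) (h i) (var (θ i))
  rename-⇓ h leaf             = leaf
  rename-⇓ h (node d d₁)      = node (rename-⇓ h d) (rename-⇓ h d₁)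
  rename-⇓ h (case-leaf d d₁) = case-leaf (rename-⇓ h d) (rename-⇓ h d₁)
  rename-⇓ h (case-node d d₁) = case-node (rename-⇓ h d)
    (rename-⇓ (λ { zero → refl ; (suc zero) → refl ; (suc (suc i)) → h i }) d₁)
  rename-⇓ h (bind d d₁) = bind (rename-⇓ h d)
    (rename-⇓ (λ { zero → refl ; (suc i) → h i }) d₁)
  rename-⇓ {ρ′ = ρ′} h (call {g = g} {s = s} {t = t} {c′ = c′} d d₁) = call (rename-⇓ h d)
    (subst (λ e → B′ ∣ s ∷ [] ⊢ e ⇓ t [ c′ ]) (sym (B⊆B′ g)) (rename-⇓ (λ _ → refl) d₁))

module _ {m₁ m₂} (B₁ : Vec (Exp m₁ 1) m₁) (B₂ : Vec (Exp m₂ 1) m₂) where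

  union : Vec (Exp (m₁ + m₂) 1) (m₁ + m₂)
  union = Vec.map (rename (_↑ˡ m₂) id) B₁ Vec.++ Vec.map (rename (m₁ ↑ʳ_) id) B₂

  unionˡ : Extends (_↑ˡ m₂) B₁ union
  unionˡ g = trans (Vec.lookup-++ˡ (Vec.map _ B₁) _ g) (Vec.lookup-map g _ B₁)

  unionʳ : Extends (m₁ ↑ʳ_) B₂ union
  unionʳ g = trans (Vec.lookup-++ʳ (Vec.map _ B₁) _ g) (Vec.lookup-map g _ B₂)

-- Functions computable in polynomial time

record Enc (A : Set) : Set where
  field enc : A → Tree

open Enc {{...}}

instance
  enc-⊤ : Enc ⊤
  enc-⊤ = record { enc = λ _ → leaf }

  enc-Tree : Enc Tree
  enc-Tree = record { enc = id }

  enc-ℕ : Enc ℕ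
  enc-ℕ = record { enc = encℕ }

  enc-Bool : Enc Bool
  enc-Bool = record { enc = encBool }

  enc-× : ∀ {A B} {{_ : Enc A}} {{_ : Enc B}} → Enc (A × B)
  enc-× = record { enc = λ (a , b) → node (enc a) (enc b) }

  enc-List : ∀ {A} {{_ : Enc A}} → Enc (List A)
  enc-List = record { enc = encList ∘ List.map enc }

sizeOf : ∀ {A} {{_ : Enc A}} → A → ℕ
sizeOf a = size (enc a)

-- Values may share subtrees, so the running time does not bound the size of the result.
record PolyTime {A B} {{_ : Enc A}} {{_ : Enc B}} (f : A → B) : Set where
  field
    {#funs} : ℕ
    bodies  : Vec (Exp #funs 1) #funs
    main    : Exp #funs 1
    time    : Pol
    space   : Pol
    runs    : ∀ a → ∃[ c ] bodies ∣ enc a ∷ [] ⊢ main ⇓ enc (f a) [ c ] × c ≤ ⟪ time ⟫ (sizeOf a)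
    small   : ∀ a → sizeOf (f a) ≤ ⟪ space ⟫ (sizeOf a)

open PolyTime

module _ {A B} {{_ : Enc A}} {{_ : Enc B}} where

  ext : {f g : A → B} → (∀ a → f a ≡ g a) → PolyTime f → PolyTime g
  ext f≗g F = record
    { bodies = F .bodies
    ; main   = F .main
    ; time   = F .time
    ; space  = F .space
    ; runs   = λ a → let c , r , b = F .runs a in
        c , subst (λ t → F .bodies ∣ enc a ∷ [] ⊢ F .main ⇓ enc t [ c ]) (f≗g a) r , b
    ; small  = λ a → subst (λ t → sizeOf t ≤ ⟪ F .space ⟫ (sizeOf a)) (f≗g a) (F .small a)
    }

  retype : (f : A → B) → (∀ a → enc (f a) ≡ enc a) → PolyTime f
  retype f h = record
    { bodies = []
    ; main   = var zero
    ; time   = con 1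
    ; space  = X
    ; runs   = λ a → 1 , subst (λ t → [] ∣ enc a ∷ [] ⊢ var zero ⇓ t [ 1 ]) (sym (h a)) (var zero) , ℕ.≤-refl
    ; small  = λ a → ℕ.≤-reflexive (cong size (h a))
    }

  fst : PolyTime (proj₁ {A = A} {B = λ _ → B})
  fst = record
    { bodies = []
    ; main   = case (var zero) leaf (var zero)
    ; time   = con 3
    ; space  = X
    ; runs   = λ a → 3 , case-node (var zero) (var zero) , ℕ.≤-refl
    ; small  = λ (a , b) → ℕ.≤-trans (ℕ.m≤m+n _ _) (ℕ.n≤1+n _)
    }

  snd : PolyTime (proj₂ {A = A} {B = λ _ → B})
  snd = record
    { bodies = []
    ; main   = case (var zero) leaf (var (suc zero))
    ; time   = con 3
    ; space  = X
    ; runs   = λ a → 3 , case-node (var zero) (var (suc zero)) , ℕ.≤-refl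
    ; small  = λ (a , b) → ℕ.≤-trans (ℕ.m≤n+m _ (sizeOf a)) (ℕ.n≤1+n _)
    }

quoteTree : Tree → Exp 0 1
quoteTree leaf       = leaf
quoteTree (node s t) = node (quoteTree s) (quoteTree t)

quoteTree-⇓ : ∀ {ρ} t → [] ∣ ρ ⊢ quoteTree t ⇓ t [ size t ]
quoteTree-⇓ leaf       = leaf
quoteTree-⇓ (node s t) = node (quoteTree-⇓ s) (quoteTree-⇓ t)

module _ {A B} {{_ : Enc A}} {{_ : Enc B}} where

  constant : (b : B) → PolyTime {A} (λ _ → b)
  constant b = record
    { bodies = []
    ; main   = quoteTree (enc b)
    ; time   = con (sizeOf b)
    ; space  = con (sizeOf b)
    ; runs   = λ _ → _ , quoteTree-⇓ (enc b) , ℕ.≤-refl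
    ; small  = λ _ → ℕ.≤-refl
    }

module _ {A B C} {{_ : Enc A}} {{_ : Enc B}} {{_ : Enc C}} where

  infixr 9 _●_

  _●_ : {g : B → C} {f : A → B} → PolyTime g → PolyTime f → PolyTime (λ a → g (f a))
  _●_ {g} {f} Q P = record
    { bodies = union (P .bodies) (Q .bodies)
    ; main   = bind (rename (_↑ˡ _) id (P .main)) (rename (#funs P ↑ʳ_) (λ _ → zero) (Q .main))
    ; time   = con 1 ⊕ (P .time ⊕ Q .time ⊚ P .space)
    ; space  = Q .space ⊚ P .space
    ; runs   = run
    ; small  = λ a → ℕ.≤-trans (Q .small (f a)) (lift (Q .space) a)
    }
    where
    lift : ∀ p a → ⟪ p ⟫ (sizeOf (f a)) ≤ ⟪ p ⊚ P .space ⟫ (sizeOf a)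
    lift p a = subst (_ ≤_) (sym (⟪⊚⟫ p (P .space) _)) (⟪⟫-mono p (P .small a))
    run : ∀ a → _
    run a with P .runs a | Q .runs (f a)
    ... | c , r , b | c′ , r′ , b′ =
      _ , bind (rename-⇓ (unionˡ (P .bodies) _) (λ _ → refl) r)
               (rename-⇓ (unionʳ (P .bodies) _) (λ { zero → refl }) r′)
        , s≤s (ℕ.+-mono-≤ b (ℕ.≤-trans b′ (lift (Q .time) a)))

  infixr 4 _&_

  _&_ : {f : A → B} {g : A → C} → PolyTime f → PolyTime g → PolyTime (λ a → f a , g a)
  P & Q = record
    { bodies = union (P .bodies) (Q .bodies)
    ; main   = node (rename (_↑ˡ _) id (P .main)) (rename (#funs P ↑ʳ_) id (Q .main))
    ; time   = con 1 ⊕ (P .time ⊕ Q .time)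
    ; space  = con 1 ⊕ (P .space ⊕ Q .space)
    ; runs   = run
    ; small  = λ a → s≤s (ℕ.+-mono-≤ (P .small a) (Q .small a))
    }
    where
    run : ∀ a → _
    run a with P .runs a | Q .runs a
    ... | c , r , b | c′ , r′ , b′ =
      _ , node (rename-⇓ (unionˡ (P .bodies) _) (λ _ → refl) r)
               (rename-⇓ (unionʳ (P .bodies) _) (λ _ → refl) r′)
        , s≤s (ℕ.+-mono-≤ b b′)

-- Primitive recursion on lists

recList : ∀ {C X R : Set} → (C → R) → (((C × X) × List X) × R → R) → C → List X → R
recList b s c []       = b c
recList b s c (x ∷ xs) = s (((c , x) , xs) , recList b s c xs)

length<size : ∀ {A} {{_ : Enc A}} (xs : List A) → List.length xs ≤ sizeOf xs
length<size []       = z≤n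
length<size (x ∷ xs) = s≤s (ℕ.≤-trans (length<size xs) (ℕ.m≤n+m _ (sizeOf x)))

module _ {C Y R} {{_ : Enc C}} {{_ : Enc Y}} {{_ : Enc R}}
         {b : C → R} {s : ((C × Y) × List Y) × R → R} where

  -- A size bound on the results has to be supplied from outside: a step that doubles its argument
  -- is polynomial, yet iterating it is not. The bound is applied to every suffix of the list, since
  -- these are the results of the recursive calls.
  recursion : PolyTime b → PolyTime s →
              (p : Pol) → (∀ c xs → sizeOf (recList b s c xs) ≤ ⟪ p ⟫ (sizeOf (c , xs))) →
              PolyTime (λ ((c , xs) : C × List Y) → recList b s c xs)
  recursion P Q p bound = record
    { bodies = body ∷ Vec.map (rename suc id) U
    ; main   = call zero (var zero)
    ; time   = con 2 ⊕ X ⊗ q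
    ; space  = p
    ; runs   = run
    ; small  = λ (c , xs) → bound c xs
    }
    where
    U : Vec (Exp (#funs P + #funs Q) 1) (#funs P + #funs Q)
    U = union (P .bodies) (Q .bodies)

    -- The 15 is the fixed cost of one cons step, beyond running the step program and the recursive
    -- call. The argument tuple of the step has size at most 1 + N + `⟪ p ⟫ N`.
    q : Pol
    q = con 15 ⊕ P .time ⊕ Q .time ⊚ (con 1 ⊕ X ⊕ p)

    v0 : ∀ {m k} → Exp m (suc k)
    v0 = var zero
    v1 : ∀ {m k} → Exp m (suc (suc k))
    v1 = var (suc zero)
    v2 : ∀ {m k} → Exp m (suc (suc (suc k)))
    v2 = var (suc (suc zero))

    body : Exp (suc (#funs P + #funs Q)) 1
    body = case v0 leaf
      (case v1 (rename (suc ∘ (_↑ˡ _)) (λ _ → zero) (P .main))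
        (bind (node (node (node v2 v0) v1) (call zero (node v2 v1)))
              (rename (suc ∘ (#funs P ↑ʳ_)) (λ _ → zero) (Q .main))))

    B : Vec (Exp (suc (#funs P + #funs Q)) 1) (suc (#funs P + #funs Q))
    B = body ∷ Vec.map (rename suc id) U

    extends : ∀ {m} {φ : Fin m → Fin (#funs P + #funs Q)} {B₀} →
              Extends φ B₀ U → Extends (suc ∘ φ) B₀ B
    extends {φ = φ} {B₀} h g = trans (Vec.lookup-map (φ g) _ U)
      (trans (cong (rename suc id) (h g)) (rename-∘ suc φ (λ _ → refl) (lookup B₀ g)))

    -- N bounds the size of the whole input and stays fixed while the list shrinks, so every level
    -- of the recursion is charged the same `⟪ q ⟫ N`.
    evaluate : ∀ N c xs → sizeOf (c , xs) ≤ N →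
               ∃[ a ] B ∣ enc (c , xs) ∷ [] ⊢ body ⇓ enc (recList b s c xs) [ a ]
                    × a ≤ suc (List.length xs) * ⟪ q ⟫ N
    evaluate N c [] h with P .runs c
    ... | a , r , a≤ = _ ,
      case-node v (case-leaf v (rename-⇓ (extends {B₀ = P .bodies} (unionˡ (P .bodies) _)) (λ { zero → refl }) r)) ,
      (begin
        4 + a                                ≤⟨ ℕ.+-mono-≤ (ℕ.m≤m+n 4 11)
                                                  (ℕ.≤-trans a≤ (⟪⟫-mono (P .time) c≤N)) ⟩
        15 + ⟪ P .time ⟫ N                   ≤⟨ ℕ.m≤m+n _ _ ⟩
        ⟪ q ⟫ N                              ≡⟨ ℕ.*-identityˡ _ ⟨
        1 * ⟪ q ⟫ N                          ∎)
      where
      open ℕ.≤-Reasoning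
      v : ∀ {m k} {B : Vec (Exp m 1) m} {ρ : Vec Tree k} {i} → B ∣ ρ ⊢ var i ⇓ lookup ρ i [ 1 ]
      v {i = i} = var i
      c≤N : sizeOf c ≤ N
      c≤N = ℕ.≤-trans (ℕ.≤-trans (ℕ.m≤m+n _ 1) (ℕ.n≤1+n _)) h
    evaluate N c (x ∷ xs) h
      with evaluate N c xs (ℕ.≤-trans (s≤s (ℕ.+-monoʳ-≤ (sizeOf c)
             (ℕ.≤-trans (ℕ.m≤n+m (sizeOf xs) (sizeOf x)) (ℕ.n≤1+n _)))) h)
         | Q .runs (((c , x) , xs) , recList b s c xs)
    ... | a , r , a≤ | a′ , r′ , a′≤ = _ ,
      case-node v (case-node v (bind
        (node (node (node v v) v) (call (node v v) r))
        (rename-⇓ (extends {B₀ = Q .bodies} (unionʳ (P .bodies) _)) (λ { zero → refl }) r′))) ,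
      (begin
        4 + suc (suc (5 + suc (3 + a)) + a′)
          ≡⟨ solve 2 (λ a a′ → con 4 :+ (con 1 :+ (con 1 :+ (con 5 :+ (con 1 :+ (con 3 :+ a))) :+ a′))
                              := con 15 :+ a′ :+ a) refl a a′ ⟩
        15 + a′ + a
          ≤⟨ ℕ.+-mono-≤ (ℕ.+-mono-≤ (ℕ.m≤m+n 15 (⟪ P .time ⟫ N)) (ℕ.≤-trans a′≤ step-time)) a≤ ⟩
        ⟪ q ⟫ N + suc (List.length xs) * ⟪ q ⟫ N ∎)
      where
      open ℕ.≤-Reasoning
      open +-*-Solver
      v : ∀ {m k} {B : Vec (Exp m 1) m} {ρ : Vec Tree k} {i} → B ∣ ρ ⊢ var i ⇓ lookup ρ i [ 1 ]
      v {i = i} = var i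
      tail : sizeOf (c , xs) ≤ N
      tail = ℕ.≤-trans (s≤s (ℕ.+-monoʳ-≤ (sizeOf c)
               (ℕ.≤-trans (ℕ.m≤n+m (sizeOf xs) (sizeOf x)) (ℕ.n≤1+n _)))) h
      args : sizeOf (((c , x) , xs) , recList b s c xs) ≤ 1 + N + ⟪ p ⟫ N
      args = begin
        suc (suc (suc (sizeOf c + sizeOf x) + sizeOf xs) + sizeOf (recList b s c xs))
          ≡⟨ solve 4 (λ c x xs r → con 3 :+ (c :+ x) :+ xs :+ r := con 1 :+ (con 1 :+ (c :+ (con 1 :+ (x :+ xs)))) :+ r)
               refl (sizeOf c) (sizeOf x) (sizeOf xs) _ ⟩
        1 + sizeOf (c , x ∷ xs) + sizeOf (recList b s c xs)
          ≤⟨ ℕ.+-mono-≤ (s≤s h) (ℕ.≤-trans (bound c xs) (⟪⟫-mono p tail)) ⟩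
        1 + N + ⟪ p ⟫ N ∎
      step-time : ⟪ Q .time ⟫ (sizeOf (((c , x) , xs) , recList b s c xs)) ≤ ⟪ Q .time ⊚ (con 1 ⊕ X ⊕ p) ⟫ N
      step-time = subst (_ ≤_) (sym (⟪⊚⟫ (Q .time) (con 1 ⊕ X ⊕ p) N)) (⟪⟫-mono (Q .time) args)

    run : ∀ cxs → _
    run (c , xs) with evaluate (sizeOf (c , xs)) c xs ℕ.≤-refl
    ... | a , r , a≤ = _ , call (var zero) r ,
      s≤s (s≤s (ℕ.≤-trans a≤ (ℕ.*-monoˡ-≤ _
        (s≤s (ℕ.≤-trans (length<size xs) (ℕ.m≤n+m _ (sizeOf c)))))))

  -- The growth allowed per step does not depend on the result r accumulated so far. Hence nothing
  -- compounds, and the size is at most that of the base case plus one increment for each list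
  -- element.
  additive : PolyTime b → PolyTime s → (g : Pol) →
             (∀ c x xs r → sizeOf (s (((c , x) , xs) , r)) ≤ sizeOf r + ⟪ g ⟫ (sizeOf (c , x ∷ xs))) →
             PolyTime (λ ((c , xs) : C × List Y) → recList b s c xs)
  additive P Q g h = recursion P Q (P .space ⊕ X ⊗ g)
    (λ c xs → ℕ.≤-trans (bound _ c xs ℕ.≤-refl)
      (ℕ.+-monoʳ-≤ _ (ℕ.*-monoˡ-≤ _ (ℕ.≤-trans (length<size xs)
        (ℕ.≤-trans (ℕ.m≤n+m _ (sizeOf c)) (ℕ.n≤1+n _))))))
    where
    open ℕ.≤-Reasoning
    bound : ∀ N c xs → sizeOf (c , xs) ≤ N →
            sizeOf (recList b s c xs) ≤ ⟪ P .space ⟫ N + List.length xs * ⟪ g ⟫ N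
    bound N c [] N≥ = ℕ.≤-trans (P .small c) (ℕ.≤-trans
      (⟪⟫-mono (P .space) (ℕ.≤-trans (ℕ.≤-trans (ℕ.m≤m+n _ 1) (ℕ.n≤1+n _)) N≥)) (ℕ.m≤m+n _ _))
    bound N c (x ∷ xs) N≥ = begin
      sizeOf (s (((c , x) , xs) , recList b s c xs))
        ≤⟨ h c x xs _ ⟩
      sizeOf (recList b s c xs) + ⟪ g ⟫ (sizeOf (c , x ∷ xs))
        ≤⟨ ℕ.+-mono-≤ (bound N c xs (ℕ.≤-trans (s≤s (ℕ.+-monoʳ-≤ (sizeOf c)
             (ℕ.≤-trans (ℕ.m≤n+m (sizeOf xs) (sizeOf x)) (ℕ.n≤1+n _)))) N≥)) (⟪⟫-mono g N≥) ⟩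
      ⟪ P .space ⟫ N + List.length xs * ⟪ g ⟫ N + ⟪ g ⟫ N
        ≡⟨ solve 3 (λ a b g → a :+ b :+ g := a :+ (g :+ b)) refl (⟪ P .space ⟫ N) (List.length xs * ⟪ g ⟫ N) (⟪ g ⟫ N) ⟩
      ⟪ P .space ⟫ N + suc (List.length xs) * ⟪ g ⟫ N ∎
      where open +-*-Solver

-- Library of polynomial-time functions

sizeℕ : ∀ n → sizeOf n ≡ suc (2 * n)
sizeℕ zero    = refl
sizeℕ (suc n) rewrite sizeℕ n =
  solve 1 (λ n → con 1 :+ (con 1 :+ (con 1 :+ con 2 :* n)) := con 1 :+ (con 2 :* (con 1 :+ n))) refl n
  where open +-*-Solver

sizeℕ-mono : ∀ {m n} → m ≤ n → sizeOf m ≤ sizeOf n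
sizeℕ-mono {m} {n} m≤n rewrite sizeℕ m | sizeℕ n = s≤s (ℕ.*-monoʳ-≤ 2 m≤n)

n≤sizeℕ : ∀ n → n ≤ sizeOf n
n≤sizeℕ n rewrite sizeℕ n = ℕ.≤-trans (ℕ.m≤m+n n _) (ℕ.n≤1+n _)

size-+ : ∀ m n → sizeOf (m + n) ≤ sizeOf n + sizeOf m
size-+ m n rewrite sizeℕ m | sizeℕ n | sizeℕ (m + n) = ℕ.≤-trans (ℕ.n≤1+n _)
  (ℕ.≤-reflexive (solve 2 (λ m n → con 2 :+ con 2 :* (m :+ n) := con 1 :+ con 2 :* n :+ (con 1 :+ con 2 :* m)) refl m n))
  where open +-*-Solver

ticks-size : ∀ (ts : List ⊤) → sizeOf (List.length ts) ≡ sizeOf ts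
ticks-size []       = refl
ticks-size (_ ∷ ts) = cong (λ m → suc (suc m)) (ticks-size ts)

module _ {A} {{_ : Enc A}} where

  size-list : ∀ {σ} (xs : List A) → All (λ x → sizeOf x ≤ σ) xs → sizeOf xs ≤ suc (List.length xs * suc σ)
  size-list []       []       = ℕ.≤-refl
  size-list {σ} (x ∷ xs) (h ∷ hs) = s≤s (ℕ.≤-trans (ℕ.+-mono-≤ h (size-list xs hs))
    (ℕ.≤-reflexive (ℕ.+-suc σ _)))

  size-++ : (xs ys : List A) → sizeOf (xs ++ ys) ≤ sizeOf xs + sizeOf ys
  size-++ []       ys = ℕ.n≤1+n _
  size-++ (x ∷ xs) ys = s≤s (ℕ.≤-trans (ℕ.+-monoʳ-≤ (sizeOf x) (size-++ xs ys))
    (ℕ.≤-reflexive (sym (ℕ.+-assoc (sizeOf x) (sizeOf xs) _))))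

  size-∈ : (xs : List A) → All (λ x → sizeOf x ≤ sizeOf xs) xs
  size-∈ []       = []
  size-∈ (x ∷ xs) = ℕ.≤-trans (ℕ.m≤m+n _ _) (ℕ.n≤1+n _)
    ∷ All.map (λ h → ℕ.≤-trans h (ℕ.≤-trans (ℕ.m≤n+m _ (sizeOf x)) (ℕ.n≤1+n _))) (size-∈ xs)

module _ {C} {{_ : Enc C}} where

  self : PolyTime {C} (λ c → c)
  self = retype id (λ _ → refl)

  infixr 5 _∷ᴾ_

  _∷ᴾ_ : ∀ {Y} {{_ : Enc Y}} {x : C → Y} {xs : C → List Y} →
         PolyTime x → PolyTime xs → PolyTime (λ c → x c ∷ xs c)
  P ∷ᴾ Q = retype (λ (x , xs) → x ∷ xs) (λ _ → refl) ● (P & Q)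

  sucᴾ : {f : C → ℕ} → PolyTime f → PolyTime (λ c → suc (f c))
  sucᴾ P = retype (λ ((_ , n) : ⊤ × ℕ) → suc n) (λ _ → refl) ● (constant tt & P)

  ticksᴾ : {f : C → ℕ} → PolyTime f → PolyTime (λ c → replicate (f c) tt)
  ticksᴾ P = retype (λ n → replicate n tt) go ● P
    where
    go : ∀ n → enc (replicate n tt) ≡ encℕ n
    go zero    = refl
    go (suc n) = cong (node leaf) (go n)

  untickᴾ : {f : C → List ⊤} → PolyTime f → PolyTime (λ c → List.length (f c))
  untickᴾ P = retype List.length go ● P
    where
    go : ∀ (ts : List ⊤) → encℕ (List.length ts) ≡ enc ts
    go []       = refl
    go (_ ∷ ts) = cong (node leaf) (go ts)

matchList : ∀ {C X R : Set} → (C → R) → ((C × X) × List X → R) → C → List X → R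
matchList b s c []       = b c
matchList b s c (x ∷ xs) = s ((c , x) , xs)

matchℕ : ∀ {C R : Set} → (C → R) → (C × ℕ → R) → C → ℕ → R
matchℕ b s c zero    = b c
matchℕ b s c (suc n) = s (c , n)

headOr : ∀ {A : Set} → A → List A → A
headOr d []      = d
headOr d (x ∷ _) = x

nth : ∀ {A : Set} → A → ℕ → List A → A
nth d i       []       = d
nth d zero    (x ∷ xs) = x
nth d (suc i) (x ∷ xs) = nth d i xs

module _ {C Y R} {{_ : Enc C}} {{_ : Enc Y}} {{_ : Enc R}} where

  opaque

    -- A case distinction is a recursion whose step ignores the recursive result. That result is
    -- computed all the same, but its size is bounded by the larger of the two branches' bounds.
    matchListᴾ : {b : C → R} {s : (C × Y) × List Y → R} {xs : C → List Y} →
                 PolyTime b → PolyTime s → PolyTime xs → PolyTime (λ c → matchList b s c (xs c))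
    matchListᴾ {b} {s} {xs} P Q S =
      ext (λ c → go c (xs c))
        (recursion P (Q ● fst) (P .space ⊕ Q .space) bound ● (self & S))
      where
      go : ∀ (c : C) xs → recList b (λ a → s (proj₁ a)) c xs ≡ matchList b s c xs
      go c []       = refl
      go c (x ∷ xs) = refl
      bound : ∀ c xs → sizeOf (recList b (λ a → s (proj₁ a)) c xs) ≤ ⟪ P .space ⊕ Q .space ⟫ (sizeOf (c , xs))
      bound c [] = ℕ.≤-trans (ℕ.≤-trans (P .small c)
        (⟪⟫-mono (P .space) (ℕ.≤-trans (ℕ.m≤m+n _ 1) (ℕ.n≤1+n _)))) (ℕ.m≤m+n _ _)
      bound c (x ∷ xs) = ℕ.≤-trans (ℕ.≤-trans (Q .small ((c , x) , xs))
        (⟪⟫-mono (Q .space) (ℕ.≤-reflexive (cong suc (trans (cong suc (ℕ.+-assoc (sizeOf c) _ _)) (sym (ℕ.+-suc (sizeOf c) _)))))))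
        (ℕ.m≤n+m _ _)

    foldrBy : {b : C → R} {s : (C × Y) × R → R} {xs : C → List Y} →
              PolyTime b → PolyTime s → (p : Pol) →
              (∀ c xs → sizeOf (foldr (λ x r → s ((c , x) , r)) (b c) xs) ≤ ⟪ p ⟫ (sizeOf (c , xs))) →
              PolyTime xs → PolyTime (λ c → foldr (λ x r → s ((c , x) , r)) (b c) (xs c))
    foldrBy {b} {s} {xs} P Q p h S =
      ext (λ c → go c (xs c))
        (recursion P (Q ● ((fst ● fst) & snd)) p
          (λ c xs → subst (λ r → sizeOf r ≤ ⟪ p ⟫ (sizeOf (c , xs))) (sym (go c xs)) (h c xs)) ● (self & S))
      where
      go : ∀ (c : C) xs → recList b (λ (((c , x) , _) , r) → s ((c , x) , r)) c xs ≡ foldr (λ x r → s ((c , x) , r)) (b c) xs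
      go c []       = refl
      go c (x ∷ xs) = cong (λ r → s ((c , x) , r)) (go c xs)

    foldrᴾ : {b : C → R} {s : (C × Y) × R → R} {xs : C → List Y} →
             PolyTime b → PolyTime s → (g : Pol) →
             (∀ c x r → sizeOf (s ((c , x) , r)) ≤ sizeOf r + ⟪ g ⟫ (sizeOf (c , x))) →
             PolyTime xs → PolyTime (λ c → foldr (λ x r → s ((c , x) , r)) (b c) (xs c))
    foldrᴾ {b} {s} {xs} P Q g h S =
      ext (λ c → go c (xs c))
        (additive P (Q ● ((fst ● fst) & snd)) g
          (λ c x xs r → ℕ.≤-trans (h c x r) (ℕ.+-monoʳ-≤ (sizeOf r) (⟪⟫-mono g
            (s≤s (ℕ.+-monoʳ-≤ (sizeOf c) (ℕ.≤-trans (ℕ.m≤m+n _ _) (ℕ.n≤1+n _))))))) ● (self & S))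
      where
      go : ∀ (c : C) xs → recList b (λ (((c , x) , _) , r) → s ((c , x) , r)) c xs ≡ foldr (λ x r → s ((c , x) , r)) (b c) xs
      go c []       = refl
      go c (x ∷ xs) = cong (λ r → s ((c , x) , r)) (go c xs)

module _ {C R} {{_ : Enc C}} {{_ : Enc R}} where

  opaque

    matchℕᴾ : {b : C → R} {s : C × ℕ → R} {n : C → ℕ} →
              PolyTime b → PolyTime s → PolyTime n → PolyTime (λ c → matchℕ b s c (n c))
    matchℕᴾ {b} {s} {n} P Q S =
      ext (λ c → go c (n c)) (matchListᴾ P (Q ● ((fst ● fst) & untickᴾ snd)) (ticksᴾ S))
      where
      go : ∀ (c : C) n → matchList b (λ ((c , _) , ts) → s (c , List.length ts)) c (replicate n tt) ≡ matchℕ b s c n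
      go c zero    = refl
      go c (suc n) = cong (λ n → s (c , n)) (List.length-replicate n)

    ifᴾ : {b : C → Bool} {f g : C → R} →
          PolyTime b → PolyTime f → PolyTime g → PolyTime (λ c → if b c then f c else g c)
    ifᴾ {b} {f} {g} B F G =
      ext (λ c → go c (b c)) (matchListᴾ G (F ● (fst ● fst)) (retype ticks ticks-enc ● B))
      where
      ticks : Bool → List ⊤
      ticks b = if b then tt ∷ [] else []
      ticks-enc : ∀ b → enc (ticks b) ≡ enc b
      ticks-enc true  = refl
      ticks-enc false = refl
      go : ∀ c b → matchList g (λ a → f (proj₁ (proj₁ a))) c (ticks b) ≡ (if b then f c else g c)
      go c true  = refl
      go c false = refl

    foldBy : {z : C → R} {s : C × R → R} {n : C → ℕ} →
             PolyTime z → PolyTime s → (p : Pol) →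
             (∀ c n → sizeOf (fold (z c) (λ r → s (c , r)) n) ≤ ⟪ p ⟫ (sizeOf (c , n))) →
             PolyTime n → PolyTime (λ c → fold (z c) (λ r → s (c , r)) (n c))
    foldBy {z} {s} {n} Z S p h N =
      ext (λ c → go c (n c)) (foldrBy Z (S ● ((fst ● fst) & snd)) p
        (λ c ts → subst₂ _≤_ (cong sizeOf (sym (go′ c ts))) (cong (λ t → ⟪ p ⟫ (suc (sizeOf c + t))) (ticks-size ts))
           (h c (List.length ts)))
        (ticksᴾ N))
      where
      go : ∀ (c : C) n → foldr (λ (x : ⊤) r → s (c , r)) (z c) (replicate n tt) ≡ fold (z c) (λ r → s (c , r)) n
      go c zero    = refl
      go c (suc n) = cong (λ r → s (c , r)) (go c n)
      go′ : ∀ c ts → foldr (λ (x : ⊤) r → s (c , r)) (z c) ts ≡ fold (z c) (λ r → s (c , r)) (List.length ts)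
      go′ c []       = refl
      go′ c (_ ∷ ts) = cong (λ r → s (c , r)) (go′ c ts)

    foldᴾ : {z : C → R} {s : C × R → R} {n : C → ℕ} →
            PolyTime z → PolyTime s → (g : Pol) →
            (∀ c r → sizeOf (s (c , r)) ≤ sizeOf r + ⟪ g ⟫ (sizeOf c)) →
            PolyTime n → PolyTime (λ c → fold (z c) (λ r → s (c , r)) (n c))
    foldᴾ {z} {s} {n} Z S g h N =
      ext (λ c → go c (n c)) (foldrᴾ Z (S ● ((fst ● fst) & snd)) g
        (λ c x r → ℕ.≤-trans (h c r) (ℕ.+-monoʳ-≤ (sizeOf r) (⟪⟫-mono g (ℕ.≤-trans (ℕ.m≤m+n _ 1) (ℕ.n≤1+n _)))))
        (ticksᴾ N))
      where
      go : ∀ (c : C) n → foldr (λ (x : ⊤) r → s (c , r)) (z c) (replicate n tt) ≡ fold (z c) (λ r → s (c , r)) n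
      go c zero    = refl
      go c (suc n) = cong (λ r → s (c , r)) (go c n)

module _ {C} {{_ : Enc C}} where

  opaque

    notᴾ : {b : C → Bool} → PolyTime b → PolyTime (λ c → Bool.not (b c))
    notᴾ {b} B = ext (λ c → go (b c)) (ifᴾ B (constant false) (constant true))
      where
      go : ∀ b → (if b then false else true) ≡ Bool.not b
      go true  = refl
      go false = refl

    andᴾ : {b d : C → Bool} → PolyTime b → PolyTime d → PolyTime (λ c → b c Bool.∧ d c)
    andᴾ {b} B D = ext (λ c → go (b c)) (ifᴾ B D (constant false))
      where
      go : ∀ b {d} → (if b then d else false) ≡ b Bool.∧ d
      go true  = refl
      go false = refl

    orᴾ : {b d : C → Bool} → PolyTime b → PolyTime d → PolyTime (λ c → b c Bool.∨ d c)
    orᴾ {b} B D = ext (λ c → go (b c)) (ifᴾ B (constant true) D)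
      where
      go : ∀ b {d} → (if b then true else d) ≡ b Bool.∨ d
      go true  = refl
      go false = refl

    addᴾ : {f g : C → ℕ} → PolyTime f → PolyTime g → PolyTime (λ c → f c + g c)
    addᴾ {f} {g} F G = ext (λ c → go (f c) (g c)) (foldᴾ G (sucᴾ snd) (con 2) (λ c r → ℕ.≤-reflexive (ℕ.+-comm 2 (sizeOf r))) F)
      where
      go : ∀ m n → fold n suc m ≡ m + n
      go zero    n = refl
      go (suc m) n = cong suc (go m n)

module _ {C} {{_ : Enc C}} where

  opaque

    mulᴾ : {f g : C → ℕ} → PolyTime f → PolyTime g → PolyTime (λ c → f c * g c)
    mulᴾ {f} {g} F G = ext (λ c → go (f c) (g c))
      (foldᴾ (constant 0) (addᴾ (G ● fst) snd) (G .space)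
        (λ c r → ℕ.≤-trans (size-+ (g c) r) (ℕ.+-monoʳ-≤ (sizeOf r) (G .small c))) F)
      where
      go : ∀ m n → fold 0 (n +_) m ≡ m * n
      go zero    n = refl
      go (suc m) n = cong (n +_) (go m n)

    predᴾ : {f : C → ℕ} → PolyTime f → PolyTime (λ c → pred (f c))
    predᴾ {f} F = ext (λ c → go c (f c)) (matchℕᴾ (constant 0) snd F)
      where
      go : ∀ (c : C) n → matchℕ (λ _ → 0) proj₂ c n ≡ pred n
      go c zero    = refl
      go c (suc n) = refl

module _ {C} {{_ : Enc C}} where

  opaque

    monusᴾ : {f g : C → ℕ} → PolyTime f → PolyTime g → PolyTime (λ c → f c ∸ g c)
    monusᴾ {f} {g} F G = ext (λ c → go (f c) (g c))
      (foldᴾ F (predᴾ snd) (con 0)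
        (λ c r → ℕ.≤-trans (sizeℕ-mono ℕ.pred[n]≤n) (ℕ.≤-reflexive (sym (ℕ.+-identityʳ _)))) G)
      where
      go : ∀ m n → fold m pred n ≡ m ∸ n
      go m zero    = refl
      go m (suc n) = trans (cong pred (go m n)) (ℕ.pred[m∸n]≡m∸[1+n] m n)

    distᴾ : {f g : C → ℕ} → PolyTime f → PolyTime g → PolyTime (λ c → ∣ f c - g c ∣)
    distᴾ {f} {g} F G = ext (λ c → go (f c) (g c)) (addᴾ (monusᴾ F G) (monusᴾ G F))
      where
      go : ∀ m n → (m ∸ n) + (n ∸ m) ≡ ∣ m - n ∣
      go zero    zero    = refl
      go zero    (suc n) = refl
      go (suc m) zero    = ℕ.+-identityʳ _
      go (suc m) (suc n) = go m n

    isPosᴾ : {f : C → ℕ} → PolyTime f → PolyTime (λ c → 0 <ᵇ f c)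
    isPosᴾ {f} F = ext (λ c → go c (f c)) (matchℕᴾ (constant false) (constant true) F)
      where
      go : ∀ (c : C) n → matchℕ (λ _ → false) (λ _ → true) c n ≡ (0 <ᵇ n)
      go c zero    = refl
      go c (suc n) = refl

    ltᴾ : {f g : C → ℕ} → PolyTime f → PolyTime g → PolyTime (λ c → f c <ᵇ g c)
    ltᴾ {f} {g} F G = ext (λ c → go (f c) (g c)) (isPosᴾ (monusᴾ G F))
      where
      go : ∀ m n → (0 <ᵇ (n ∸ m)) ≡ (m <ᵇ n)
      go zero    n       = refl
      go (suc m) zero    = refl
      go (suc m) (suc n) = go m n

    eqᴾ : {f g : C → ℕ} → PolyTime f → PolyTime g → PolyTime (λ c → f c ≡ᵇ g c)
    eqᴾ {f} {g} F G = ext (λ c → go (f c) (g c)) (notᴾ (isPosᴾ (distᴾ F G)))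
      where
      go : ∀ m n → Bool.not (0 <ᵇ ∣ m - n ∣) ≡ (m ≡ᵇ n)
      go zero    zero    = refl
      go zero    (suc n) = refl
      go (suc m) zero    = refl
      go (suc m) (suc n) = go m n

module _ {C} {{_ : Enc C}} where

  opaque

    sumᴾ : {f : C → List ℕ} → PolyTime f → PolyTime (λ c → sum (f c))
    sumᴾ F = foldrᴾ (constant 0) (addᴾ (snd ● fst) snd) X
      (λ c x r → ℕ.≤-trans (size-+ x r) (ℕ.+-monoʳ-≤ (sizeOf r) (ℕ.≤-trans (ℕ.m≤n+m _ (sizeOf c)) (ℕ.n≤1+n _)))) F

    -- Recursion over n units sees at each position how many units remain, and this number is the
    -- entry to be listed.
    downFromᴾ : {n : C → ℕ} → PolyTime n → PolyTime (λ c → downFrom (n c))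
    downFromᴾ {n} N = ext (λ c → go c (n c))
      (additive (constant []) (untickᴾ (snd ● fst) ∷ᴾ snd) X bound ● (self & ticksᴾ N))
      where
      step : ((C × ⊤) × List ⊤) × List ℕ → List ℕ
      step ((_ , ts) , r) = List.length ts ∷ r
      go : ∀ (c : C) n → recList (λ _ → []) step c (replicate n tt) ≡ downFrom n
      go c zero    = refl
      go c (suc n) = cong₂ _∷_ (List.length-replicate n) (go c n)
      bound : ∀ (c : C) (x : ⊤) (ts : List ⊤) (r : List ℕ) → sizeOf (List.length ts ∷ r) ≤ sizeOf r + sizeOf (c , x ∷ ts)
      bound c x ts r rewrite ticks-size ts = ℕ.≤-trans
        (ℕ.≤-reflexive (trans (cong suc (ℕ.+-comm (sizeOf ts) (sizeOf r))) (sym (ℕ.+-suc (sizeOf r) _))))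
        (ℕ.+-monoʳ-≤ (sizeOf r) (s≤s (ℕ.≤-trans (ℕ.≤-trans (ℕ.n≤1+n _) (ℕ.n≤1+n _)) (ℕ.m≤n+m _ (sizeOf c)))))

module _ {C Y} {{_ : Enc C}} {{_ : Enc Y}} where

  opaque

    lengthᴾ : {xs : C → List Y} → PolyTime xs → PolyTime (λ c → List.length (xs c))
    lengthᴾ = foldrᴾ (constant 0) (sucᴾ snd) (con 2) (λ c x r → ℕ.≤-reflexive (ℕ.+-comm 2 (sizeOf r)))

    appendᴾ : {xs ys : C → List Y} → PolyTime xs → PolyTime ys → PolyTime (λ c → xs c ++ ys c)
    appendᴾ {xs} {ys} S T = ext (λ c → go (xs c) (ys c))
      (foldrᴾ T ((snd ● fst) ∷ᴾ snd) X (λ c x r → ℕ.≤-trans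
        (ℕ.≤-reflexive (trans (cong suc (ℕ.+-comm (sizeOf x) (sizeOf r))) (sym (ℕ.+-suc (sizeOf r) _))))
        (ℕ.+-monoʳ-≤ (sizeOf r) (s≤s (ℕ.m≤n+m _ (sizeOf c))))) S)
      where
      go : (xs ys : List Y) → foldr _∷_ ys xs ≡ xs ++ ys
      go []       ys = refl
      go (x ∷ xs) ys = cong (x ∷_) (go xs ys)

module _ {C Y} {{_ : Enc C}} {{_ : Enc Y}} where

  opaque

    concatᴾ : {xss : C → List (List Y)} → PolyTime xss → PolyTime (λ c → concat (xss c))
    concatᴾ = foldrᴾ (constant []) (appendᴾ (snd ● fst) snd) X
      (λ c x r → ℕ.≤-trans (size-++ x r) (ℕ.≤-trans (ℕ.≤-reflexive (ℕ.+-comm (sizeOf x) _))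
        (ℕ.+-monoʳ-≤ (sizeOf r) (ℕ.≤-trans (ℕ.m≤n+m _ (sizeOf c)) (ℕ.n≤1+n _)))))

    filterᴾ : {p : C × Y → Bool} {xs : C → List Y} → PolyTime p → PolyTime xs →
              PolyTime (λ c → filterᵇ (λ x → p (c , x)) (xs c))
    filterᴾ {p} {xs} P S = ext (λ c → go c (xs c))
      (foldrᴾ (constant []) (ifᴾ (P ● fst) ((snd ● fst) ∷ᴾ snd) snd) X bound S)
      where
      keep : (C × Y) × List Y → List Y
      keep ((c , x) , r) = if p (c , x) then x ∷ r else r
      go : ∀ (c : C) xs → foldr (λ x r → keep ((c , x) , r)) [] xs ≡ filterᵇ (λ x → p (c , x)) xs
      go c [] = refl
      go c (x ∷ xs) with p (c , x)
      ... | true  = cong (x ∷_) (go c xs)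
      ... | false = go c xs
      bound : ∀ c x r → sizeOf (keep ((c , x) , r)) ≤ sizeOf r + sizeOf (c , x)
      bound c x r with p (c , x)
      ... | true  = ℕ.≤-trans
        (ℕ.≤-reflexive (trans (cong suc (ℕ.+-comm (sizeOf x) (sizeOf r))) (sym (ℕ.+-suc (sizeOf r) _))))
        (ℕ.+-monoʳ-≤ (sizeOf r) (s≤s (ℕ.m≤n+m _ (sizeOf c))))
      ... | false = ℕ.m≤m+n _ _

    headᴾ : ∀ d {xs : C → List Y} → PolyTime xs → PolyTime (λ c → headOr d (xs c))
    headᴾ d {xs} S = ext (λ c → go c (xs c)) (matchListᴾ (constant d) (snd ● fst) S)
      where
      go : ∀ (c : C) xs → matchList (λ _ → d) (λ ((_ , x) , _) → x) c xs ≡ headOr d xs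
      go c []      = refl
      go c (_ ∷ _) = refl

    nthᴾ : ∀ d {i : C → ℕ} {xs : C → List Y} → PolyTime i → PolyTime xs → PolyTime (λ c → nth d (i c) (xs c))
    nthᴾ d {i} {xs} I S = ext (λ c → go (i c) (xs c))
      (headᴾ d (foldᴾ S (tailᴾ snd) (con 0) (λ c r → bound r) I))
      where
      tail : List Y → List Y
      tail []       = []
      tail (_ ∷ xs) = xs
      tailᴾ : ∀ {D : Set} {{_ : Enc D}} {xs : D → List Y} → PolyTime xs → PolyTime (λ c → tail (xs c))
      tailᴾ {D} {xs = xs} S = ext (λ c → tail-go c (xs c)) (matchListᴾ (constant []) snd S)
        where
        tail-go : ∀ (c : D) xs → matchList (λ _ → []) proj₂ c xs ≡ tail xs
        tail-go c []      = refl
        tail-go c (_ ∷ _) = refl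
      bound : ∀ r → sizeOf (tail r) ≤ sizeOf r + 0
      bound []       = ℕ.≤-refl
      bound (x ∷ xs) = ℕ.≤-trans (ℕ.≤-trans (ℕ.m≤n+m _ (sizeOf x)) (ℕ.n≤1+n _)) (ℕ.m≤m+n _ 0)
      peel : ∀ (xs : List Y) i → fold (tail xs) tail i ≡ tail (fold xs tail i)
      peel xs zero    = refl
      peel xs (suc i) = cong tail (peel xs i)
      go[] : ∀ i → fold [] tail i ≡ []
      go[] zero    = refl
      go[] (suc i) = cong tail (go[] i)
      go : ∀ i xs → headOr d (fold xs tail i) ≡ nth d i xs
      go zero    []       = refl
      go zero    (x ∷ xs) = refl
      go (suc i) []       = cong (headOr d) (go[] (suc i))
      go (suc i) (x ∷ xs) = trans (cong (headOr d) (sym (peel (x ∷ xs) i))) (go i xs)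

module _ {C Y Z} {{_ : Enc C}} {{_ : Enc Y}} {{_ : Enc Z}} where

  opaque

    mapᴾ : {f : C × Y → Z} {xs : C → List Y} → PolyTime f → PolyTime xs →
           PolyTime (λ c → map (λ x → f (c , x)) (xs c))
    mapᴾ {f} {xs} F S = ext (λ c → go c (xs c))
      (foldrᴾ (constant []) ((F ● fst) ∷ᴾ snd) (con 1 ⊕ F .space)
        (λ c x r → ℕ.≤-trans (s≤s (ℕ.+-monoˡ-≤ (sizeOf r) (F .small (c , x))))
          (ℕ.≤-reflexive (ℕ.+-comm (suc (⟪ F .space ⟫ (sizeOf (c , x)))) (sizeOf r)))) S)
      where
      go : ∀ (c : C) xs → foldr (λ x r → f (c , x) ∷ r) [] xs ≡ map (λ x → f (c , x)) xs
      go c []       = refl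
      go c (x ∷ xs) = cong (f (c , x) ∷_) (go c xs)

module _ {C} {{_ : Enc C}} where

  opaque

    -- Each round increments all entries, so the growth depends on the list built so far and `foldᴾ`
    -- does not apply. The size bound comes from knowing the intermediate results: n entries, each
    -- below n.
    upToᴾ : {n : C → ℕ} → PolyTime n → PolyTime (λ c → upTo (n c))
    upToᴾ {n} N = ext (λ c → go (n c))
      (foldBy (constant []) (constant 0 ∷ᴾ mapᴾ (sucᴾ snd) snd) (con 1 ⊕ X ⊗ (con 1 ⊕ X)) bound N)
      where
      step : List ℕ → List ℕ
      step r = 0 ∷ map suc r
      go : ∀ n → fold [] step n ≡ upTo n
      go zero    = refl
      go (suc n) = cong (0 ∷_) (trans (cong (map suc) (go n)) (List.map-applyUpTo id suc n))
      bound : ∀ (c : C) n → sizeOf (fold [] step n) ≤ suc (sizeOf (c , n) * suc (sizeOf (c , n)))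
      bound c n rewrite go n = ℕ.≤-trans
        (size-list {σ = sizeOf (c , n)} (upTo n) (All.applyUpTo⁺₁ id n
          (λ {i} i<n → ℕ.≤-trans (sizeℕ-mono (ℕ.<⇒≤ i<n)) n-size)))
        (s≤s (ℕ.*-monoˡ-≤ (suc (sizeOf (c , n))) (subst (_≤ sizeOf (c , n)) (sym (List.length-upTo n))
          (ℕ.≤-trans (n≤sizeℕ n) n-size))))
        where
        n-size : sizeOf n ≤ sizeOf (c , n)
        n-size = ℕ.≤-trans (ℕ.m≤n+m _ (sizeOf c)) (ℕ.n≤1+n _)

-- Reads a tree as a unary number: it inverts `encℕ`, and it is positive on `encBool true` and zero
-- on `encBool false`.
spine : Tree → ℕ
spine leaf       = 0
spine (node _ t) = suc (spine t)

left right : Tree → Tree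
left leaf        = leaf
left (node s _)  = s
right leaf       = leaf
right (node _ t) = t

unroll : Tree → List Tree
unroll leaf       = []
unroll (node s t) = s ∷ unroll t

unroll-enc : ∀ t → enc (unroll t) ≡ t
unroll-enc leaf       = refl
unroll-enc (node s t) = cong (node s) (unroll-enc t)

module _ {C} {{_ : Enc C}} where

  opaque

    unrollᴾ : {t : C → Tree} → PolyTime t → PolyTime (λ c → unroll (t c))
    unrollᴾ T = retype unroll unroll-enc ● T

    spineᴾ : {t : C → Tree} → PolyTime t → PolyTime (λ c → spine (t c))
    spineᴾ {t} T = ext (λ c → go (t c)) (lengthᴾ (unrollᴾ T))
      where
      go : ∀ t → List.length (unroll t) ≡ spine t
      go leaf       = refl
      go (node s t) = cong suc (go t)

    leftᴾ : {t : C → Tree} → PolyTime t → PolyTime (λ c → left (t c))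
    leftᴾ {t} T = ext (λ c → go (t c)) (headᴾ leaf (unrollᴾ T))
      where
      go : ∀ t → headOr leaf (unroll t) ≡ left t
      go leaf       = refl
      go (node s t) = refl

    rightᴾ : {t : C → Tree} → PolyTime t → PolyTime (λ c → right (t c))
    rightᴾ {t} T = ext (λ c → go c (t c))
      (matchListᴾ (constant leaf) (retype (encList ∘ map id) (λ _ → refl) ● snd) (unrollᴾ T))
      where
      go : ∀ (c : C) t → matchList (λ _ → leaf) (λ (_ , ts) → encList (map id ts)) c (unroll t) ≡ right t
      go c leaf       = refl
      go c (node s t) = unroll-enc t

-- Evaluation of circuits

-- The first-order data whose encodings are those of gates, hyperedges and instances.
RawGate = ℕ × Tree
RawEdge = List Bool × List RawGate
RawCSP  = ℕ × ℕ × List RawEdge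
Raw     = RawCSP × List ℕ × List ℕ

-- The tags are those of `encGate`, with 4 as the remaining case. The list `bs` holds the values of
-- the earlier gates, latest first, to match the indices in a gate. On encoded circuits all
-- positions exist, so the defaults of `nth` are never read.
gateBit : List ℕ → List Bool → RawGate → Bool
gateBit f bs (tag , t) =
  if tag ≡ᵇ 0 then 0 <ᵇ spine t else
  if tag ≡ᵇ 1 then nth 0 (spine (left t)) f ≡ᵇ spine (right t) else
  if tag ≡ᵇ 2 then Bool.not (nth false (spine t) bs) else
  if tag ≡ᵇ 3 then nth false (spine (left t)) bs Bool.∧ nth false (spine (right t)) bs
              else nth false (spine (left t)) bs Bool.∨ nth false (spine (right t)) bs

-- Gates are stored latest first, so `foldr` evaluates the earliest one first and the output ends up
-- at the head.
circuitBit : List ℕ → List RawGate → Bool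
circuitBit f gs = headOr false (foldr (λ g bs → gateBit f bs g ∷ bs) [] gs)

satisfied : List ℕ → List RawEdge → ℕ
satisfied f es = List.length (filterᵇ (λ e → circuitBit f (proj₂ e)) es)

opaque

  gateBitᴾ : PolyTime (λ (((f , g) , bs) : (List ℕ × RawGate) × List Bool) → gateBit f bs g)
  gateBitᴾ =
    ifᴾ (eqᴾ tagᴾ (constant 0)) (ltᴾ (constant 0) (spineᴾ argᴾ))
    (ifᴾ (eqᴾ tagᴾ (constant 1)) (eqᴾ (nthᴾ 0 (spineᴾ (leftᴾ argᴾ)) (fst ● fst)) (spineᴾ (rightᴾ argᴾ)))
    (ifᴾ (eqᴾ tagᴾ (constant 2)) (notᴾ (nthᴾ false (spineᴾ argᴾ) snd))
    (ifᴾ (eqᴾ tagᴾ (constant 3))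
      (andᴾ (nthᴾ false (spineᴾ (leftᴾ argᴾ)) snd) (nthᴾ false (spineᴾ (rightᴾ argᴾ)) snd))
      (orᴾ (nthᴾ false (spineᴾ (leftᴾ argᴾ)) snd) (nthᴾ false (spineᴾ (rightᴾ argᴾ)) snd)))))
    where
    tagᴾ : PolyTime (λ (((f , g) , bs) : (List ℕ × RawGate) × List Bool) → proj₁ g)
    tagᴾ = fst ● (snd ● fst)
    argᴾ : PolyTime (λ (((f , g) , bs) : (List ℕ × RawGate) × List Bool) → proj₂ g)
    argᴾ = snd ● (snd ● fst)

  circuitBitᴾ : PolyTime (λ ((f , gs) : List ℕ × List RawGate) → circuitBit f gs)
  circuitBitᴾ = headᴾ false (foldrᴾ (constant []) (gateBitᴾ ● (((fst ● (fst ● fst)) & (snd ● fst)) & snd) ∷ᴾ snd)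
    (con 4) (λ (f , _) g bs → bound bs (gateBit f bs g)) snd)
    where
    bound : ∀ (bs : List Bool) (b : Bool) → sizeOf (b ∷ bs) ≤ sizeOf bs + 4
    bound bs b = ℕ.≤-trans (s≤s (ℕ.+-monoˡ-≤ (sizeOf bs) {sizeOf b} {3} (sizeBool b))) (ℕ.≤-reflexive (ℕ.+-comm 4 (sizeOf bs)))
      where
      sizeBool : ∀ (b : Bool) → sizeOf b ≤ 3
      sizeBool true  = ℕ.≤-refl
      sizeBool false = s≤s z≤n

  satisfiedᴾ : PolyTime (λ ((f , es) : List ℕ × List RawEdge) → satisfied f es)
  satisfiedᴾ = lengthᴾ (filterᴾ (circuitBitᴾ ● ((fst ● fst) & (snd ● snd))) snd)

-- The greedy colouring

-- The initial candidate 0 takes part in the comparison, so the result may be 0 even if 0 is not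
-- listed. It is used on `upTo K` with K positive, where 0 is a colour.
argmin : (ℕ → ℕ) → List ℕ → ℕ
argmin φ = foldr (λ x r → if φ x <ᵇ φ r then x else r) 0

argmin-size : ∀ φ xs → sizeOf (argmin φ xs) ≤ sizeOf xs
argmin-size φ [] = ℕ.≤-refl
argmin-size φ (x ∷ xs) with φ x <ᵇ φ (argmin φ xs)
... | true  = ℕ.≤-trans (ℕ.m≤m+n _ _) (ℕ.n≤1+n _)
... | false = ℕ.≤-trans (argmin-size φ xs) (ℕ.≤-trans (ℕ.m≤n+m _ (sizeOf x)) (ℕ.n≤1+n _))

argminᴾ : ∀ {C : Set} {{_ : Enc C}} {φ : C × ℕ → ℕ} {xs : C → List ℕ} → PolyTime φ → PolyTime xs →
          PolyTime (λ c → argmin (λ x → φ (c , x)) (xs c))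
argminᴾ {C} {φ} P S = foldrBy (constant 0) (ifᴾ (ltᴾ (P ● fst) (P ● ((fst ● fst) & snd))) (snd ● fst) snd) X
  (λ c xs → ℕ.≤-trans (argmin-size (λ x → φ (c , x)) xs) (ℕ.≤-trans (ℕ.m≤n+m _ (sizeOf c)) (ℕ.n≤1+n _))) S

members : ℕ → List Bool → List ℕ
members n e = filterᵇ (λ v → nth false v e) (upTo n)

membersᴾ : PolyTime (λ ((n , e) : ℕ × List Bool) → members n e)
membersᴾ = filterᴾ (nthᴾ false snd (snd ● fst)) (upToᴾ fst)

-- Only the first q factors are multiplied, so that for fixed q the product of any list is
-- polynomially bounded.
prodFirst : ℕ → List ℕ → ℕ
prodFirst zero    xs       = 1
prodFirst (suc q) []       = 1
prodFirst (suc q) (x ∷ xs) = x * prodFirst q xs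

prodFirstᴾ : ∀ q → PolyTime (prodFirst q)
prodFirstᴾ zero    = constant 1
prodFirstᴾ (suc q) = ext go
  (matchListᴾ (constant 1) (mulᴾ (snd ● fst) (prodFirstᴾ q ● snd)) self)
  where
  go : ∀ xs → matchList (λ _ → 1) (λ ((_ , x) , xs) → x * prodFirst q xs) xs xs ≡ prodFirst (suc q) xs
  go []      = refl
  go (_ ∷ _) = refl

-- At time t the vertices u with c(u) n + u < t have been reassigned.
frame : ℕ → List ℕ → List ℕ × List ℕ → ℕ → List ℕ
frame n cs (f , g) t = map (λ u → if nth 0 u cs * n + u <ᵇ t then nth 0 u g else nth 0 u f) (upTo n)

frameᴾ : PolyTime (λ (((n , cs) , fg) , t) → frame n cs fg t)
frameᴾ = mapᴾ {f = λ ((((n , cs) , (f , g)) , t) , u) → if nth 0 u cs * n + u <ᵇ t then nth 0 u g else nth 0 u f}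
  (ifᴾ (ltᴾ (addᴾ (mulᴾ (nthᴾ 0 snd (snd ● (fst ● (fst ● fst)))) (fst ● (fst ● (fst ● fst)))) snd) (snd ● fst))
       (nthᴾ 0 snd (snd ● (snd ● (fst ● fst))))
       (nthᴾ 0 snd (fst ● (snd ● (fst ● fst)))))
  (upToᴾ (fst ● (fst ● fst)))

module Greedy (q K : ℕ) (T : List (List ℕ)) where

  -- The vertices are coloured in order; K stands for the colour of an uncoloured vertex.
  weight : List ℕ → List ℕ → ℕ → ℕ
  weight cs w v = nth 0 (nth K v cs) w

  -- For a table `w` belonging to j, and a hyperedge with members `vs`, this is K^q times the
  -- conditional probability, given the colours `cs` of the first vertices, that all colours on the
  -- hyperedge are below j (or all above j).
  term : List ℕ → List ℕ → List ℕ → ℕ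
  term cs w vs = prodFirst q (map (weight cs w) vs)

  total : List (List ℕ) → List ℕ → List ℕ → ℕ
  total ms cs w = sum (map (term cs w) ms)

  -- Under the empty colouring every vertex is uncoloured, so the second total is the unconditional
  -- expectation.
  deviation : List (List ℕ) → List ℕ → List ℕ → ℕ
  deviation ms cs w = ∣ total ms cs w - total ms [] w ∣

  potential : List (List ℕ) → List ℕ → ℕ
  potential ms cs = sum (map (λ w → deviation ms cs w * deviation ms cs w) T)

  best : List (List ℕ) → List ℕ → ℕ
  best ms cs = argmin (λ c → potential ms (cs ++ c ∷ [])) (upTo K)

  colouring : List (List ℕ) → ℕ → List ℕ
  colouring ms = fold [] (λ cs → cs ++ best ms cs ∷ [])

  edgeMembers : RawCSP → List (List ℕ)
  edgeMembers (n , _ , es) = map (λ e → members n (proj₁ e)) es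

  -- The ranks c(u) n + u lie below K n, so the times 0 to K n lead from the start to the end.
  greedyPath : Raw → List (List ℕ)
  greedyPath (G@(n , _) , fg) = map (frame n (colouring (edgeMembers G) n) fg) (upTo (suc (K * n)))

  opaque

    termᴾ : PolyTime (λ ((cs , w) , vs) → term cs w vs)
    termᴾ = prodFirstᴾ q ● mapᴾ (nthᴾ 0 (nthᴾ K snd (fst ● (fst ● fst))) (snd ● (fst ● fst))) snd

    totalᴾ : PolyTime (λ ((ms , cs) , w) → total ms cs w)
    totalᴾ = sumᴾ (mapᴾ (termᴾ ● (((snd ● (fst ● fst)) & (snd ● fst)) & snd)) (fst ● fst))

    deviationᴾ : PolyTime (λ ((ms , cs) , w) → deviation ms cs w)
    deviationᴾ = distᴾ totalᴾ (totalᴾ ● (((fst ● fst) & constant []) & snd))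

    potentialᴾ : PolyTime (λ (ms , cs) → potential ms cs)
    potentialᴾ = sumᴾ (mapᴾ (mulᴾ deviationᴾ deviationᴾ) (constant T))

    bestᴾ : PolyTime (λ (ms , cs) → best ms cs)
    bestᴾ = argminᴾ {φ = λ ((ms , cs) , c) → potential ms (cs ++ c ∷ [])} (potentialᴾ ● ((fst ● fst) & appendᴾ (snd ● fst) (snd ∷ᴾ constant []))) (constant (upTo K))

    -- The choice of a colour depends on the whole list so far, but only one colour of bounded size
    -- is appended, so the growth is additive.
    colouringᴾ : PolyTime (λ (ms , n) → colouring ms n)
    colouringᴾ = foldᴾ {s = λ ((ms , _) , cs) → cs ++ best ms cs ∷ []} (constant []) (appendᴾ snd (bestᴾ ● ((fst ● fst) & snd) ∷ᴾ constant []))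
      (con (2 + sizeOf (upTo K)))
      (λ (ms , n) cs → ℕ.≤-trans (size-++ cs (best ms cs ∷ [])) (ℕ.+-monoʳ-≤ (sizeOf cs)
        (s≤s (ℕ.≤-trans (ℕ.+-monoˡ-≤ 1 (argmin-size (λ c → potential ms (cs ++ c ∷ [])) (upTo K)))
          (ℕ.≤-reflexive (ℕ.+-comm _ 1))))))
      snd

    edgeMembersᴾ : PolyTime edgeMembers
    edgeMembersᴾ = mapᴾ (membersᴾ ● ((fst ● fst) & (fst ● snd))) (snd ● snd)

    greedyPathᴾ : PolyTime greedyPath
    greedyPathᴾ = mapᴾ {f = λ ((G@(n , _) , fg) , t) → frame n (colouring (edgeMembers G) n) fg t} (frameᴾ ● ((((fst ● (fst ● fst)) & (colouringᴾ ● ((edgeMembersᴾ ● (fst ● fst)) & (fst ● (fst ● fst))))) & (snd ● fst)) & snd))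
      (upToᴾ (sucᴾ (mulᴾ (constant K) (fst ● fst))))

-- Exhaustive search

differences : ℕ → List ℕ → List ℕ → ℕ
differences n f g = List.length (filterᵇ (λ v → Bool.not (nth 0 v f ≡ᵇ nth 0 v g)) (upTo n))

-- Adds the detour f, u, f at the first f adjacent to u.
insert : ℕ → List ℕ → List (List ℕ) → List (List ℕ)
insert n u []      = []
insert n u (f ∷ t) = if differences n f u <ᵇ 2 then f ∷ u ∷ f ∷ t else f ∷ insert n u t

round : ℕ → List (List ℕ) → List (List ℕ) → List (List ℕ)
round n S t = foldr (insert n) t S

tour : ℕ → List (List ℕ) → List (List ℕ) → List (List ℕ)
tour n S t = fold t (round n S) (List.length S)

upToFirst : ℕ → List ℕ → List (List ℕ) → List (List ℕ)
upToFirst n g = foldr (λ f r → if differences n f g ≡ᵇ 0 then f ∷ [] else f ∷ r) []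

visits : ℕ → List ℕ → List (List ℕ) → Bool
visits n g t = 0 <ᵇ List.length (filterᵇ (λ f → differences n f g ≡ᵇ 0) t)

-- Cut off at length N, so that for fixed N the list is polynomially long.
words : ℕ → ℕ → ℕ → List (List ℕ)
words zero    n       k = [] ∷ []
words (suc N) zero    k = [] ∷ []
words (suc N) (suc n) k = concat (map (λ a → map (a ∷_) (words N n k)) (upTo k))

allowed : ℕ → Raw → ℕ → List (List ℕ)
allowed N ((n , k , es) , _) s = filterᵇ (λ f → Bool.not (satisfied f es <ᵇ s)) (words N n k)

tourFrom : ℕ → Raw → ℕ → List (List ℕ)
tourFrom N I@((n , _) , (f , _)) s = tour n (allowed N I s) (f ∷ [])

module _ {P : List ℕ → Set} (n : ℕ) where

  -- Insertions only add copies of u and of entries already present. Carried over to whole tours,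
  -- this serves twice: with a size bound for the running time, and with well-formedness and value
  -- for correctness.
  insert-All : ∀ {u t} → P u → All P t → All P (insert n u t)
  insert-All pu [] = []
  insert-All {u} {f ∷ t} pu (pf ∷ pt) with differences n f u <ᵇ 2
  ... | true  = pf ∷ pu ∷ pf ∷ pt
  ... | false = pf ∷ insert-All pu pt

  round-All : ∀ {S t} → All P S → All P t → All P (round n S t)
  round-All []        pt = pt
  round-All (pu ∷ pS) pt = insert-All pu (round-All pS pt)

  rounds-All : ∀ {S t} i → All P S → All P t → All P (fold t (round n S) i)
  rounds-All zero    pS pt = pt
  rounds-All (suc i) pS pt = round-All pS (rounds-All i pS pt)

module _ (n : ℕ) where

  insert-length : ∀ u t → List.length (insert n u t) ≤ 2 + List.length t
  insert-length u []      = z≤n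
  insert-length u (f ∷ t) with differences n f u <ᵇ 2
  ... | true  = ℕ.≤-refl
  ... | false = s≤s (insert-length u t)

  round-length : ∀ S t → List.length (round n S t) ≤ List.length S * 2 + List.length t
  round-length []      t = ℕ.≤-refl
  round-length (u ∷ S) t = ℕ.≤-trans (insert-length u (round n S t)) (s≤s (s≤s (round-length S t)))

  rounds-length : ∀ S t i → List.length (fold t (round n S) i) ≤ i * (List.length S * 2) + List.length t
  rounds-length S t zero    = ℕ.≤-refl
  rounds-length S t (suc i) = ℕ.≤-trans (round-length S _) (ℕ.≤-trans
    (ℕ.+-monoʳ-≤ (List.length S * 2) (rounds-length S t i))
    (ℕ.≤-reflexive (sym (ℕ.+-assoc (List.length S * 2) _ _))))

  insert-size : ∀ u t → sizeOf (insert n u t) ≤ 2 * sizeOf (u , t)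
  insert-size u [] = s≤s z≤n
  insert-size u (f ∷ t) with differences n f u <ᵇ 2
  ... | true  = ℕ.m+n≤o⇒m≤o _ {1 + sizeOf u + sizeOf t} (ℕ.≤-reflexive
    (solve 3 (λ f u t → con 1 :+ (f :+ (con 1 :+ (u :+ (con 1 :+ (f :+ t))))) :+ (con 1 :+ u :+ t)
      := con 2 :* (con 1 :+ (u :+ (con 1 :+ (f :+ t))))) refl (sizeOf f) (sizeOf u) (sizeOf t)))
    where open +-*-Solver
  ... | false = ℕ.≤-trans (s≤s (ℕ.+-monoʳ-≤ (sizeOf f) (insert-size u t)))
    (ℕ.m+n≤o⇒m≤o _ {1 + sizeOf f} (ℕ.≤-reflexive
      (solve 3 (λ f u t → con 1 :+ (f :+ con 2 :* (con 1 :+ (u :+ t))) :+ (con 1 :+ f)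
        := con 2 :* (con 1 :+ (u :+ (con 1 :+ (f :+ t))))) refl (sizeOf f) (sizeOf u) (sizeOf t))))
    where open +-*-Solver

opaque

  differencesᴾ : PolyTime (λ ((n , f) , g) → differences n f g)
  differencesᴾ = lengthᴾ (filterᴾ {p = λ (((_ , f) , g) , v) → Bool.not (nth 0 v f ≡ᵇ nth 0 v g)} (notᴾ (eqᴾ (nthᴾ 0 snd (snd ● (fst ● fst))) (nthᴾ 0 snd (snd ● fst)))) (upToᴾ (fst ● fst)))

  insertᴾ : PolyTime (λ ((n , u) , t) → insert n u t)
  insertᴾ = ext (λ ((n , u) , t) → go n u t) (recursion (constant [])
    (ifᴾ (ltᴾ (differencesᴾ ● (((fst ● (fst ● (fst ● fst))) & (snd ● (fst ● fst))) & (snd ● (fst ● (fst ● fst))))) (constant 2))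
         ((snd ● (fst ● fst)) ∷ᴾ (snd ● (fst ● (fst ● fst))) ∷ᴾ (snd ● (fst ● fst)) ∷ᴾ (snd ● fst))
         ((snd ● (fst ● fst)) ∷ᴾ snd))
    (con 2 ⊗ X)
    (λ (n , u) t → subst (λ r → sizeOf r ≤ 2 * sizeOf ((n , u) , t)) (sym (go n u t))
      (ℕ.≤-trans (insert-size n u t) (ℕ.*-monoʳ-≤ 2 (s≤s (ℕ.+-monoˡ-≤ (sizeOf t) (ℕ.≤-trans (ℕ.m≤n+m _ (sizeOf n)) (ℕ.n≤1+n _))))))))
    where
    step : (((ℕ × List ℕ) × List ℕ) × List (List ℕ)) × List (List ℕ) → List (List ℕ)
    step ((((n , u) , f) , t) , r) = if differences n f u <ᵇ 2 then f ∷ u ∷ f ∷ t else f ∷ r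
    go : ∀ n u t → recList (λ _ → []) step (n , u) t ≡ insert n u t
    go n u []      = refl
    go n u (f ∷ t) = cong (λ r → if differences n f u <ᵇ 2 then f ∷ u ∷ f ∷ t else f ∷ r) (go n u t)

  -- Iterating the factor 2 of `insert-size` would give an exponential bound. Instead the length,
  -- which grows by at most 2 per insertion, is multiplied by the size of the largest entry, which
  -- comes from `S` or `t`.
  roundᴾ : PolyTime (λ ((n , S) , t) → round n S t)
  roundᴾ = foldrBy {s = λ ((((n , _) , _) , u) , r) → insert n u r} snd (insertᴾ ● (((fst ● (fst ● (fst ● fst))) & (snd ● fst)) & snd))
    (con 1 ⊕ (X ⊗ con 2 ⊕ X) ⊗ (con 1 ⊕ X))
    (λ ((n , S₀) , t) S → ℕ.≤-trans (size-list (round n S t) (round-All n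
        (All.map (λ h → ℕ.≤-trans h (S-small n S₀ t S)) (size-∈ S))
        (All.map (λ h → ℕ.≤-trans h (t-small n S₀ t S)) (size-∈ t))))
      (s≤s (ℕ.*-monoˡ-≤ (suc (sizeOf (((n , S₀) , t) , S))) (ℕ.≤-trans (round-length n S t)
        (ℕ.+-mono-≤ (ℕ.*-monoˡ-≤ 2 (ℕ.≤-trans (length<size S) (S-small n S₀ t S)))
          (ℕ.≤-trans (length<size t) (t-small n S₀ t S)))))))
    (snd ● fst)
    where
    S-small : ∀ (n : ℕ) (S₀ t S : List (List ℕ)) → sizeOf S ≤ sizeOf (((n , S₀) , t) , S)
    S-small n S₀ t S = ℕ.≤-trans (ℕ.m≤n+m _ (sizeOf ((n , S₀) , t))) (ℕ.n≤1+n _)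
    t-small : ∀ (n : ℕ) (S₀ t S : List (List ℕ)) → sizeOf t ≤ sizeOf (((n , S₀) , t) , S)
    t-small n S₀ t S = ℕ.≤-trans (ℕ.m≤n+m _ (sizeOf (n , S₀))) (ℕ.≤-trans (ℕ.n≤1+n _)
      (ℕ.≤-trans (ℕ.m≤m+n _ (sizeOf S)) (ℕ.n≤1+n _)))

  tourᴾ : PolyTime (λ ((n , S) , t) → tour n S t)
  tourᴾ = foldBy {s = λ (((n , S) , _) , r) → round n S r} snd (roundᴾ ● ((fst ● fst) & snd))
    (con 1 ⊕ (X ⊗ (X ⊗ con 2) ⊕ X) ⊗ (con 1 ⊕ X))
    (λ ((n , S) , t) i → ℕ.≤-trans (size-list (fold t (round n S) i) (rounds-All n i
        (All.map (λ h → ℕ.≤-trans h (S-small n S t i)) (size-∈ S))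
        (All.map (λ h → ℕ.≤-trans h (t-small n S t i)) (size-∈ t))))
      (s≤s (ℕ.*-monoˡ-≤ (suc (sizeOf (((n , S) , t) , i))) (ℕ.≤-trans (rounds-length n S t i)
        (ℕ.+-mono-≤ (ℕ.*-mono-≤ (ℕ.≤-trans (n≤sizeℕ i) (ℕ.≤-trans (ℕ.m≤n+m _ (sizeOf ((n , S) , t))) (ℕ.n≤1+n _)))
            (ℕ.*-monoˡ-≤ 2 (ℕ.≤-trans (length<size S) (S-small n S t i))))
          (ℕ.≤-trans (length<size t) (t-small n S t i)))))))
    (lengthᴾ (snd ● fst))
    where
    S-small : ∀ (n : ℕ) (S t : List (List ℕ)) (i : ℕ) → sizeOf S ≤ sizeOf (((n , S) , t) , i)
    S-small n S t i = ℕ.≤-trans (ℕ.m≤n+m _ (sizeOf n)) (ℕ.≤-trans (ℕ.n≤1+n _)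
      (ℕ.≤-trans (ℕ.m≤m+n _ (sizeOf t)) (ℕ.≤-trans (ℕ.n≤1+n _)
      (ℕ.≤-trans (ℕ.m≤m+n _ (sizeOf i)) (ℕ.n≤1+n _)))))
    t-small : ∀ (n : ℕ) (S t : List (List ℕ)) (i : ℕ) → sizeOf t ≤ sizeOf (((n , S) , t) , i)
    t-small n S t i = ℕ.≤-trans (ℕ.m≤n+m _ (sizeOf (n , S))) (ℕ.≤-trans (ℕ.n≤1+n _)
      (ℕ.≤-trans (ℕ.m≤m+n _ (sizeOf i)) (ℕ.n≤1+n _)))

  upToFirstᴾ : PolyTime (λ ((n , g) , t) → upToFirst n g t)
  upToFirstᴾ = foldrᴾ {s = λ ((((n , g) , _) , f) , r) → if differences n f g ≡ᵇ 0 then f ∷ [] else f ∷ r} (constant [])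
    (ifᴾ (eqᴾ (differencesᴾ ● (((fst ● (fst ● (fst ● fst))) & (snd ● fst)) & (snd ● (fst ● (fst ● fst))))) (constant 0))
         ((snd ● fst) ∷ᴾ constant [])
         ((snd ● fst) ∷ᴾ snd))
    (con 2 ⊕ X)
    (λ ((n , g) , t) f r → bound (differences n f g ≡ᵇ 0) f r (ℕ.≤-trans (ℕ.m≤n+m _ (sizeOf ((n , g) , t))) (ℕ.n≤1+n _)))
    snd
    where
    bound : ∀ {N} b (f : List ℕ) (r : List (List ℕ)) → sizeOf f ≤ N →
            sizeOf (if b then f ∷ [] else f ∷ r) ≤ sizeOf r + (2 + N)
    bound true f r h = ℕ.≤-trans (s≤s (ℕ.≤-trans (ℕ.≤-reflexive (ℕ.+-comm (sizeOf f) 1)) (s≤s h)))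
      (ℕ.m≤n+m _ (sizeOf r))
    bound false f r h = ℕ.≤-trans (s≤s (ℕ.≤-trans (ℕ.≤-reflexive (ℕ.+-comm (sizeOf f) (sizeOf r))) (ℕ.+-monoʳ-≤ (sizeOf r) h)))
      (ℕ.≤-trans (ℕ.n≤1+n _) (ℕ.≤-reflexive (sym (trans (ℕ.+-suc (sizeOf r) _) (cong suc (ℕ.+-suc (sizeOf r) _))))))

  visitsᴾ : PolyTime (λ ((n , g) , t) → visits n g t)
  visitsᴾ = isPosᴾ (lengthᴾ (filterᴾ {p = λ (((n , g) , _) , f) → differences n f g ≡ᵇ 0} (eqᴾ (differencesᴾ ● (((fst ● (fst ● fst)) & snd) & (snd ● (fst ● fst)))) (constant 0)) snd))

  -- The depth N is unrolled into the program, as N nested polynomial-time constructions. With the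
  -- recursion on n left to run time, the k^n words would admit no polynomial bound.
  wordsᴾ : ∀ N → PolyTime (λ ((n , k) : ℕ × ℕ) → words N n k)
  wordsᴾ zero    = constant ([] ∷ [])
  wordsᴾ (suc N) = ext (λ (n , k) → go n k)
    (matchℕᴾ (constant ([] ∷ []))
      (concatᴾ (mapᴾ (mapᴾ ((snd ● fst) ∷ᴾ snd) (wordsᴾ N ● ((snd ● fst) & (snd ● (fst ● fst)))))
        (upToᴾ (snd ● fst))))
      fst)
    where
    go : ∀ n k → matchℕ (λ _ → [] ∷ [])
           (λ ((_ , k) , n) → concat (map (λ a → map (a ∷_) (words N n k)) (upTo k))) (n , k) n ≡ words (suc N) n k
    go zero    k = refl
    go (suc n) k = refl

  allowedᴾ : ∀ N → PolyTime (λ ((I , s) : Raw × ℕ) → allowed N I s)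
  allowedᴾ N = filterᴾ {p = λ ((((_ , _ , es) , _) , s) , f) → Bool.not (satisfied f es <ᵇ s)}
    (notᴾ (ltᴾ (satisfiedᴾ ● (snd & (snd ● (snd ● (fst ● (fst ● fst)))))) (snd ● fst)))
    (wordsᴾ N ● ((fst ● (fst ● fst)) & (fst ● (snd ● (fst ● fst)))))

  tourFromᴾ : ∀ N → PolyTime (λ ((I , s) : Raw × ℕ) → tourFrom N I s)
  tourFromᴾ N = tourᴾ ● (((fst ● (fst ● fst)) & allowedᴾ N) & ((fst ● (snd ● fst)) ∷ᴾ constant []))

module Search (N q K : ℕ) (T : List (List ℕ)) where

  open Greedy q K T

  searchStep : Raw → ℕ → List (List ℕ) → List (List ℕ)
  searchStep I@((n , _) , (_ , g)) s r =
    if visits n g (tourFrom N I s) then upToFirst n g (tourFrom N I s) else r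

  -- The thresholds descend from the number of hyperedges, so the outermost step of `foldr` belongs
  -- to the largest one, and the largest threshold at which the end is reached prevails.
  search : Raw → List (List ℕ)
  search I@((_ , _ , es) , _) = foldr (searchStep I) (greedyPath I) (downFrom (suc (List.length es)))

  bestPath : Raw → List (List ℕ)
  bestPath I@((n , _) , _) = if n <ᵇ N then search I else greedyPath I

  opaque

    tourToᴾ : PolyTime (λ ((I@((n , _) , (_ , g)) , s) : Raw × ℕ) → upToFirst n g (tourFrom N I s))
    tourToᴾ = upToFirstᴾ ● (((fst ● (fst ● fst)) & (snd ● (snd ● fst))) & tourFromᴾ N)

    searchᴾ : PolyTime search
    searchᴾ = foldrᴾ {s = λ ((I , s) , r) → searchStep I s r} greedyPathᴾ
      (ifᴾ (visitsᴾ ● (((fst ● (fst ● (fst ● fst))) & (snd ● (snd ● (fst ● fst)))) & (tourFromᴾ N ● fst)))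
           (tourToᴾ ● fst) snd)
      (tourToᴾ .space) (λ I@((n , _) , (_ , g)) s r → bound I s r (visits n g (tourFrom N I s)))
      (downFromᴾ (sucᴾ (lengthᴾ (snd ● (snd ● fst)))))
      where
      bound : ∀ I s r b → sizeOf (if b then upToFirst (proj₁ (proj₁ I)) (proj₂ (proj₂ I)) (tourFrom N I s) else r)
              ≤ sizeOf r + ⟪ tourToᴾ .space ⟫ (sizeOf (I , s))
      bound I s r true  = ℕ.≤-trans (tourToᴾ .small (I , s)) (ℕ.m≤n+m _ (sizeOf r))
      bound I s r false = ℕ.m≤m+n _ _

    bestPathᴾ : PolyTime bestPath
    bestPathᴾ = ifᴾ (ltᴾ (fst ● fst) (constant N)) searchᴾ greedyPathᴾ

-- Finite sums and squared deviations

module _ {A : Set} where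

  sum-cong : ∀ {f g : A → ℕ} {xs} → All (λ x → f x ≡ g x) xs → sum (map f xs) ≡ sum (map g xs)
  sum-cong []       = refl
  sum-cong (h ∷ hs) = cong₂ _+_ h (sum-cong hs)

  sum-mono : ∀ {f g : A → ℕ} {xs} → All (λ x → f x ≤ g x) xs → sum (map f xs) ≤ sum (map g xs)
  sum-mono []       = ℕ.≤-refl
  sum-mono (h ∷ hs) = ℕ.+-mono-≤ h (sum-mono hs)

  sum-+ : ∀ (f g : A → ℕ) xs → sum (map (λ x → f x + g x) xs) ≡ sum (map f xs) + sum (map g xs)
  sum-+ f g []       = refl
  sum-+ f g (x ∷ xs) rewrite sum-+ f g xs =
    solve 4 (λ a b c d → a :+ b :+ (c :+ d) := a :+ c :+ (b :+ d)) refl (f x) (g x) (sum (map f xs)) (sum (map g xs))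
    where open +-*-Solver

  sum-* : ∀ a (f : A → ℕ) xs → sum (map (λ x → a * f x) xs) ≡ a * sum (map f xs)
  sum-* a f []       = sym (ℕ.*-zeroʳ a)
  sum-* a f (x ∷ xs) rewrite sum-* a f xs = sym (ℕ.*-distribˡ-+ a (f x) _)

  sum-const : ∀ a (xs : List A) → sum (map (λ _ → a) xs) ≡ List.length xs * a
  sum-const a []       = refl
  sum-const a (x ∷ xs) = cong (a +_) (sum-const a xs)

module _ {A B : Set} where

  sum-swap : ∀ (f : A → B → ℕ) xs ys →
             sum (map (λ x → sum (map (f x) ys)) xs) ≡ sum (map (λ y → sum (map (λ x → f x y) xs)) ys)
  sum-swap f []       ys = sym (trans (sum-const 0 ys) (ℕ.*-zeroʳ (List.length ys)))
  sum-swap f (x ∷ xs) ys = trans (cong (sum (map (f x) ys) +_) (sum-swap f xs ys))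
    (sym (sum-+ (f x) (λ y → sum (map (λ x → f x y) xs)) ys))

∣-∣-+ : ∀ a b c d → ∣ (a + b) - (c + d) ∣ ≤ ∣ a - c ∣ + ∣ b - d ∣
∣-∣-+ a b c d = ℕ.≤-trans (ℕ.∣-∣-triangle (a + b) (c + b) (c + d))
  (ℕ.≤-reflexive (cong₂ _+_ (trans (cong₂ ∣_-_∣ (ℕ.+-comm a b) (ℕ.+-comm c b)) (ℕ.∣m+n-m+o∣≡∣n-o∣ b a c))
    (ℕ.∣m+n-m+o∣≡∣n-o∣ c b d)))

∣-∣-sum : ∀ {A : Set} (f g : A → ℕ) xs → ∣ sum (map f xs) - sum (map g xs) ∣ ≤ sum (map (λ x → ∣ f x - g x ∣) xs)
∣-∣-sum f g []       = ℕ.≤-refl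
∣-∣-sum f g (x ∷ xs) = ℕ.≤-trans (∣-∣-+ (f x) _ (g x) _) (ℕ.+-monoʳ-≤ ∣ f x - g x ∣ (∣-∣-sum f g xs))

infix 8 _²

_² : ℕ → ℕ
n ² = n * n

∣-∣² : ∀ a b → ∣ a - b ∣ ² + 2 * (a * b) ≡ a ² + b ²
∣-∣² a b with ℕ.≤-total a b
... | inj₁ a≤b = subst (λ b → ∣ a - b ∣ ² + 2 * (a * b) ≡ a ² + b ²) (ℕ.m+[n∸m]≡n a≤b)
  (trans (cong (λ d → d ² + 2 * (a * (a + (b ∸ a)))) (ℕ.∣m-m+n∣≡n a (b ∸ a)))
    (solve 2 (λ a k → k :* k :+ con 2 :* (a :* (a :+ k)) := a :* a :+ (a :+ k) :* (a :+ k)) refl a (b ∸ a)))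
  where open +-*-Solver
... | inj₂ b≤a = subst (λ a → ∣ a - b ∣ ² + 2 * (a * b) ≡ a ² + b ²) (ℕ.m+[n∸m]≡n b≤a)
  (trans (cong (λ d → d ² + 2 * ((b + (a ∸ b)) * b)) (trans (ℕ.∣-∣-comm (b + (a ∸ b)) b) (ℕ.∣m-m+n∣≡n b (a ∸ b))))
    (solve 2 (λ b k → k :* k :+ con 2 :* ((b :+ k) :* b) := (b :+ k) :* (b :+ k) :+ b :* b) refl b (a ∸ b)))
  where open +-*-Solver

-- Since z is the mean of f, the cross term between f x - z and z - z₀ sums to zero. Applied to the
-- next colour, z is the current conditional expectation and z₀ the initial one.
bias-variance : ∀ {A : Set} (f : A → ℕ) xs z z₀ → sum (map f xs) ≡ List.length xs * z →
                sum (map (λ x → ∣ f x - z₀ ∣ ²) xs) ≡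
                sum (map (λ x → ∣ f x - z ∣ ²) xs) + List.length xs * ∣ z - z₀ ∣ ²
-- The cross terms are added on both sides, so that no subtraction occurs. The squares are then
-- expanded once around z₀ and once around z.
bias-variance f xs z z₀ mean = ℕ.+-cancelʳ-≡ (2 * (l * z * z₀) + 2 * (l * z ²)) _ _ (begin
  V z₀ + (2 * (l * z * z₀) + 2 * (l * z ²))
    ≡⟨ solve 3 (λ v a b → v :+ (a :+ b) := v :+ a :+ b) refl (V z₀) _ _ ⟩
  V z₀ + 2 * (l * z * z₀) + 2 * (l * z ²)
    ≡⟨ cong (_+ 2 * (l * z ²)) (expand z₀) ⟩
  Q + l * z₀ ² + 2 * (l * z ²)
    ≡⟨ solve 4 (λ q l z w → q :+ l :* (w :* w) :+ con 2 :* (l :* (z :* z))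
         := q :+ l :* (z :* z) :+ l :* (z :* z :+ w :* w)) refl Q l z z₀ ⟩
  Q + l * z ² + l * (z ² + z₀ ²)
    ≡⟨ cong₂ _+_ (expand z) (cong (l *_) (∣-∣² z z₀)) ⟨
  V z + 2 * (l * z * z) + l * (∣ z - z₀ ∣ ² + 2 * (z * z₀))
    ≡⟨ solve 5 (λ v l z w d → v :+ con 2 :* (l :* z :* z) :+ l :* (d :+ con 2 :* (z :* w))
         := v :+ l :* d :+ (con 2 :* (l :* z :* w) :+ con 2 :* (l :* (z :* z)))) refl (V z) l z z₀ (∣ z - z₀ ∣ ²) ⟩
  V z + l * ∣ z - z₀ ∣ ² + (2 * (l * z * z₀) + 2 * (l * z ²)) ∎)
  where
  open ≡-Reasoning
  open +-*-Solver
  l Q : ℕ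
  l = List.length xs
  Q = sum (map (λ x → f x ²) xs)
  V : ℕ → ℕ
  V w = sum (map (λ x → ∣ f x - w ∣ ²) xs)
  expand : ∀ w → V w + 2 * (l * z * w) ≡ Q + l * w ²
  expand w = begin
    V w + 2 * (l * z * w)
      ≡⟨ cong (λ s → V w + 2 * (s * w)) mean ⟨
    V w + 2 * (sum (map f xs) * w)
      ≡⟨ cong (V w +_) (solve 2 (λ s w → con 2 :* (s :* w) := (con 2 :* w) :* s) refl (sum (map f xs)) w) ⟩
    V w + 2 * w * sum (map f xs)
      ≡⟨ cong (V w +_) (sum-* (2 * w) f xs) ⟨
    V w + sum (map (λ x → 2 * w * f x) xs)
      ≡⟨ sum-+ _ _ xs ⟨
    sum (map (λ x → ∣ f x - w ∣ ² + 2 * w * f x) xs)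
      ≡⟨ sum-cong (All.universal (λ x → trans
           (cong (∣ f x - w ∣ ² +_) (solve 2 (λ w x → con 2 :* w :* x := con 2 :* (x :* w)) refl w (f x)))
           (∣-∣² (f x) w)) xs) ⟩
    sum (map (λ x → f x ² + w ²) xs)
      ≡⟨ sum-+ _ _ xs ⟩
    Q + sum (map (λ _ → w ²) xs)
      ≡⟨ cong (Q +_) (sum-const (w ²) xs) ⟩
    Q + l * w ² ∎

-- Analysis of the greedy colouring

argmin-≤ : ∀ (φ : ℕ → ℕ) xs → All (λ x → φ (argmin φ xs) ≤ φ x) xs
argmin-≤ φ [] = []
argmin-≤ φ (x ∷ xs) with φ x <ᵇ φ (argmin φ xs) in eq
... | true  = ℕ.≤-refl ∷ All.map (ℕ.≤-trans (ℕ.<⇒≤ (ℕ.<ᵇ⇒< _ _ (subst Bool.T (sym eq) _)))) (argmin-≤ φ xs)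
... | false = ℕ.≮⇒≥ (λ lt → subst Bool.T eq (ℕ.<⇒<ᵇ lt)) ∷ argmin-≤ φ xs

argmin-All : ∀ {P : ℕ → Set} φ xs → P 0 → All P xs → P (argmin φ xs)
argmin-All φ [] p0 ps = p0
argmin-All φ (x ∷ xs) p0 (p ∷ ps) with φ x <ᵇ φ (argmin φ xs)
... | true  = p
... | false = argmin-All φ xs p0 ps

argmin-average : ∀ φ xs b → sum (map φ xs) ≤ List.length xs * b → 0 < List.length xs → φ (argmin φ xs) ≤ b
argmin-average φ xs@(_ ∷ _) b h _ = ℕ.*-cancelˡ-≤ (List.length xs) (ℕ.≤-trans
  (ℕ.≤-reflexive (sym (sum-const _ xs))) (ℕ.≤-trans (sum-mono {g = φ} (argmin-≤ φ xs)) h))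

nth-++ : ∀ {A : Set} (d : A) xs x u → u ≢ List.length xs → nth d u (xs ++ x ∷ []) ≡ nth d u xs
nth-++ d []       x zero    u≢ = ⊥-elim (u≢ refl)
nth-++ d []       x (suc u) u≢ = refl
nth-++ d (y ∷ xs) x zero    u≢ = refl
nth-++ d (y ∷ xs) x (suc u) u≢ = nth-++ d xs x u (u≢ ∘ cong suc)

nth-++-last : ∀ {A : Set} (d : A) xs x → nth d (List.length xs) (xs ++ x ∷ []) ≡ x
nth-++-last d []       x = refl
nth-++-last d (y ∷ xs) x = nth-++-last d xs x

nth-All : ∀ {A : Set} {P : A → Set} {d xs} → P d → All P xs → ∀ v → P (nth d v xs)
nth-All p []       v       = p
nth-All p (h ∷ hs) zero    = h
nth-All p (h ∷ hs) (suc v) = nth-All p hs v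

nth-outside : ∀ {A : Set} (d : A) xs u → List.length xs ≤ u → nth d u xs ≡ d
nth-outside d []       u       h       = refl
nth-outside d (x ∷ xs) (suc u) (s≤s h) = nth-outside d xs u h

prodFirst-product : ∀ xs → prodFirst (List.length xs) xs ≡ product xs
prodFirst-product []       = refl
prodFirst-product (x ∷ xs) = cong (x *_) (prodFirst-product xs)

product-≤ : ∀ K xs → All (_≤ K) xs → product xs ≤ K ^ List.length xs
product-≤ K []       []       = ℕ.≤-refl
product-≤ K (x ∷ xs) (h ∷ hs) = ℕ.*-mono-≤ h (product-≤ K xs hs)

product-cong : ∀ {f g : ℕ → ℕ} {vs v} → v ∉ vs → (∀ u → u ≢ v → f u ≡ g u) →
               product (map f vs) ≡ product (map g vs)
product-cong {vs = []}     v∉ h = refl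
product-cong {vs = u ∷ vs} v∉ h =
  cong₂ _*_ (h u (λ u≡v → v∉ (here (sym u≡v)))) (product-cong (v∉ ∘ there) h)

-- As v occurs exactly once, R is the product of the factors at the other vertices, and it is the
-- same for all g that agree with f there.
product-linear : ∀ (f : ℕ → ℕ) {vs v} → Unique vs → v ∈ vs →
                 ∃[ R ] (∀ g → (∀ u → u ≢ v → g u ≡ f u) → product (map g vs) ≡ g v * R)
product-linear f {u ∷ vs} (u∉ ∷ _) (here refl) = product (map f vs) , λ g h →
  cong (g u *_) (product-cong (λ u∈ → All.lookup u∉ u∈ refl) h)
product-linear f {u ∷ vs} {v} (u∉ ∷ uniq) (there v∈) with product-linear f uniq v∈
... | R , hR = f u * R , λ g h → trans (cong₂ _*_ (h u (All.lookup u∉ v∈)) (hR g h))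
  (solve 3 (λ a b R → a :* (b :* R) := b :* (a :* R)) refl (f u) (g v) R)
  where open +-*-Solver

indicator : ℕ → List ℕ → ℕ
indicator v vs = if does (v ∈? vs) then 1 else 0

-- `T-fair` makes the weight of an uncoloured vertex the average over the K colours, which turns the
-- totals into martingales. `T-bounded` keeps every term at most K^q and so bounds the increments.
module Analysis (q K : ℕ) (T : List (List ℕ))
  (0<K : 0 < K)
  (T-fair : All (λ w → sum (map (λ c → nth 0 c w) (upTo K)) ≡ K * nth 0 K w) T)
  (T-bounded : All (λ w → ∀ c → nth 0 c w ≤ K) T)
  (ms : List (List ℕ)) (ms-unique : All Unique ms) (ms-uniform : All (λ vs → List.length vs ≡ q) ms)
  where

  open Greedy q K T

  term-product : ∀ cs w {vs} → List.length vs ≡ q → term cs w vs ≡ product (map (weight cs w) vs)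
  term-product cs w {vs} h = trans
    (cong (λ l → prodFirst l (map (weight cs w) vs)) (sym (trans (List.length-map (weight cs w) vs) h)))
    (prodFirst-product (map (weight cs w) vs))

  weight-++ : ∀ cs c w u → u ≢ List.length cs → weight (cs ++ c ∷ []) w u ≡ weight cs w u
  weight-++ cs c w u h = cong (λ c → nth 0 c w) (nth-++ K cs c u h)

  weight-last : ∀ cs c w → weight (cs ++ c ∷ []) w (List.length cs) ≡ nth 0 c w
  weight-last cs c w = cong (λ c → nth 0 c w) (nth-++-last K cs c)

  weight-uncoloured : ∀ cs w → weight cs w (List.length cs) ≡ nth 0 K w
  weight-uncoloured cs w = cong (λ c → nth 0 c w) (nth-outside K cs (List.length cs) ℕ.≤-refl)

  term-≤ : ∀ cs {w vs} → (∀ c → nth 0 c w ≤ K) → List.length vs ≡ q → term cs w vs ≤ K ^ q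
  term-≤ cs {w} {vs} bounded h = subst₂ _≤_ (sym (term-product cs w h))
    (cong (K ^_) (trans (List.length-map (weight cs w) vs) h))
    (product-≤ K _ (All.map⁺ (All.universal (λ _ → bounded _) vs)))

  -- The martingale property for one hyperedge. The vertex coloured next has number `length cs`.
  -- Outside the hyperedge it changes nothing; inside, the term is linear in its weight, and
  -- fairness averages that weight.
  term-mean : ∀ cs {w vs} → sum (map (λ c → nth 0 c w) (upTo K)) ≡ K * nth 0 K w → Unique vs → List.length vs ≡ q →
              sum (map (λ c → term (cs ++ c ∷ []) w vs) (upTo K)) ≡ K * term cs w vs
  term-mean cs {w} {vs} fair uniq h with List.length cs ∈? vs
  ... | no  v∉ = trans
    (sum-cong (All.universal (λ c → trans (term-product (cs ++ c ∷ []) w h)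
      (trans (product-cong v∉ (weight-++ cs c w)) (sym (term-product cs w h)))) (upTo K)))
    (trans (sum-const _ (upTo K)) (cong (_* term cs w vs) (List.length-upTo K)))
  ... | yes v∈ with product-linear (weight cs w) uniq v∈
  ... | R , hR = begin
    sum (map (λ c → term (cs ++ c ∷ []) w vs) (upTo K))
      ≡⟨ sum-cong (All.universal (λ c → trans (term-product (cs ++ c ∷ []) w h)
           (trans (hR _ (weight-++ cs c w)) (trans (cong (_* R) (weight-last cs c w)) (ℕ.*-comm _ R)))) (upTo K)) ⟩
    sum (map (λ c → R * nth 0 c w) (upTo K))
      ≡⟨ sum-* R _ (upTo K) ⟩
    R * sum (map (λ c → nth 0 c w) (upTo K))
      ≡⟨ cong (R *_) fair ⟩
    R * (K * nth 0 K w)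
      ≡⟨ solve 3 (λ R K w → R :* (K :* w) := K :* (w :* R)) refl R K (nth 0 K w) ⟩
    K * (nth 0 K w * R)
      ≡⟨ cong (λ x → K * (x * R)) (weight-uncoloured cs w) ⟨
    K * (weight cs w (List.length cs) * R)
      ≡⟨ cong (K *_) (hR (weight cs w) (λ _ _ → refl)) ⟨
    K * product (map (weight cs w) vs)
      ≡⟨ cong (K *_) (term-product cs w h) ⟨
    K * term cs w vs ∎
    where
    open ≡-Reasoning
    open +-*-Solver

  -- Only hyperedges through the newly coloured vertex change, and both of their terms lie between 0
  -- and K^q. Summed over the hyperedges, this brings in the degree.
  term-change : ∀ cs c {w vs} → (∀ c → nth 0 c w ≤ K) → List.length vs ≡ q →
                ∣ term (cs ++ c ∷ []) w vs - term cs w vs ∣ ≤ K ^ q * indicator (List.length cs) vs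
  term-change cs c {w} {vs} bounded h with List.length cs ∈? vs
  ... | yes _  = subst (∣ term (cs ++ c ∷ []) w vs - term cs w vs ∣ ≤_) (sym (ℕ.*-identityʳ (K ^ q)))
    (ℕ.≤-trans (ℕ.∣m-n∣≤m⊔n (term (cs ++ c ∷ []) w vs) (term cs w vs))
      (ℕ.⊔-lub (term-≤ (cs ++ c ∷ []) {w} bounded h) (term-≤ cs {w} bounded h)))
  ... | no  v∉ = ℕ.≤-trans (ℕ.≤-reflexive (ℕ.m≡n⇒∣m-n∣≡0
    (trans (term-product (cs ++ c ∷ []) w h)
      (trans (product-cong v∉ (weight-++ cs c w)) (sym (term-product cs w h)))))) z≤n

  total-mean : ∀ cs {w} → sum (map (λ c → nth 0 c w) (upTo K)) ≡ K * nth 0 K w →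
               sum (map (λ c → total ms (cs ++ c ∷ []) w) (upTo K)) ≡ K * total ms cs w
  total-mean cs {w} fair = trans (sum-swap (λ c → term (cs ++ c ∷ []) w) (upTo K) ms)
    (trans (sum-cong (All.zipWith (λ (u , h) → term-mean cs {w} fair u h) (ms-unique , ms-uniform)))
      (sum-* K _ ms))

  module _ (d : ℕ) where

    total-change : ∀ cs c {w} → (∀ c → nth 0 c w ≤ K) → sum (map (indicator (List.length cs)) ms) ≤ d →
                   ∣ total ms (cs ++ c ∷ []) w - total ms cs w ∣ ≤ K ^ q * d
    total-change cs c {w} bounded deg = begin
      ∣ total ms (cs ++ c ∷ []) w - total ms cs w ∣
        ≤⟨ ∣-∣-sum (term (cs ++ c ∷ []) w) (term cs w) ms ⟩
      sum (map (λ vs → ∣ term (cs ++ c ∷ []) w vs - term cs w vs ∣) ms)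
        ≤⟨ sum-mono (All.map (term-change cs c {w} bounded) ms-uniform) ⟩
      sum (map (λ vs → K ^ q * indicator (List.length cs) vs) ms)
        ≡⟨ sum-* (K ^ q) _ ms ⟩
      K ^ q * sum (map (indicator (List.length cs)) ms)
        ≤⟨ ℕ.*-monoʳ-≤ (K ^ q) deg ⟩
      K ^ q * d ∎
      where open ℕ.≤-Reasoning

    step : ℕ
    step = List.length T * (K ^ q * d) ²

    -- The best colour does no worse than the average over all colours. After exchanging the sums,
    -- `bias-variance` splits that average into the old potential and, for each table, a variance of
    -- at most (K^q d)^2.
    potential-step : ∀ cs → sum (map (indicator (List.length cs)) ms) ≤ d →
                     potential ms (cs ++ best ms cs ∷ []) ≤ step + potential ms cs
    potential-step cs deg = argmin-average (λ c → potential ms (cs ++ c ∷ [])) (upTo K) _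
      (begin
        sum (map (λ c → sum (map (λ w → deviation ms (cs ++ c ∷ []) w ²) T)) (upTo K))
          ≡⟨ sum-swap (λ c w → deviation ms (cs ++ c ∷ []) w ²) (upTo K) T ⟩
        sum (map (λ w → sum (map (λ c → deviation ms (cs ++ c ∷ []) w ²) (upTo K))) T)
          ≡⟨ sum-cong (All.map (λ {w} fair → bias-variance (λ c → total ms (cs ++ c ∷ []) w) (upTo K) (total ms cs w) (total ms [] w)
               (trans (total-mean cs {w} fair) (cong (_* total ms cs w) (sym (List.length-upTo K))))) T-fair) ⟩
        sum (map (λ w → sum (map (λ c → ∣ total ms (cs ++ c ∷ []) w - total ms cs w ∣ ²) (upTo K))
                        + List.length (upTo K) * deviation ms cs w ²) T)
          ≤⟨ sum-mono (All.map (λ {w} bounded → ℕ.+-monoˡ-≤ (List.length (upTo K) * deviation ms cs w ²)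
               (ℕ.≤-trans (sum-mono (All.universal (λ c → ℕ.*-mono-≤ (total-change cs c {w} bounded deg) (total-change cs c {w} bounded deg)) (upTo K)))
                 (ℕ.≤-reflexive (sum-const ((K ^ q * d) ²) (upTo K))))) T-bounded) ⟩
        sum (map (λ w → List.length (upTo K) * (K ^ q * d) ² + List.length (upTo K) * deviation ms cs w ²) T)
          ≡⟨ trans (sum-+ _ _ T) (cong₂ _+_ (sum-const _ T) (sum-* (List.length (upTo K)) _ T)) ⟩
        List.length T * (List.length (upTo K) * (K ^ q * d) ²) + List.length (upTo K) * potential ms cs
          ≡⟨ solve 4 (λ t l x p → t :* (l :* x) :+ l :* p := l :* (t :* x :+ p)) refl
               (List.length T) (List.length (upTo K)) ((K ^ q * d) ²) (potential ms cs) ⟩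
        List.length (upTo K) * (step + potential ms cs) ∎)
      (subst (0 <_) (sym (List.length-upTo K)) 0<K)
      where
      open ℕ.≤-Reasoning
      open +-*-Solver

    length-colouring : ∀ n → List.length (colouring ms n) ≡ n
    length-colouring zero    = refl
    length-colouring (suc n) = trans (List.length-++ (colouring ms n))
      (trans (ℕ.+-comm _ 1) (cong suc (length-colouring n)))

    colouring-<K : ∀ n → All (_< K) (colouring ms n)
    colouring-<K zero    = []
    colouring-<K (suc n) = All.++⁺ (colouring-<K n)
      (argmin-All (λ c → potential ms (colouring ms n ++ c ∷ [])) (upTo K) 0<K (All.applyUpTo⁺₁ id K id) ∷ [])

    potential-[] : potential ms [] ≡ 0
    potential-[] = trans (sum-cong (All.universal (λ w → cong _² (ℕ.∣n-n∣≡0 (total ms [] w))) T))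
      (trans (sum-const 0 T) (ℕ.*-zeroʳ (List.length T)))

    potential-colouring : ∀ n → (∀ v → v < n → sum (map (indicator v) ms) ≤ d) →
                          potential ms (colouring ms n) ≤ n * step
    potential-colouring zero    deg = ℕ.≤-reflexive potential-[]
    potential-colouring (suc n) deg = ℕ.≤-trans
      (potential-step (colouring ms n) (subst (λ v → sum (map (indicator v) ms) ≤ d) (sym (length-colouring n)) (deg n ℕ.≤-refl)))
      (ℕ.+-monoʳ-≤ step (potential-colouring n (λ v v<n → deg v (ℕ.m<n⇒m<1+n v<n))))

    deviation-≤ : ∀ cs → All (λ w → deviation ms cs w ² ≤ potential ms cs) T
    deviation-≤ cs = go T
      where
      go : ∀ T → All (λ w → deviation ms cs w ² ≤ sum (map (λ w → deviation ms cs w ²) T)) T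
      go []      = []
      go (w ∷ T) = ℕ.m≤m+n _ _ ∷ All.map (λ h → ℕ.≤-trans h (ℕ.m≤n+m _ _)) (go T)

-- Convexity estimates

rearrangement : ∀ {a b A B} → a ≤ b → A ≤ B → a * B + b * A ≤ a * A + b * B
rearrangement {a} {b} {A} {B} a≤b A≤B = subst₂ (λ b B → a * B + b * A ≤ a * A + b * B)
  (ℕ.m+[n∸m]≡n a≤b) (ℕ.m+[n∸m]≡n A≤B)
  -- The two sides differ by exactly this product.
  (ℕ.m+n≤o⇒m≤o _ {(b ∸ a) * (B ∸ A)} (ℕ.≤-reflexive
    (solve 4 (λ a A k l → a :* (A :+ l) :+ (a :+ k) :* A :+ k :* l := a :* A :+ (a :+ k) :* (A :+ l)) refl
      a A (b ∸ a) (B ∸ A))))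
  where open +-*-Solver

-- Midpoint convexity of the power q = p + 1, and the origin of 2^(q-1). The induction step is
-- Chebyshev's sum inequality: a and b are ordered like their powers, so the mixed products do not
-- exceed the pure ones.
power-mean : ∀ p a b → (a + b) ^ suc p ≤ 2 ^ p * (a ^ suc p + b ^ suc p)
power-mean zero    a b = ℕ.≤-reflexive
  (solve 2 (λ a b → (a :+ b) :* con 1 := con 1 :* (a :* con 1 :+ b :* con 1)) refl a b)
  where open +-*-Solver
power-mean (suc p) a b = begin
  (a + b) * (a + b) ^ suc p
    ≤⟨ ℕ.*-monoʳ-≤ (a + b) (power-mean p a b) ⟩
  (a + b) * (2 ^ p * (A + B))
    ≡⟨ solve 5 (λ a b P A B → (a :+ b) :* (P :* (A :+ B)) := P :* (a :* A :+ b :* B :+ (a :* B :+ b :* A))) refl a b (2 ^ p) A B ⟩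
  2 ^ p * (a * A + b * B + (a * B + b * A))
    ≤⟨ ℕ.*-monoʳ-≤ (2 ^ p) (ℕ.+-monoʳ-≤ (a * A + b * B) (mixed (ℕ.≤-total a b))) ⟩
  2 ^ p * (a * A + b * B + (a * A + b * B))
    ≡⟨ solve 2 (λ P S → P :* (S :+ S) := (con 2 :* P) :* S) refl (2 ^ p) (a * A + b * B) ⟩
  2 ^ suc p * (a * A + b * B) ∎
  where
  open ℕ.≤-Reasoning
  open +-*-Solver
  A B : ℕ
  A = a ^ suc p
  B = b ^ suc p
  mixed : a ≤ b ⊎ b ≤ a → a * B + b * A ≤ a * A + b * B
  mixed (inj₁ h) = rearrangement h (ℕ.^-monoˡ-≤ (suc p) h)
  mixed (inj₂ h) = subst₂ _≤_ (ℕ.+-comm (b * A) (a * B)) (ℕ.+-comm (b * B) (a * A))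
    (rearrangement h (ℕ.^-monoˡ-≤ (suc p) h))

-- A mean value estimate for the power p + 1. With K = x + 1 it measures the cost of giving up one
-- colour class.
bernoulli : ∀ p x → suc x ^ suc p ≤ x ^ suc p + suc p * suc x ^ p
bernoulli zero    x = ℕ.≤-reflexive
  (solve 1 (λ x → (con 1 :+ x) :* con 1 := x :* con 1 :+ con 1 :* con 1) refl x)
  where open +-*-Solver
bernoulli (suc p) x = begin
  Y + x * Y
    ≤⟨ ℕ.+-monoʳ-≤ Y (ℕ.*-monoʳ-≤ x (bernoulli p x)) ⟩
  Y + x * (x ^ suc p + suc p * suc x ^ p)
    ≡⟨ solve 5 (λ y x X s z → y :+ x :* (X :+ s :* z) := x :* X :+ (y :+ s :* (x :* z))) refl Y x (x ^ suc p) (suc p) (suc x ^ p) ⟩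
  x * x ^ suc p + (Y + suc p * (x * suc x ^ p))
    ≤⟨ ℕ.+-monoʳ-≤ (x * x ^ suc p) (ℕ.+-monoʳ-≤ Y (ℕ.*-monoʳ-≤ (suc p) (ℕ.*-monoˡ-≤ (suc x ^ p) (ℕ.n≤1+n x)))) ⟩
  x ^ suc (suc p) + suc (suc p) * Y ∎
  where
  open ℕ.≤-Reasoning
  open +-*-Solver
  Y : ℕ
  Y = suc x ^ suc p

²-cancel-≤ : ∀ a b → a ² ≤ b ² → a ≤ b
²-cancel-≤ a b h with ℕ.≤-total a b
... | inj₁ a≤b = a≤b
... | inj₂ b≤a with ℕ.m≤n⇒m<n∨m≡n b≤a
...   | inj₂ refl = ℕ.≤-refl
...   | inj₁ b<a  = ⊥-elim (ℕ.<⇒≱ (ℕ.*-mono-< b<a b<a) h)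

-- Weight tables

sum-upTo : ∀ (f : ℕ → ℕ) K → sum (map f (upTo (suc K))) ≡ f 0 + sum (map (f ∘ suc) (upTo K))
sum-upTo f K = cong (λ xs → f 0 + sum xs)
  (trans (cong (map f) (sym (List.map-applyUpTo id suc K))) (sym (List.map-∘ (upTo K))))

sum-below : ∀ a j K → j ≤ K → sum (map (λ c → if c <ᵇ j then a else 0) (upTo K)) ≡ j * a
sum-below a zero    K       h = trans (sum-const 0 (upTo K)) (ℕ.*-zeroʳ (List.length (upTo K)))
sum-below a (suc j) (suc K) (s≤s h) =
  trans (sum-upTo (λ c → if c <ᵇ suc j then a else 0) K) (cong (a +_) (sum-below a j K h))

sum-above : ∀ a j K → sum (map (λ c → if j <ᵇ c then a else 0) (upTo K)) ≡ (K ∸ suc j) * a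
sum-above a j       zero    = refl
sum-above a zero    (suc K) = trans (sum-upTo (λ c → if 0 <ᵇ c then a else 0) K)
  (trans (sum-const a (upTo K)) (cong (_* a) (List.length-upTo K)))
sum-above a (suc j) (suc K) = trans (sum-upTo (λ c → if suc j <ᵇ c then a else 0) K) (sum-above a j K)

nth-applyUpTo : ∀ {A : Set} (d : A) f c K → c < K → nth d c (applyUpTo f K) ≡ f c
nth-applyUpTo d f zero    (suc K) h       = refl
nth-applyUpTo d f (suc c) (suc K) (s≤s h) = nth-applyUpTo d (f ∘ suc) c K h

nth-map-upTo : ∀ {A : Set} (d : A) f c K → c < K → nth d c (map f (upTo K)) ≡ f c
nth-map-upTo d f c K h = trans (cong (nth d c) (List.map-applyUpTo id f K)) (nth-applyUpTo d f c K h)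

-- The last entry of a table is the weight of an uncoloured vertex: the average of the others.
table : ℕ → (ℕ → ℕ) → ℕ → List ℕ
table K f a = map f (upTo K) ++ a ∷ []

module _ (K : ℕ) (f : ℕ → ℕ) (a : ℕ) where

  private
    length-row : List.length (map f (upTo K)) ≡ K
    length-row = trans (List.length-map f (upTo K)) (List.length-upTo K)

  table-< : ∀ {c} → c < K → nth 0 c (table K f a) ≡ f c
  table-< {c} h = trans (nth-++ 0 (map f (upTo K)) a c (λ c≡ → ℕ.<⇒≢ h (trans c≡ length-row)))
    (nth-map-upTo 0 f c K h)

  table-K : nth 0 K (table K f a) ≡ a
  table-K = subst (λ k → nth 0 k (table K f a) ≡ a) length-row (nth-++-last 0 (map f (upTo K)) a)

  table-≤ : ∀ {b} → (∀ c → f c ≤ b) → a ≤ b → ∀ c → nth 0 c (table K f a) ≤ b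
  table-≤ {b} hf ha c with ℕ.<-cmp c K
  ... | tri< c<K _ _ = subst (_≤ b) (sym (table-< c<K)) (hf c)
  ... | tri≈ _ refl _ = subst (_≤ b) (sym table-K) ha
  ... | tri> _ _ K<c = subst (_≤ b) (sym (nth-outside 0 (table K f a) c
    (subst (_≤ c) (sym (trans (List.length-++ (map f (upTo K))) (trans (ℕ.+-comm _ 1) (cong suc length-row)))) K<c))) z≤n

  table-fair : sum (map f (upTo K)) ≡ a * K →
               sum (map (λ c → nth 0 c (table K f a)) (upTo K)) ≡ K * nth 0 K (table K f a)
  table-fair h = trans (sum-cong (All.applyUpTo⁺₁ id K table-<))
    (trans h (trans (ℕ.*-comm a K) (cong (K *_) (sym table-K))))

-- Up to the factor K, the weight is the conditional probability that the colour of the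
-- vertex will be below (above) j.
below above : ℕ → ℕ → List ℕ
below K j = table K (λ c → if c <ᵇ j then K else 0) j
above K j = table K (λ c → if j <ᵇ c then K else 0) (K ∸ suc j)

tables : ℕ → List (List ℕ)
tables K = map (below K) (upTo K) ++ map (above K) (upTo K)

length-tables : ∀ K → List.length (tables K) ≡ 2 * K
length-tables K = trans (List.length-++ (map (below K) (upTo K)))
  (cong₂ _+_ (len (below K)) (trans (len (above K)) (sym (ℕ.+-identityʳ K))))
  where
  len : (f : ℕ → List ℕ) → List.length (map f (upTo K)) ≡ K
  len f = trans (List.length-map f (upTo K)) (List.length-upTo K)

All-tables : ∀ {P : List ℕ → Set} K → (∀ j → j < K → P (below K j)) → (∀ j → P (above K j)) → All P (tables K)
All-tables K hb ha = All.++⁺ (All.map⁺ (All.applyUpTo⁺₁ id K (hb _))) (All.map⁺ (All.universal ha (upTo K)))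

if-≤ : ∀ b a → (if b then a else 0) ≤ a
if-≤ true  a = ℕ.≤-refl
if-≤ false a = z≤n

tables-fair : ∀ K → All (λ w → sum (map (λ c → nth 0 c w) (upTo K)) ≡ K * nth 0 K w) (tables K)
tables-fair K = All-tables K
  (λ j h → table-fair K _ j (sum-below K j K (ℕ.<⇒≤ h)))
  (λ j → table-fair K _ (K ∸ suc j) (sum-above K j K))

tables-bounded : ∀ K → All (λ w → ∀ c → nth 0 c w ≤ K) (tables K)
tables-bounded K = All-tables K
  (λ j h → table-≤ K _ j (λ c → if-≤ (c <ᵇ j) K) (ℕ.<⇒≤ h))
  (λ j → table-≤ K _ (K ∸ suc j) (λ c → if-≤ (j <ᵇ c) K) (ℕ.m∸n≤m K (suc j)))

-- Once all vertices are coloured the weights are 0 or K. A term can then only be nonzero if every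
-- vertex of the hyperedge lies on the required side of j.
product-zero : ∀ {P : ℕ → Set} (f : ℕ → ℕ) {vs} → All (λ v → P v ⊎ f v ≡ 0) vs →
               All P vs ⊎ product (map f vs) ≡ 0
product-zero f []            = inj₁ []
product-zero f {v ∷ vs} (inj₂ h ∷ hs) = inj₂ (cong (_* product (map f vs)) h)
product-zero f {v ∷ vs} (inj₁ p ∷ hs) with product-zero f hs
... | inj₁ ps = inj₁ (p ∷ ps)
... | inj₂ h  = inj₂ (trans (cong (f v *_) h) (ℕ.*-zeroʳ (f v)))

product-constant : ∀ a (vs : List ℕ) → product (map (λ _ → a) vs) ≡ a ^ List.length vs
product-constant a []       = refl
product-constant a (v ∷ vs) = cong (a *_) (product-constant a vs)

if-zero : ∀ m n a → m < n ⊎ (if m <ᵇ n then a else 0) ≡ 0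
if-zero m n a with m <ᵇ n in eq
... | true  = inj₁ (ℕ.<ᵇ⇒< m n (subst Bool.T (sym eq) _))
... | false = inj₂ refl

-- Concentration for all colours simultaneously

module Concentration (p κ : ℕ) (0<κ : 0 < κ) where

  -- The tolerance for a deviation is the fraction 1/H of the hyperedges. The values of K and H make
  -- both relative losses equal to 1/κ: q/K for giving up colour j, and 2^(q-1) times 2/H for the
  -- two deviations.
  q K H : ℕ
  q = suc p
  K = q * κ
  H = 2 ^ q * κ

  0<K : 0 < K
  0<K = ℕ.*-mono-≤ {1} {q} (s≤s z≤n) 0<κ

  -- The squared deviations are at most 2K n (K^q d)^2 with n d = q m, and should be at most
  -- (K^q m / H)^2.
  n₀ : ℕ
  n₀ = 2 * K * (q * H) ²

  module _ {A : Set} (E : List A) (vertices : A → List ℕ) (n d : ℕ)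
    (unique : All (Unique ∘ vertices) E)
    (uniform : All (λ e → List.length (vertices e) ≡ q) E)
    (inside : All (λ e → All (_< n) (vertices e)) E)
    (regular : ∀ v → v < n → sum (map (λ e → indicator v (vertices e)) E) ≤ d)
    (handshake : n * d ≡ q * List.length E)
    (n₀≤n : n₀ ≤ n) where

    ms : List (List ℕ)
    ms = map vertices E

    open Greedy q K (tables K)
    open Analysis q K (tables K) 0<K (tables-fair K) (tables-bounded K) ms (All.map⁺ unique) (All.map⁺ uniform)

    m : ℕ
    m = List.length E

    cs : List ℕ
    cs = colouring ms n

    deviation-bound : All (λ w → H * deviation ms cs w ≤ K ^ q * m) (tables K)
    deviation-bound = All.map (λ {w} → bound {w}) (deviation-≤ d cs)
      where
      open ℕ.≤-Reasoning
      open +-*-Solver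
      instance
        nz : NonZero (2 * K * q ²)
        nz = >-nonZero (ℕ.*-mono-≤ {1} {2 * K} (ℕ.*-mono-≤ {1} {2} (s≤s z≤n) 0<K) (s≤s z≤n))
      bound : ∀ {w} → deviation ms cs w ² ≤ potential ms cs → H * deviation ms cs w ≤ K ^ q * m
      -- The factor 2K q^2 turns H^2 into `n₀`, which is at most n. A second n comes from the n
      -- steps of the colouring, and the two pair up with d^2 so that the handshake identity
      -- applies.
      bound {w} h = ²-cancel-≤ _ _ (ℕ.*-cancelˡ-≤ (2 * K * q ²) (begin
        2 * K * q ² * (H * D) ²
          ≡⟨ solve 4 (λ k q h d → (k :* (q :* q)) :* ((h :* d) :* (h :* d)) := (k :* ((q :* h) :* (q :* h))) :* (d :* d))
               refl (2 * K) q H D ⟩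
        n₀ * D ²
          ≤⟨ ℕ.*-mono-≤ n₀≤n (ℕ.≤-trans h (potential-colouring d n (λ v v<n →
               subst (λ s → sum s ≤ d) (List.map-∘ E) (regular v v<n)))) ⟩
        n * (n * (List.length (tables K) * (K ^ q * d) ²))
          ≡⟨ solve 4 (λ n t k d → n :* (n :* (t :* ((k :* d) :* (k :* d)))) := t :* ((k :* (n :* d)) :* (k :* (n :* d))))
               refl n (List.length (tables K)) (K ^ q) d ⟩
        List.length (tables K) * (K ^ q * (n * d)) ²
          ≡⟨ cong₂ (λ t x → t * (K ^ q * x) ²) (length-tables K) handshake ⟩
        2 * K * (K ^ q * (q * m)) ²
          ≡⟨ solve 4 (λ k q a m → k :* ((a :* (q :* m)) :* (a :* (q :* m))) := (k :* (q :* q)) :* ((a :* m) :* (a :* m)))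
               refl (2 * K) q (K ^ q) m ⟩
        2 * K * q ² * (K ^ q * m) ² ∎))
        where
        D : ℕ
        D = deviation ms cs w

    total-[] : ∀ w a → nth 0 K w ≡ a → total ms [] w ≡ m * a ^ q
    total-[] w a h = trans (cong sum (sym (List.map-∘ E)))
      (trans (sum-cong (All.map (λ {e} len → trans (term-product [] w {vertices e} len)
          (trans (cong product (List.map-cong (λ _ → h) (vertices e)))
            (trans (product-constant a (vertices e)) (cong (a ^_) len)))) uniform))
        (sum-const (a ^ q) E))

    colour : ℕ → ℕ
    colour v = nth 0 v cs

    -- The weights read a missing colour as K, while the frames read it as 0. On coloured vertices
    -- the two readings agree.
    nth-colour : ∀ (cs : List ℕ) v → v < List.length cs → nth K v cs ≡ nth 0 v cs
    nth-colour (c ∷ cs) zero    h       = refl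
    nth-colour (c ∷ cs) (suc v) (s≤s h) = nth-colour cs v h

    colour-<K : ∀ v → colour v < K
    colour-<K = nth-All 0<K (colouring-<K d n)

    weight-colour : ∀ f a {v} → v < n → weight cs (table K f a) v ≡ f (colour v)
    weight-colour f a {v} h = trans
      (cong (λ c → nth 0 c (table K f a)) (nth-colour cs v (subst (v <_) (sym (length-colouring d n)) h)))
      (table-< K f a (colour-<K v))

    -- Both terms are nonzero for no edge, since edges are nonempty.
    edge-≤ : ∀ j {ok} e → List.length (vertices e) ≡ q → All (_< n) (vertices e) → j < K →
             (All (λ v → colour v < j) (vertices e) ⊎ All (λ v → j < colour v) (vertices e) → ok ≡ 1) →
             term cs (below K j) (vertices e) + term cs (above K j) (vertices e) ≤ K ^ q * ok
    edge-≤ j {ok} e len ins j<K h with product-zero {P = λ v → colour v < j} (weight cs (below K j)) (All.map low ins)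
                                     | product-zero {P = λ v → j < colour v} (weight cs (above K j)) (All.map high ins)
      where
      low : ∀ {v} → v < n → colour v < j ⊎ weight cs (below K j) v ≡ 0
      low {v} v<n = subst (λ x → colour v < j ⊎ x ≡ 0) (sym (weight-colour _ j v<n)) (if-zero (colour v) j K)
      high : ∀ {v} → v < n → j < colour v ⊎ weight cs (above K j) v ≡ 0
      high {v} v<n = subst (λ x → j < colour v ⊎ x ≡ 0) (sym (weight-colour _ (K ∸ suc j) v<n)) (if-zero j (colour v) K)
    ... | inj₂ z | inj₂ z′ rewrite term-product cs (below K j) {vertices e} len | term-product cs (above K j) {vertices e} len | z | z′ = z≤n
    ... | inj₁ l | inj₂ z′ rewrite h (inj₁ l) | term-product cs (above K j) {vertices e} len | z′ =
      subst₂ _≤_ (sym (ℕ.+-identityʳ _)) (sym (ℕ.*-identityʳ (K ^ q)))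
        (term-≤ cs {below K j} {vertices e} (table-≤ K _ j (λ c → if-≤ (c <ᵇ j) K) (ℕ.<⇒≤ j<K)) len)
    ... | inj₂ z | inj₁ l rewrite h (inj₂ l) | term-product cs (below K j) {vertices e} len | z =
      subst (term cs (above K j) (vertices e) ≤_) (sym (ℕ.*-identityʳ (K ^ q)))
        (term-≤ cs {above K j} {vertices e} (table-≤ K _ (K ∸ suc j) (λ c → if-≤ (j <ᵇ c) K) (ℕ.m∸n≤m K (suc j))) len)
    ... | inj₁ l | inj₁ l′ with vertices e | len | l | l′
    ...   | v ∷ _ | _ | c<j ∷ _ | j<c ∷ _ = ⊥-elim (ℕ.<-asym c<j j<c)

    -- In `ok`, a hyperedge lying entirely on one side of j counts 1. One of the two summands m on
    -- the right pays for colour j (`bernoulli`), the other for the deviations of the two totals at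
    -- j.
    concentration : ∀ j → j < K → (ok : A → ℕ) →
      All (λ e → All (λ v → colour v < j) (vertices e) ⊎ All (λ v → j < colour v) (vertices e) → ok e ≡ 1) E →
      κ * m ≤ 2 ^ p * κ * sum (map ok E) + 2 * m
    -- The cancelled factor is H K^q / κ, the common scale of the tolerance and of the terms.
    concentration j j<K ok h = ℕ.*-cancelˡ-≤ (2 * 2 ^ p * q * κ * A^) {{nz}} (begin
      2 * 2 ^ p * q * κ * A^ * (κ * m)
        ≡⟨ solve 5 (λ P q k a m → con 2 :* P :* q :* k :* a :* (k :* m) := (con 2 :* P :* k) :* m :* ((q :* k) :* a))
             refl (2 ^ p) q κ A^ m ⟩
      H * m * K ^ q
        ≤⟨ ℕ.*-monoʳ-≤ (H * m) power-K ⟩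
      H * m * (2 ^ p * (j ^ q + (K ∸ suc j) ^ q) + q * A^)
        ≡⟨ solve 6 (λ h m P x q a → h :* m :* (P :* x :+ q :* a) := P :* (h :* (m :* x)) :+ h :* m :* (q :* a))
             refl H m (2 ^ p) (j ^ q + (K ∸ suc j) ^ q) q A^ ⟩
      2 ^ p * (H * (m * (j ^ q + (K ∸ suc j) ^ q))) + H * m * (q * A^)
        ≤⟨ ℕ.+-monoˡ-≤ (H * m * (q * A^)) (ℕ.*-monoʳ-≤ (2 ^ p) totals) ⟩
      2 ^ p * (H * (K ^ q * S) + 2 * (K ^ q * m)) + H * m * (q * A^)
        ≡⟨ solve 6 (λ P q k a m s → P :* ((con 2 :* P :* k) :* (((q :* k) :* a) :* s) :+ con 2 :* (((q :* k) :* a) :* m)) :+ (con 2 :* P :* k) :* m :* (q :* a)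
             := con 2 :* P :* q :* k :* a :* (P :* k :* s :+ con 2 :* m)) refl (2 ^ p) q κ A^ m S ⟩
      2 * 2 ^ p * q * κ * A^ * (2 ^ p * κ * S + 2 * m) ∎)
      where
      open ℕ.≤-Reasoning
      open +-*-Solver
      A^ S : ℕ
      A^ = K ^ p
      S = sum (map ok E)
      nz : NonZero (2 * 2 ^ p * q * κ * A^)
      nz = >-nonZero (ℕ.*-mono-≤ {1} {2 * 2 ^ p * q * κ}
        (ℕ.*-mono-≤ {1} {2 * 2 ^ p * q} (ℕ.*-mono-≤ {1} {2 * 2 ^ p} (ℕ.*-mono-≤ {1} {2} (s≤s z≤n) (ℕ.m^n>0 2 p)) (s≤s z≤n)) 0<κ)
        (ℕ.m^n>0 K {{>-nonZero 0<K}} p))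
      power-K : K ^ q ≤ 2 ^ p * (j ^ q + (K ∸ suc j) ^ q) + q * A^
      power-K = begin
        K ^ q                          ≡⟨ cong (_^ q) (ℕ.m+[n∸m]≡n j<K) ⟨
        suc (j + (K ∸ suc j)) ^ q      ≤⟨ bernoulli p (j + (K ∸ suc j)) ⟩
        (j + (K ∸ suc j)) ^ q + q * suc (j + (K ∸ suc j)) ^ p
          ≡⟨ cong (λ k → (j + (K ∸ suc j)) ^ q + q * k ^ p) (ℕ.m+[n∸m]≡n j<K) ⟩
        (j + (K ∸ suc j)) ^ q + q * A^ ≤⟨ ℕ.+-monoˡ-≤ (q * A^) (power-mean p j (K ∸ suc j)) ⟩
        2 ^ p * (j ^ q + (K ∸ suc j) ^ q) + q * A^ ∎
      split : All (λ w → H * deviation ms cs w ≤ K ^ q * m) (map (below K) (upTo K)) ×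
              All (λ w → H * deviation ms cs w ≤ K ^ q * m) (map (above K) (upTo K))
      split = All.++⁻ _ deviation-bound
      at : ∀ {P : ℕ → Set} → All P (upTo K) → P j
      at ps = All.applyUpTo⁻ id K ps j<K
      one : ∀ w a → nth 0 K w ≡ a → H * deviation ms cs w ≤ K ^ q * m → H * (m * a ^ q) ≤ H * total ms cs w + K ^ q * m
      one w a e dev = begin
        H * (m * a ^ q)                               ≡⟨ cong (H *_) (total-[] w a e) ⟨
        H * total ms [] w                             ≤⟨ ℕ.*-monoʳ-≤ H (ℕ.m≤n+∣n-m∣ (total ms [] w) (total ms cs w)) ⟩
        H * (total ms cs w + deviation ms cs w)       ≡⟨ ℕ.*-distribˡ-+ H _ _ ⟩
        H * total ms cs w + H * deviation ms cs w     ≤⟨ ℕ.+-monoʳ-≤ (H * total ms cs w) dev ⟩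
        H * total ms cs w + K ^ q * m                 ∎
      both : total ms cs (below K j) + total ms cs (above K j) ≤ K ^ q * S
      both = begin
        total ms cs (below K j) + total ms cs (above K j)
          ≡⟨ cong₂ (λ x y → sum x + sum y) (List.map-∘ E) (List.map-∘ E) ⟨
        sum (map (λ e → term cs (below K j) (vertices e)) E) + sum (map (λ e → term cs (above K j) (vertices e)) E)
          ≡⟨ sum-+ _ _ E ⟨
        sum (map (λ e → term cs (below K j) (vertices e) + term cs (above K j) (vertices e)) E)
          ≤⟨ sum-mono (All.zipWith (λ {e} (len , ins , h) → edge-≤ j e len ins j<K h) (uniform , All.zipWith id (inside , h))) ⟩
        sum (map (λ e → K ^ q * ok e) E)
          ≡⟨ sum-* (K ^ q) ok E ⟩
        K ^ q * S ∎
      totals : H * (m * (j ^ q + (K ∸ suc j) ^ q)) ≤ H * (K ^ q * S) + 2 * (K ^ q * m)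
      totals = begin
        H * (m * (j ^ q + (K ∸ suc j) ^ q))
          ≡⟨ solve 4 (λ h m x y → h :* (m :* (x :+ y)) := h :* (m :* x) :+ h :* (m :* y)) refl H m (j ^ q) _ ⟩
        H * (m * j ^ q) + H * (m * (K ∸ suc j) ^ q)
          ≤⟨ ℕ.+-mono-≤ (one (below K j) j (table-K K _ j) (at (All.map⁻ (proj₁ split))))
                        (one (above K j) (K ∸ suc j) (table-K K _ (K ∸ suc j)) (at (All.map⁻ (proj₂ split)))) ⟩
        (H * total ms cs (below K j) + K ^ q * m) + (H * total ms cs (above K j) + K ^ q * m)
          ≡⟨ solve 4 (λ h x y z → (h :* x :+ z) :+ (h :* y :+ z) := h :* (x :+ y) :+ con 2 :* z) refl H _ _ (K ^ q * m) ⟩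
        H * (total ms cs (below K j) + total ms cs (above K j)) + 2 * (K ^ q * m)
          ≤⟨ ℕ.+-monoˡ-≤ (2 * (K ^ q * m)) (ℕ.*-monoʳ-≤ H both) ⟩
        H * (K ^ q * S) + 2 * (K ^ q * m) ∎

-- Exhaustive search finds the best walk

≡true : ∀ {b} → Bool.T b → b ≡ true
≡true {true} _ = refl

true-T : ∀ {b} → b ≡ true → Bool.T b
true-T refl = _

infixr 5 _∷_

-- Having both end points as indices makes detours and truncations simple inductions, on the same
-- plain lists that the programs compute.
data Walk {A : Set} (R : A → A → Set) : A → A → List A → Set where
  [_] : ∀ x → Walk R x x (x ∷ [])
  _∷_ : ∀ {x y z xs} → R x y → Walk R y z xs → Walk R x z (x ∷ xs)

filterᵇ-cong : ∀ {A : Set} {p r : A → Bool} → (∀ x → p x ≡ r x) → ∀ xs → filterᵇ p xs ≡ filterᵇ r xs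
filterᵇ-cong h [] = refl
filterᵇ-cong {p = p} {r} h (x ∷ xs) with p x | r x | h x
... | true  | _ | refl = cong (x ∷_) (filterᵇ-cong h xs)
... | false | _ | refl = filterᵇ-cong h xs

∈-filterᵇ⁺ : ∀ {A : Set} (p : A → Bool) {x xs} → x ∈ xs → p x ≡ true → x ∈ filterᵇ p xs
∈-filterᵇ⁺ p x∈ px = ∈.∈-filter⁺ (Bool.T? ∘ p) x∈ (true-T px)

∈-filterᵇ⁻ : ∀ {A : Set} (p : A → Bool) {x xs} → x ∈ filterᵇ p xs → x ∈ xs × p x ≡ true
∈-filterᵇ⁻ p {xs = xs} x∈ = let x∈xs , px = ∈.∈-filter⁻ (Bool.T? ∘ p) {xs = xs} x∈ in x∈xs , ≡true px

∈⇒0<length : ∀ {A : Set} {x : A} {xs} → x ∈ xs → 0 < List.length xs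
∈⇒0<length (here _)  = s≤s z≤n
∈⇒0<length (there _) = s≤s z≤n

-- No summand can be strictly smaller without making the sum strictly smaller. So when a count fails
-- to drop, none of its summands has dropped.
sum-cancel-≤ : ∀ {A : Set} (f g : A → ℕ) {xs} → All (λ x → f x ≤ g x) xs →
               sum (map g xs) ≤ sum (map f xs) → All (λ x → g x ≤ f x) xs
sum-cancel-≤ f g [] h = []
sum-cancel-≤ f g {x ∷ xs} (fx ∷ fs) h =
  ℕ.+-cancelʳ-≤ _ _ _ (ℕ.≤-trans h (ℕ.+-monoʳ-≤ (f x) (sum-mono fs)))
  ∷ sum-cancel-≤ f g fs (ℕ.+-cancelˡ-≤ (g x) _ _ (ℕ.≤-trans h (ℕ.+-monoˡ-≤ _ fx)))

module _ (n : ℕ) where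

  Near : List ℕ → List ℕ → Set
  Near f g = differences n f g < 2

  differences-sym : ∀ f g → differences n f g ≡ differences n g f
  differences-sym f g = cong List.length (filterᵇ-cong (λ v → cong Bool.not (≡ᵇ-sym (nth 0 v f) (nth 0 v g))) (upTo n))
    where
    ≡ᵇ-sym : ∀ a b → (a ≡ᵇ b) ≡ (b ≡ᵇ a)
    ≡ᵇ-sym zero    zero    = refl
    ≡ᵇ-sym zero    (suc b) = refl
    ≡ᵇ-sym (suc a) zero    = refl
    ≡ᵇ-sym (suc a) (suc b) = ≡ᵇ-sym a b

  -- The detour comes back to f, which uses the symmetry of `Near`, so the end points and the step
  -- after f are unaffected.
  insert-walk : ∀ u {f g t} → Walk Near f g t → Walk Near f g (insert n u t)
  insert-walk u [ f ] with differences n f u <ᵇ 2 in eq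
  ... | true  = let fu = ℕ.<ᵇ⇒< _ _ (true-T eq) in fu ∷ subst (_< 2) (differences-sym f u) fu ∷ [ f ]
  ... | false = [ f ]
  insert-walk u {f} (r ∷ w) with differences n f u <ᵇ 2 in eq
  ... | true  = let fu = ℕ.<ᵇ⇒< _ _ (true-T eq) in fu ∷ subst (_< 2) (differences-sym f u) fu ∷ r ∷ w
  ... | false = r ∷ insert-walk u w

  rounds-walk : ∀ S i {f g t} → Walk Near f g t → Walk Near f g (fold t (round n S) i)
  rounds-walk S zero    w = w
  rounds-walk S (suc i) w = round-walk S (rounds-walk S i w)
    where
    round-walk : ∀ S {f g t} → Walk Near f g t → Walk Near f g (round n S t)
    round-walk []      w = w
    round-walk (u ∷ S) w = insert-walk u (round-walk S w)

  insert-⊆ : ∀ u t → t ⊆ insert n u t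
  insert-⊆ u (f ∷ t) x∈ with differences n f u <ᵇ 2
  insert-⊆ u (f ∷ t) (here e)   | true  = here e
  insert-⊆ u (f ∷ t) (there x∈) | true  = there (there (there x∈))
  insert-⊆ u (f ∷ t) (here e)   | false = here e
  insert-⊆ u (f ∷ t) (there x∈) | false = there (insert-⊆ u t x∈)

  insert-∈ : ∀ {f u t} → f ∈ t → Near f u → u ∈ insert n u t
  insert-∈ {u = u} {f ∷ t} f∈ h with differences n f u <ᵇ 2 in eq
  ... | true = there (here refl)
  insert-∈ {u = u} {f ∷ t} (here refl) h | false = ⊥-elim (subst Bool.T eq (ℕ.<⇒<ᵇ h))
  insert-∈ {u = u} {f ∷ t} (there f∈)  h | false = there (insert-∈ f∈ h)

  insert-∈⁻ : ∀ {x u} t → x ∈ insert n u t → x ∈ t ⊎ (x ≡ u × ∃[ f ] f ∈ t × Near f u)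
  insert-∈⁻ {u = u} (f ∷ t) x∈ with differences n f u <ᵇ 2 in eq
  insert-∈⁻ (f ∷ t) (here e)                 | true = inj₁ (here e)
  insert-∈⁻ (f ∷ t) (there (here e))         | true = inj₂ (e , f , here refl , ℕ.<ᵇ⇒< _ _ (true-T eq))
  insert-∈⁻ (f ∷ t) (there (there x∈))       | true = inj₁ x∈
  insert-∈⁻ (f ∷ t) (here e)                 | false = inj₁ (here e)
  insert-∈⁻ (f ∷ t) (there x∈)               | false with insert-∈⁻ t x∈
  ... | inj₁ x∈t = inj₁ (there x∈t)
  ... | inj₂ (e , g , g∈ , h) = inj₂ (e , g , there g∈ , h)

  round-⊆ : ∀ S t → t ⊆ round n S t
  round-⊆ []      t x∈ = x∈
  round-⊆ (u ∷ S) t x∈ = insert-⊆ u _ (round-⊆ S t x∈)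

  round-∈ : ∀ {f u S t} → f ∈ t → u ∈ S → Near f u → u ∈ round n S t
  round-∈ {S = u ∷ S} {t} f∈ (here refl) h = insert-∈ (round-⊆ S t f∈) h
  round-∈ {S = u ∷ S} {t} f∈ (there u∈)  h = insert-⊆ u _ (round-∈ f∈ u∈ h)

  Closed : List (List ℕ) → List (List ℕ) → Set
  Closed S t = ∀ {f u} → f ∈ t → u ∈ S → Near f u → u ∈ t

  closed-⊇ : ∀ {S t} S′ → S′ ⊆ S → Closed S t → round n S′ t ⊆ t
  closed-⊇ []       S′⊆S cl x∈ = x∈
  closed-⊇ (u ∷ S′) S′⊆S cl x∈ with insert-∈⁻ _ x∈
  ... | inj₁ x∈t = closed-⊇ S′ (S′⊆S ∘ there) cl x∈t
  ... | inj₂ (refl , f , f∈ , h) = cl (closed-⊇ S′ (S′⊆S ∘ there) cl f∈) (S′⊆S (here refl)) h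

  closed-round : ∀ {S t} → Closed S t → Closed S (round n S t)
  closed-round {S} {t} cl f∈ u∈ h = round-⊆ S t (cl (closed-⊇ S id cl f∈) u∈ h)

  module _ (S : List (List ℕ)) where

    open DecMembership (List.≡-dec ℕ._≟_) using () renaming (_∈?_ to _∈ˡ?_)

    missing : List (List ℕ) → List ℕ → ℕ
    missing t u = if does (u ∈ˡ? t) then 0 else 1

    missing-anti : ∀ {t t′} → t ⊆ t′ → ∀ u → missing t′ u ≤ missing t u
    missing-anti {t} {t′} t⊆t′ u with u ∈ˡ? t | u ∈ˡ? t′
    ... | _      | yes _  = z≤n
    ... | no _   | no _   = ℕ.≤-refl
    ... | yes u∈ | no u∉  = ⊥-elim (u∉ (t⊆t′ u∈))

    missing-≤ : ∀ {t t′ u} → missing t u ≤ missing t′ u → u ∈ t′ → u ∈ t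
    missing-≤ {t} {t′} {u} h u∈ with u ∈ˡ? t | u ∈ˡ? t′
    ... | yes u∈t | _      = u∈t
    ... | no _    | no u∉  = ⊥-elim (u∉ u∈)
    missing-≤ () u∈ | no _ | yes _

    unvisited : List (List ℕ) → ℕ
    unvisited t = sum (map (missing t) S)

    -- A round visits every member of S adjacent to the walk. If the number of unvisited members
    -- does not drop, these were all visited before, so the walk was closed already and stays
    -- closed. Otherwise each round uses up one unvisited member.
    rounds-progress : ∀ t i → Closed S (fold t (round n S) i) ⊎
                              (unvisited (fold t (round n S) i) + i ≤ List.length S)
    rounds-progress t zero = inj₂ (subst₂ _≤_ (sym (ℕ.+-identityʳ _)) (trans (sum-const 1 S) (ℕ.*-identityʳ _))
      (sum-mono (All.universal (λ u → if-≤1 (does (u ∈ˡ? t))) S)))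
      where
      if-≤1 : ∀ b → (if b then 0 else 1) ≤ 1
      if-≤1 true  = z≤n
      if-≤1 false = ℕ.≤-refl
    rounds-progress t (suc i) with rounds-progress t i
    ... | inj₁ cl = inj₁ (closed-round cl)
    ... | inj₂ h with ℕ.<-≤-connex (unvisited (fold t (round n S) (suc i))) (unvisited (fold t (round n S) i))
    ...   | inj₁ lt = inj₂ (ℕ.≤-trans (ℕ.≤-reflexive (ℕ.+-suc _ i)) (ℕ.≤-trans (ℕ.+-monoˡ-≤ i lt) h))
    ...   | inj₂ ge = inj₁ (closed-round (λ {f} {u} f∈ u∈ near →
            missing-≤ {W} {round n S W} (All.lookup same u∈) (round-∈ f∈ u∈ near)))
      where
      W : List (List ℕ)
      W = fold t (round n S) i
      same : All (λ u → missing W u ≤ missing (round n S W) u) S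
      same = sum-cancel-≤ (missing (round n S W)) (missing W) (All.universal (missing-anti (round-⊆ S W)) S) ge

    tour-closed : ∀ t → Closed S (tour n S t)
    tour-closed t with rounds-progress t (List.length S)
    ... | inj₁ cl = cl
    -- Here `length S` rounds have each used up a member, so none is unvisited and closedness is
    -- immediate. Comparing with `missing S`, which vanishes on S, extracts this member by member.
    ... | inj₂ h  = λ f∈ u∈ near → missing-≤ {tour n S t} {S} (All.lookup all-visited u∈) u∈
      where
      missing-∈ : ∀ {u t} → u ∈ t → missing t u ≡ 0
      missing-∈ {u} {t} u∈ with u ∈ˡ? t
      ... | yes _ = refl
      ... | no u∉ = ⊥-elim (u∉ u∈)
      all-visited : All (λ u → missing (tour n S t) u ≤ missing S u) S
      all-visited = sum-cancel-≤ (missing S) (missing (tour n S t))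
        (All.tabulate (λ {u} u∈ → subst (_≤ missing (tour n S t) u) (sym (missing-∈ u∈)) z≤n))
        (ℕ.≤-trans (ℕ.+-cancelʳ-≤ (List.length S) _ 0 h) z≤n)

    -- Closedness carries membership along each step of the walk, so the tour reaches whatever is
    -- reachable inside S.
    walk-in-tour : ∀ t {f g h} → Walk Near f g h → f ∈ tour n S t → All (_∈ S) h → g ∈ tour n S t
    walk-in-tour t [ f ]         f∈ _  = f∈
    walk-in-tour t (r ∷ w@([ _ ])) f∈ (_ ∷ hs@(y∈ ∷ _)) = walk-in-tour t w (tour-closed t f∈ y∈ r) hs
    walk-in-tour t (r ∷ w@(_ ∷ _)) f∈ (_ ∷ hs@(y∈ ∷ _)) = walk-in-tour t w (tour-closed t f∈ y∈ r) hs

  -- Since `differences n` sees only the first n entries, the new end point is merely known to agree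
  -- with g there. For words of length n, `differences-0` later identifies the two.
  upToFirst-walk : ∀ g {f z x t} → Walk Near f z t → x ∈ t → differences n x g ≡ 0 →
                   ∃[ y ] differences n y g ≡ 0 × Walk Near f y (upToFirst n g t)
  upToFirst-walk g {f} w x∈ e with differences n f g ≡ᵇ 0 in eq | w
  ... | true  | [ f ]   rewrite eq = f , ℕ.≡ᵇ⇒≡ _ 0 (true-T eq) , [ f ]
  ... | true  | _ ∷ _   rewrite eq = f , ℕ.≡ᵇ⇒≡ _ 0 (true-T eq) , [ f ]
  upToFirst-walk g w (here refl) e | false | [ f ]  = ⊥-elim (subst Bool.T eq (ℕ.≡⇒≡ᵇ _ 0 e))
  upToFirst-walk g w (here refl) e | false | _ ∷ _  = ⊥-elim (subst Bool.T eq (ℕ.≡⇒≡ᵇ _ 0 e))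
  upToFirst-walk g w (there x∈)  e | false | r ∷ w′ rewrite eq =
    let y , ye , wy = upToFirst-walk g w′ x∈ e in y , ye , r ∷ wy

  upToFirst-All : ∀ {P : List ℕ → Set} g {t} → All P t → All P (upToFirst n g t)
  upToFirst-All g [] = []
  upToFirst-All g {f ∷ t} (p ∷ ps) with differences n f g ≡ᵇ 0
  ... | true  = p ∷ []
  ... | false = p ∷ upToFirst-All g ps

  visits⁺ : ∀ {g x t} → x ∈ t → differences n x g ≡ 0 → visits n g t ≡ true
  visits⁺ {g} x∈ e = ≡true (ℕ.<⇒<ᵇ (∈⇒0<length (∈-filterᵇ⁺ (λ f → differences n f g ≡ᵇ 0) x∈ (≡true (ℕ.≡⇒≡ᵇ _ 0 e)))))

  visits⁻ : ∀ {g} t → visits n g t ≡ true → ∃[ x ] x ∈ t × differences n x g ≡ 0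
  visits⁻ {g} t h with filterᵇ (λ f → differences n f g ≡ᵇ 0) t in eq
  ... | x ∷ _ = let x∈ , e = ∈-filterᵇ⁻ (λ f → differences n f g ≡ᵇ 0) {xs = t} (subst (x ∈_) (sym eq) (here refl))
                in x , x∈ , ℕ.≡ᵇ⇒≡ _ 0 (true-T e)

Word : ℕ → ℕ → List ℕ → Set
Word n k f = List.length f ≡ n × All (_< k) f

words-Word : ∀ N n k → n ≤ N → All (Word n k) (words N n k)
words-Word zero    zero    k h       = (refl , []) ∷ []
words-Word (suc N) zero    k h       = (refl , []) ∷ []
words-Word (suc N) (suc n) k (s≤s h) = All.concat⁺ (All.map⁺ (All.applyUpTo⁺₁ id k
  (λ a<k → All.map⁺ (All.map (λ (l , ks) → cong suc l , a<k ∷ ks) (words-Word N n k h)))))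

Word-words : ∀ N n k {f} → n ≤ N → Word n k f → f ∈ words N n k
Word-words zero    zero    k {[]}    h       _              = here refl
Word-words (suc N) zero    k {[]}    h       _              = here refl
Word-words (suc N) (suc n) k {a ∷ f} (s≤s h) (l , a<k ∷ ks) =
  ∈.∈-concat⁺′ (∈.∈-map⁺ (a ∷_) (Word-words N n k h (ℕ.suc-injective l , ks)))
    (∈.∈-map⁺ (λ a → map (a ∷_) (words N n k)) (∈.∈-upTo⁺ a<k))

nth-ext : ∀ {f g} → List.length f ≡ List.length g → (∀ v → v < List.length f → nth 0 v f ≡ nth 0 v g) → f ≡ g
nth-ext {[]}    {[]}    l h = refl
nth-ext {a ∷ f} {b ∷ g} l h = cong₂ _∷_ (h 0 (s≤s z≤n)) (nth-ext (ℕ.suc-injective l) (λ v v< → h (suc v) (s≤s v<)))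

differences-0 : ∀ {n f g} → List.length f ≡ n → List.length g ≡ n → differences n f g ≡ 0 → f ≡ g
differences-0 {n} {f} {g} lf lg e = nth-ext (trans lf (sym lg)) (λ v v< → same v (subst (v <_) lf v<))
  where
  same : ∀ v → v < n → nth 0 v f ≡ nth 0 v g
  same v v<n with nth 0 v f ≡ᵇ nth 0 v g in eq
  ... | true  = ℕ.≡ᵇ⇒≡ _ _ (true-T eq)
  ... | false = ⊥-elim (ℕ.<⇒≢ (∈⇒0<length (∈-filterᵇ⁺ (λ v → Bool.not (nth 0 v f ≡ᵇ nth 0 v g)) (∈.∈-upTo⁺ v<n) (cong Bool.not eq))) (sym e))

differences-self : ∀ n f → differences n f f ≡ 0
differences-self n f with filterᵇ (λ v → Bool.not (nth 0 v f ≡ᵇ nth 0 v f)) (upTo n) in eq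
... | []    = refl
... | v ∷ _ with ∈-filterᵇ⁻ (λ v → Bool.not (nth 0 v f ≡ᵇ nth 0 v f)) {xs = upTo n} (subst (v ∈_) (sym eq) (here refl))
...   | _ , e with nth 0 v f ≡ᵇ nth 0 v f | ≡true (ℕ.≡⇒≡ᵇ (nth 0 v f) _ refl)
differences-self n f | v ∷ _ | _ , () | true | _

module _ {A : Set} (found : ℕ → Bool) (path : ℕ → A) (Solution : A → Set) (Above : ℕ → A → Set)
  (above-anti : ∀ {s s′ r} → s′ ≤ s → Above s r → Above s′ r) where

  -- If the search succeeds at the largest threshold, its path is also above every smaller one. If
  -- it fails there, completeness excludes any solution above that threshold, and the smaller
  -- thresholds decide.
  foldr-best : ∀ {base} → Solution base → ∀ m →
               (∀ s → s < m → found s ≡ true → Solution (path s) × Above s (path s)) →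
               (∀ s {r} → Solution r → Above s r → found s ≡ true) →
               let best = foldr (λ s r → if found s then path s else r) base (downFrom m) in
               Solution best × (∀ {s r} → s < m → Solution r → Above s r → Above s best)
  foldr-best base zero    sound complete = base , λ ()
  foldr-best base (suc m) sound complete with foldr-best base m (λ s lt → sound s (ℕ.m≤n⇒m≤1+n lt)) complete | found m in eq
  ... | _                 | true  = let sol , above = sound m ℕ.≤-refl eq in
    sol , λ s≤m _ _ → above-anti (ℕ.≤-pred s≤m) above
  ... | solution , optimal | false = solution , opt
    where
    opt : ∀ {s r} → s < suc m → Solution r → Above s r → Above s _
    opt {s} s<m sol above with ℕ.m≤n⇒m<n∨m≡n (ℕ.≤-pred s<m)
    ... | inj₁ lt   = optimal lt sol above
    ... | inj₂ refl with trans (sym eq) (complete s sol above)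
    ...   | ()

module _ (N q K : ℕ) (T : List (List ℕ)) {n k : ℕ} {es : List RawEdge} {f g : List ℕ} (n≤N : n ≤ N)
  (f-word : Word n k f) (g-word : Word n k g) (f-sat : satisfied f es ≡ List.length es) where

  open Greedy q K T
  open Search N q K T

  private
    I : Raw
    I = (n , k , es) , f , g

  Solves : List (List ℕ) → Set
  Solves r = Walk (Near n) f g r × All (Word n k) r

  Above : ℕ → List (List ℕ) → Set
  Above s = All (λ h → s ≤ satisfied h es)

  allowed⁺ : ∀ {s h} → Word n k h → s ≤ satisfied h es → h ∈ allowed N I s
  allowed⁺ {s} {h} w le = ∈-filterᵇ⁺ (λ f → Bool.not (satisfied f es <ᵇ s)) (Word-words N n k n≤N w) (go _ _ le)
    where
    go : ∀ a b → b ≤ a → Bool.not (a <ᵇ b) ≡ true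
    go a zero _ = refl
    go (suc a) (suc b) (s≤s h) = go a b h

  allowed⁻ : ∀ s → All (λ h → Word n k h × s ≤ satisfied h es) (allowed N I s)
  allowed⁻ s = All.tabulate (λ {h} h∈ →
    let h∈′ , e = ∈-filterᵇ⁻ (λ f → Bool.not (satisfied f es <ᵇ s)) {xs = words N n k} h∈
    in All.lookup (words-Word N n k n≤N) h∈′ , go _ _ e)
    where
    go : ∀ a b → Bool.not (a <ᵇ b) ≡ true → b ≤ a
    go a       zero    e = z≤n
    go (suc a) (suc b) e = s≤s (go a b e)

  tourFrom-walk : ∀ s → Walk (Near n) f f (tourFrom N I s)
  tourFrom-walk s = rounds-walk n (allowed N I s) (List.length (allowed N I s)) [ f ]

  start-∈-tourFrom : ∀ s → f ∈ tourFrom N I s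
  start-∈-tourFrom s = first-∈ (tourFrom-walk s)
    where
    first-∈ : ∀ {R : List ℕ → List ℕ → Set} {a b xs} → Walk R a b xs → a ∈ xs
    first-∈ [ _ ]   = here refl
    first-∈ (_ ∷ _) = here refl

  -- All inserted entries are allowed ones. The initial entry f meets every such threshold because
  -- it satisfies all hyperedges.
  tourFrom-All : ∀ s → s ≤ List.length es → All (λ h → Word n k h × s ≤ satisfied h es) (tourFrom N I s)
  tourFrom-All s h = rounds-All n (List.length (allowed N I s)) (allowed⁻ s) ((f-word , subst (s ≤_) (sym f-sat) h) ∷ [])

  found-solves : ∀ s → s ≤ List.length es → visits n g (tourFrom N I s) ≡ true →
                 Solves (upToFirst n g (tourFrom N I s)) × Above s (upToFirst n g (tourFrom N I s))
  found-solves s h v =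
    let x , x∈ , e = visits⁻ n {g} (tourFrom N I s) v
        y , ye , w = upToFirst-walk n g (tourFrom-walk s) x∈ e
        words , above = All.unzipWith id (upToFirst-All n g (tourFrom-All s h))
        y≡g = differences-0 (proj₁ (All.lookup words (last-∈ w))) (proj₁ g-word) ye
    in (subst (λ y → Walk (Near n) f y (upToFirst n g (tourFrom N I s))) y≡g w , words) , above
    where
    last-∈ : ∀ {R : List ℕ → List ℕ → Set} {a b xs} → Walk R a b xs → b ∈ xs
    last-∈ [ _ ]   = here refl
    last-∈ (_ ∷ w) = there (last-∈ w)

  solves-found : ∀ s {r} → Solves r → Above s r → visits n g (tourFrom N I s) ≡ true
  solves-found s (w , words) above = visits⁺ n {g}
    (walk-in-tour n (allowed N I s) (f ∷ []) w (start-∈-tourFrom s)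
      (All.zipWith (λ (wd , le) → allowed⁺ wd le) (words , above)))
    (differences-self n g)

  search-correct : Solves (greedyPath I) →
                   Solves (search I) × (∀ {s r} → s < suc (List.length es) → Solves r → Above s r → Above s (search I))
  search-correct base = foldr-best (λ s → visits n g (tourFrom N I s)) (λ s → upToFirst n g (tourFrom N I s))
    Solves Above (λ le → All.map (ℕ.≤-trans le)) base (suc (List.length es))
    (λ s h → found-solves s (ℕ.≤-pred h)) (λ s → solves-found s)

-- Instances as first-order data

nth-toList : ∀ {A B : Set} (d : B) (g : A → B) {n} (xs : Vec A n) v →
             nth d (toℕ v) (map g (Vec.toList xs)) ≡ g (lookup xs v)
nth-toList d g (x ∷ xs) zero    = refl
nth-toList d g (x ∷ xs) (suc v) = nth-toList d g xs v

rawAssignment : ∀ {n k} → Assignment n k → List ℕ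
rawAssignment f = map toℕ (Vec.toList f)

nth-raw : ∀ {n k} (f : Assignment n k) v → nth 0 (toℕ v) (rawAssignment f) ≡ toℕ (lookup f v)
nth-raw = nth-toList 0 toℕ

module _ {n} {e : Subset n} {k : ℕ} where

  rawGate : ∀ {m} → Gate e k m → RawGate
  rawGate (const b)     = 0 , encBool b
  rawGate (input v _ a) = 1 , node (encFin v) (encFin a)
  rawGate (not g)       = 2 , encFin g
  rawGate (and g h)     = 3 , node (encFin g) (encFin h)
  rawGate (or g h)      = 4 , node (encFin g) (encFin h)

  rawGates : ∀ {m} → Gates e k m → List RawGate
  rawGates []       = []
  rawGates (gs ▷ g) = rawGate g ∷ rawGates gs

  enc-rawGate : ∀ {m} (g : Gate e k m) → enc (rawGate g) ≡ encGate g
  enc-rawGate (const b)     = refl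
  enc-rawGate (input v _ a) = refl
  enc-rawGate (not g)       = refl
  enc-rawGate (and g h)     = refl
  enc-rawGate (or g h)      = refl

  enc-rawGates : ∀ {m} (gs : Gates e k m) → enc (rawGates gs) ≡ encGates gs
  enc-rawGates []       = refl
  enc-rawGates (gs ▷ g) = cong₂ node (enc-rawGate g) (enc-rawGates gs)

  spine-encℕ : ∀ i → spine (encℕ i) ≡ i
  spine-encℕ zero    = refl
  spine-encℕ (suc i) = cong suc (spine-encℕ i)

  nth-bits : ∀ {m} (bs : Vec Bool m) g → nth false (spine (encFin g)) (Vec.toList bs) ≡ lookup bs g
  nth-bits bs g = trans (cong₂ (nth false) (spine-encℕ (toℕ g)) (sym (List.map-id (Vec.toList bs))))
    (nth-toList false id bs g)

  ≡ᵇ-≟ : ∀ {k} (a b : Fin k) → (toℕ a ≡ᵇ toℕ b) ≡ ⌊ a Fin.≟ b ⌋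
  ≡ᵇ-≟ a b with a Fin.≟ b
  ... | yes refl = ≡true (ℕ.≡⇒≡ᵇ (toℕ a) _ refl)
  ... | no a≢b with toℕ a ≡ᵇ toℕ b in eq
  ...   | false = refl
  ...   | true  = ⊥-elim (a≢b (Fin.toℕ-injective (ℕ.≡ᵇ⇒≡ _ _ (true-T eq))))

  gateBit-raw : ∀ (f : Assignment n k) {m} (g : Gate e k m) bs →
                gateBit (rawAssignment f) (Vec.toList bs) (rawGate g) ≡ gateValue (f ↾ e) g bs
  gateBit-raw f (const true)  bs = refl
  gateBit-raw f (const false) bs = refl
  gateBit-raw f (input v _ a) bs rewrite spine-encℕ (toℕ v) | spine-encℕ (toℕ a) | nth-raw f v = ≡ᵇ-≟ (lookup f v) a
  gateBit-raw f (not g)   bs rewrite nth-bits bs g = refl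
  gateBit-raw f (and g h) bs rewrite nth-bits bs g | nth-bits bs h = refl
  gateBit-raw f (or g h)  bs rewrite nth-bits bs g | nth-bits bs h = refl

  gateBits-raw : ∀ (f : Assignment n k) {m} (gs : Gates e k m) →
                 foldr (λ g bs → gateBit (rawAssignment f) bs g ∷ bs) [] (rawGates gs) ≡ Vec.toList (gateValues (f ↾ e) gs)
  gateBits-raw f []       = refl
  gateBits-raw f (gs ▷ g) rewrite gateBits-raw f gs = cong (_∷ _) (gateBit-raw f g (gateValues (f ↾ e) gs))

  circuitBit-raw : ∀ (f : Assignment n k) (c : Circuit e k) →
                   circuitBit (rawAssignment f) (rawGates (proj₂ c)) ≡ ⟦ f ↾ e ⟧ c
  circuitBit-raw f (_ , gs) rewrite gateBits-raw f gs with gateValues (f ↾ e) gs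
  ... | b ∷ _ = refl

  gateValue-cong : ∀ {x y : Local e k} → (∀ v i → x v i ≡ y v i) → ∀ {m} (g : Gate e k m) bs → gateValue x g bs ≡ gateValue y g bs
  gateValue-cong h (const b)     bs = refl
  gateValue-cong h (input v i a) bs = cong (λ s → ⌊ s Fin.≟ a ⌋) (h v i)
  gateValue-cong h (not g)       bs = refl
  gateValue-cong h (and g g′)    bs = refl
  gateValue-cong h (or g g′)     bs = refl

  gateValues-cong : ∀ {x y : Local e k} → (∀ v i → x v i ≡ y v i) → ∀ {m} (gs : Gates e k m) → gateValues x gs ≡ gateValues y gs
  gateValues-cong h []       = refl
  gateValues-cong {x} {y} h (gs ▷ g) = cong₂ _∷_
    (trans (gateValue-cong h g (gateValues x gs)) (cong (gateValue y g) (gateValues-cong h gs)))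
    (gateValues-cong h gs)

  -- Agreement on the vertices of the hyperedge suffices. A hyperedge with all or none of its
  -- vertices reassigned thereby inherits satisfaction from the end or the start.
  circuit-cong : ∀ {x y : Local e k} → (∀ v i → x v i ≡ y v i) → (c : Circuit e k) → ⟦ x ⟧ c ≡ ⟦ y ⟧ c
  circuit-cong h (_ , gs) = cong Vec.head (gateValues-cong h gs)

module _ {n k : ℕ} where

  rawEdge : ∀ {e : Subset n} → Circuit e k → RawEdge
  rawEdge {e} (_ , gs) = Vec.toList e , rawGates gs

  rawEdges : ∀ {es : List (Subset n)} → All (λ e → Circuit e k) es → List RawEdge
  rawEdges = All.reduce rawEdge

  rawEdges-All : ∀ {P : RawEdge → Set} {es} (Ψ : All (λ e → Circuit e k) es) →
                 (∀ {e} (e∈ : e ∈ es) → P (rawEdge (All.lookup Ψ e∈))) → All P (rawEdges Ψ)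
  rawEdges-All []      h = []
  rawEdges-All (c ∷ Ψ) h = h (here refl) ∷ rawEdges-All Ψ (h ∘ there)

  length-rawEdges : ∀ {es} (Ψ : All (λ e → Circuit e k) es) → List.length (rawEdges Ψ) ≡ List.length es
  length-rawEdges []      = refl
  length-rawEdges (c ∷ Ψ) = cong suc (length-rawEdges Ψ)

  satisfied-raw : ∀ (f : Assignment n k) {es} (Ψ : All (λ e → Circuit e k) es) →
                  satisfied (rawAssignment f) (rawEdges Ψ) ≡ List.length (filterᵇ id (All.reduce (λ {e} → ⟦ f ↾ e ⟧) Ψ))
  satisfied-raw f []      = refl
  satisfied-raw f (_∷_ {e} c Ψ) with circuitBit (rawAssignment f) (rawGates (proj₂ c)) | ⟦ f ↾ e ⟧ c | circuitBit-raw f c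
  ... | true  | _ | refl = cong suc (satisfied-raw f Ψ)
  ... | false | _ | refl = satisfied-raw f Ψ

  enc-rawAssignment : (f : Assignment n k) → enc (rawAssignment f) ≡ encAssignment f
  enc-rawAssignment f = cong encList (sym (List.map-∘ (Vec.toList f)))

  enc-rawEdges : ∀ {es} (Ψ : All (λ e → Circuit e k) es) →
                 enc (rawEdges Ψ) ≡ encList (All.reduce (λ {e} (_ , gs) → node (encSubset e) (encGates gs)) Ψ)
  enc-rawEdges []             = refl
  enc-rawEdges ((_ , gs) ∷ Ψ) = cong₂ (λ s t → node (node _ s) t) (enc-rawGates gs) (enc-rawEdges Ψ)

rawInstance : ∀ {q} → Instance q → Raw
rawInstance I = (n I , k I , rawEdges (Ψ (G I))) , rawAssignment (start I) , rawAssignment (end I)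

enc-rawInstance : ∀ {q} (I : Instance q) → enc (rawInstance I) ≡ encInstance I
enc-rawInstance I = cong₂ node
  (cong (λ t → node (encℕ (n I)) (node (encℕ (k I)) t)) (enc-rawEdges (Ψ (G I))))
  (cong₂ node (enc-rawAssignment (start I)) (enc-rawAssignment (end I)))

val-raw : ∀ {q n k} (G : CSP q n k) f →
          val G f ≡ fraction (satisfied (rawAssignment f) (rawEdges (Ψ G))) (List.length (rawEdges (Ψ G)))
val-raw G f = cong₂ fraction (sym (satisfied-raw f (Ψ G))) (sym (length-rawEdges (Ψ G)))

satisfied-all : ∀ f {es} → All (λ e → circuitBit f (proj₂ e) ≡ true) es → satisfied f es ≡ List.length es
satisfied-all f [] = refl
satisfied-all f {e ∷ es} (h ∷ hs) rewrite h = cong suc (satisfied-all f hs)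

satisfied-sum : ∀ f es → satisfied f es ≡ sum (map (λ e → if circuitBit f (proj₂ e) then 1 else 0) es)
satisfied-sum f [] = refl
satisfied-sum f (e ∷ es) with circuitBit f (proj₂ e)
... | true  = cong suc (satisfied-sum f es)
... | false = satisfied-sum f es

Satisfies-raw : ∀ {q n k} (G : CSP q n k) f → Satisfies G f →
                satisfied (rawAssignment f) (rawEdges (Ψ G)) ≡ List.length (rawEdges (Ψ G))
Satisfies-raw G f sat = satisfied-all (rawAssignment f) (rawEdges-All (Ψ G)
  (λ e∈ → trans (circuitBit-raw f (All.lookup (Ψ G) e∈)) (≡true (sat e∈))))

length-raw : ∀ {n k} (f : Assignment n k) → List.length (rawAssignment f) ≡ n
length-raw f = trans (List.length-map toℕ (Vec.toList f)) (Vec.length-toList f)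

Word-raw : ∀ {n k} (f : Assignment n k) → Word n k (rawAssignment f)
Word-raw f = length-raw f , All.map⁺ (All.universal Fin.toℕ<n (Vec.toList f))

raw-Word : ∀ {n k f} → Word n k f → ∃[ g ] rawAssignment {n} {k} g ≡ f
raw-Word {zero}  {f = []}    _              = [] , refl
raw-Word {suc n} {f = a ∷ f} (l , a<k ∷ ks) with raw-Word {n} {f = f} (ℕ.suc-injective l , ks)
... | g , h = fromℕ< a<k ∷ g , cong₂ _∷_ (Fin.toℕ-fromℕ< a<k) h

raw-injective : ∀ {n k} {f g : Assignment n k} → rawAssignment f ≡ rawAssignment g → f ≡ g
raw-injective {f = []}    {[]}    h = refl
raw-injective {f = a ∷ f} {b ∷ g} h =
  cong₂ _∷_ (Fin.toℕ-injective (List.∷-injectiveˡ h)) (raw-injective (List.∷-injectiveʳ h))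

unique-constant : ∀ {A : Set} {xs : List A} → Unique xs → (∀ {x y} → x ∈ xs → y ∈ xs → x ≡ y) → List.length xs < 2
unique-constant {xs = []}         u       h = s≤s z≤n
unique-constant {xs = x ∷ []}     u       h = s≤s (s≤s z≤n)
unique-constant {xs = x ∷ y ∷ xs} ((x≢y ∷ _) ∷ _) h = ⊥-elim (x≢y (h (here refl) (there (here refl))))

length<2 : ∀ {A : Set} {xs : List A} {x y} → List.length xs < 2 → x ∈ xs → y ∈ xs → x ≡ y
length<2 {xs = _ ∷ []} h (here refl) (here refl) = refl
length<2 {xs = _ ∷ _ ∷ _} (s≤s (s≤s ())) _ _

near : ∀ {n f g} → (∀ {u v} → u < n → v < n → nth 0 u f ≢ nth 0 u g → nth 0 v f ≢ nth 0 v g → u ≡ v) → Near n f g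
near {n} {f} {g} h = unique-constant (Unique.filter⁺ (Bool.T? ∘ _) (Unique.upTo⁺ n))
  (λ x∈ y∈ → let x< , xd = at x∈ ; y< , yd = at y∈ in h x< y< xd yd)
  where
  p : ℕ → Bool
  p v = Bool.not (nth 0 v f ≡ᵇ nth 0 v g)
  at : ∀ {x} → x ∈ filterᵇ p (upTo n) → x < n × nth 0 x f ≢ nth 0 x g
  at {x} x∈ = let x∈′ , px = ∈-filterᵇ⁻ p {xs = upTo n} x∈ in ∈.∈-upTo⁻ x∈′ ,
    λ e → subst (λ b → Bool.T (Bool.not b)) (≡true (ℕ.≡⇒≡ᵇ _ _ e)) (true-T px)

module _ {n k} {f g : Assignment n k} where

  private
    differ : ∀ {v} → nth 0 (toℕ v) (rawAssignment f) ≢ nth 0 (toℕ v) (rawAssignment g) → lookup f v ≢ lookup g v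
    differ {v} h e = h (trans (nth-raw f v) (trans (cong toℕ e) (sym (nth-raw g v))))

  near⁺ : DifferAtMostOnce f g → Near n (rawAssignment f) (rawAssignment g)
  near⁺ h = near {n} {rawAssignment f} {rawAssignment g} λ {u} {v} u<n v<n du dv → trans (sym (Fin.toℕ-fromℕ< u<n)) (trans
    (cong toℕ (h (fromℕ< u<n) (fromℕ< v<n)
      (differ (subst (λ u → nth 0 u (rawAssignment f) ≢ nth 0 u (rawAssignment g)) (sym (Fin.toℕ-fromℕ< u<n)) du))
      (differ (subst (λ u → nth 0 u (rawAssignment f) ≢ nth 0 u (rawAssignment g)) (sym (Fin.toℕ-fromℕ< v<n)) dv))))
    (Fin.toℕ-fromℕ< v<n))

  near⁻ : Near n (rawAssignment f) (rawAssignment g) → DifferAtMostOnce f g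
  near⁻ h u v du dv = Fin.toℕ-injective (length<2 h (at u du) (at v dv))
    where
    p : ℕ → Bool
    p v = Bool.not (nth 0 v (rawAssignment f) ≡ᵇ nth 0 v (rawAssignment g))
    at : ∀ v → lookup f v ≢ lookup g v → toℕ v ∈ filterᵇ p (upTo n)
    at v dv = ∈-filterᵇ⁺ p (∈.∈-upTo⁺ (Fin.toℕ<n v)) pv
      where
      pv : p (toℕ v) ≡ true
      pv rewrite nth-raw f v | nth-raw g v | ≡ᵇ-≟ {e = Subset.⊥ {n}} {k = k} (lookup f v) (lookup g v) with lookup f v Fin.≟ lookup g v
      ... | yes e = ⊥-elim (dv e)
      ... | no _  = refl

last-∷ : ∀ {A : Set} (x y : A) ys → List⁺.last (x ∷ y ∷ ys) ≡ List⁺.last (y ∷ ys)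
last-∷ x y ys with initLast ys
... | []                      = refl
... | _ ∷ʳ′ _ = refl

module _ {n k : ℕ} where

  raws : List⁺ (Assignment n k) → List (List ℕ)
  raws f⃗ = map rawAssignment (List⁺.toList f⃗)

  walk⁻ : ∀ {f g rs} → Walk (Near n) (rawAssignment f) (rawAssignment g) rs → All (Word n k) rs →
          ∃[ f⃗ ] f⃗ Reconfigures f to g × raws f⃗ ≡ rs
  walk⁻ {f} {g} w words = let f⃗ , eq , st , en , steps = go w words in
    f⃗ , record { starts = raw-injective st ; ends = raw-injective en ; steps = steps } , eq
    where
    go : ∀ {f g rs} → Walk (Near n) f g rs → All (Word n k) rs →
         ∃[ f⃗ ] raws f⃗ ≡ rs × rawAssignment (List⁺.head f⃗) ≡ f × rawAssignment (List⁺.last f⃗) ≡ g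
              × Linked DifferAtMostOnce (List⁺.toList f⃗)
    go [ x ] (wx ∷ []) = let f , eq = raw-Word wx in f ∷ [] , cong (_∷ []) eq , eq , eq , [-]
    go (r ∷ w) (wx ∷ ws) with raw-Word wx | go w ws
    ... | f , refl | y ∷ ys , eq , refl , en , steps =
      f ∷ y ∷ ys , cong (_ ∷_) eq , refl , trans (cong rawAssignment (last-∷ f y ys)) en , near⁻ {f = f} {g = y} r ∷ steps

  walk⁺ : ∀ {f g f⃗} → f⃗ Reconfigures f to g → Walk (Near n) (rawAssignment f) (rawAssignment g) (raws f⃗)
  walk⁺ {f⃗ = f ∷ fs} record { starts = refl ; ends = refl ; steps = steps } = go f fs steps
    where
    go : ∀ f fs → Linked DifferAtMostOnce (f ∷ fs) →
         Walk (Near n) (rawAssignment f) (rawAssignment (List⁺.last (f ∷ fs))) (raws (f ∷ fs))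
    go f []       _       = [ rawAssignment f ]
    go f (g ∷ fs) (r ∷ l) rewrite last-∷ f g fs = near⁺ {f = f} {g = g} r ∷ go g fs l

  raws-Word : (f⃗ : List⁺ (Assignment n k)) → All (Word n k) (raws f⃗)
  raws-Word f⃗ = All.map⁺ (All.universal Word-raw (List⁺.toList f⃗))

-- Members of hyperedges and degrees

filterᵇ-map : ∀ {A B : Set} (p : B → Bool) (f : A → B) xs → filterᵇ p (map f xs) ≡ map f (filterᵇ (p ∘ f) xs)
filterᵇ-map p f [] = refl
filterᵇ-map p f (x ∷ xs) with p (f x)
... | true  = cong (f x ∷_) (filterᵇ-map p f xs)
... | false = filterᵇ-map p f xs

length-members : ∀ {n} (e : Subset n) → List.length (members n (Vec.toList e)) ≡ ∣ e ∣
length-members []      = refl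
length-members {suc n} (b ∷ e) = split b
  where
  tail : ∀ b → List.length (filterᵇ (λ v → nth false v (b ∷ Vec.toList e)) (applyUpTo suc n)) ≡ ∣ e ∣
  tail b = trans (cong (λ vs → List.length (filterᵇ (λ v → nth false v (b ∷ Vec.toList e)) vs)) (sym (List.map-applyUpTo id suc n)))
    (trans (cong List.length (filterᵇ-map (λ v → nth false v (b ∷ Vec.toList e)) suc (upTo n)))
      (trans (List.length-map suc (members n (Vec.toList e))) (length-members e)))
  split : ∀ b → List.length (members (suc n) (b ∷ Vec.toList e)) ≡ ∣ b ∷ e ∣
  split true  = cong suc (tail true)
  split false = tail false

members-unique : ∀ n e → Unique (members n e)
members-unique n e = Unique.filter⁺ (Bool.T? ∘ _) (Unique.upTo⁺ n)

members-< : ∀ n e → All (_< n) (members n e)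
members-< n e = All.tabulate (λ v∈ → ∈.∈-upTo⁻ (proj₁ (∈-filterᵇ⁻ (λ v → nth false v e) {xs = upTo n} v∈)))

nth-subset : ∀ {n} (e : Subset n) v → nth false (toℕ v) (Vec.toList e) ≡ does (v Subset.∈? e)
nth-subset (true ∷ e)  zero    = refl
nth-subset (false ∷ e) zero    = refl
nth-subset (b ∷ e)     (suc v) = nth-subset e v

members-∈ : ∀ {n} (e : Subset n) {v} → v Subset.∈ e → toℕ v ∈ members n (Vec.toList e)
members-∈ e {v} v∈e = ∈-filterᵇ⁺ (λ v → nth false v (Vec.toList e)) (∈.∈-upTo⁺ (Fin.toℕ<n v)) (trans (nth-subset e v) (dec v∈e))
  where
  dec : v Subset.∈ e → does (v Subset.∈? e) ≡ true
  dec v∈ with v Subset.∈? e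
  ... | yes _ = refl
  ... | no v∉ = ⊥-elim (v∉ v∈)

indicator-members : ∀ {v n} e → v < n → indicator v (members n e) ≡ (if nth false v e then 1 else 0)
indicator-members {v} {n} e v<n with v ∈? members n e | nth false v e in eq
... | yes _  | true  = refl
... | no  _  | false = refl
... | no  v∉ | true  = ⊥-elim (v∉ (∈-filterᵇ⁺ (λ v → nth false v e) (∈.∈-upTo⁺ v<n) eq))
... | yes v∈ | false with trans (sym eq) (proj₂ (∈-filterᵇ⁻ (λ v → nth false v e) {xs = upTo n} v∈))
...   | ()

sum-filterᵇ : ∀ {A : Set} (p : A → Bool) xs → sum (map (λ x → if p x then 1 else 0) xs) ≡ List.length (filterᵇ p xs)
sum-filterᵇ p [] = refl
sum-filterᵇ p (x ∷ xs) with p x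
... | true  = cong suc (sum-filterᵇ p xs)
... | false = sum-filterᵇ p xs

module _ {n k : ℕ} where

  degree-raw : ∀ v {es} (Ψ : All (λ (e : Subset n) → Circuit e k) es) →
               sum (map (λ e → indicator (toℕ v) (members n (proj₁ e))) (rawEdges Ψ)) ≡ List.length (filter (v Subset.∈?_) es)
  degree-raw v [] = refl
  degree-raw v {e ∷ es} (c ∷ Ψ)
    rewrite indicator-members (Vec.toList e) (Fin.toℕ<n v) | nth-subset e v with v Subset.∈? e
  ... | yes _ = cong suc (degree-raw v Ψ)
  ... | no  _ = degree-raw v Ψ

  double-counting : ∀ {d q} (E : List RawEdge) →
                    All (λ v → sum (map (λ e → indicator v (members n (proj₁ e))) E) ≡ d) (upTo n) →
                    All (λ e → List.length (members n (proj₁ e)) ≡ q) E →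
                    n * d ≡ q * List.length E
  double-counting {d} {q} E deg unif = begin
    n * d
      ≡⟨ cong (_* d) (List.length-upTo n) ⟨
    List.length (upTo n) * d
      ≡⟨ sum-const d (upTo n) ⟨
    sum (map (λ _ → d) (upTo n))
      ≡⟨ sum-cong deg ⟨
    sum (map (λ v → sum (map (λ e → indicator v (members n (proj₁ e))) E)) (upTo n))
      ≡⟨ sum-swap (λ v e → indicator v (members n (proj₁ e))) (upTo n) E ⟩
    sum (map (λ e → sum (map (λ v → indicator v (members n (proj₁ e))) (upTo n))) E)
      ≡⟨ sum-cong (All.map (λ {e} u → trans (sum-cong (All.applyUpTo⁺₁ id n (indicator-members (proj₁ e))))
           (trans (sum-filterᵇ (λ v → nth false v (proj₁ e)) (upTo n)) u)) unif) ⟩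
    sum (map (λ _ → q) E)
      ≡⟨ sum-const q E ⟩
    List.length E * q
      ≡⟨ ℕ.*-comm (List.length E) q ⟩
    q * List.length E ∎
    where open ≡-Reasoning

-- The path of the greedy colouring

<⇒<ᵇ≡true : ∀ {m n} → m < n → (m <ᵇ n) ≡ true
<⇒<ᵇ≡true = ≡true ∘ ℕ.<⇒<ᵇ

≥⇒<ᵇ≡false : ∀ {m n} → n ≤ m → (m <ᵇ n) ≡ false
≥⇒<ᵇ≡false {m} {n} n≤m with m <ᵇ n in eq
... | false = refl
... | true  = ⊥-elim (ℕ.≤⇒≯ n≤m (ℕ.<ᵇ⇒< m n (true-T eq)))

walk-applyUpTo : ∀ {A : Set} {R : A → A → Set} (F : ℕ → A) M → (∀ t → R (F t) (F (suc t))) →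
                 Walk R (F 0) (F M) (applyUpTo F (suc M))
walk-applyUpTo F zero    h = [ F 0 ]
walk-applyUpTo F (suc M) h = h 0 ∷ walk-applyUpTo (F ∘ suc) M (h ∘ suc)

nth-All-< : ∀ {P : ℕ → Set} {xs} → All P xs → ∀ {v} → v < List.length xs → P (nth 0 v xs)
nth-All-< (p ∷ ps) {zero}  h       = p
nth-All-< (p ∷ ps) {suc v} (s≤s h) = nth-All-< ps h

module _ {n k : ℕ} (cs f g : List ℕ) where

  rank : ℕ → ℕ
  rank u = nth 0 u cs * n + u

  private
    F : ℕ → List ℕ
    F = frame n cs (f , g)

  nth-frame : ∀ t {u} → u < n → nth 0 u (F t) ≡ (if rank u <ᵇ t then nth 0 u g else nth 0 u f)
  nth-frame t {u} h = nth-map-upTo 0 (λ u → if rank u <ᵇ t then nth 0 u g else nth 0 u f) u n h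

  length-frame : ∀ t → List.length (F t) ≡ n
  length-frame t = trans (List.length-map _ (upTo n)) (List.length-upTo n)

  frame-after : ∀ t {u} → u < n → rank u < t → nth 0 u (F t) ≡ nth 0 u g
  frame-after t {u} h r = trans (nth-frame t h) (cong (λ b → if b then nth 0 u g else nth 0 u f) (<⇒<ᵇ≡true r))

  frame-before : ∀ t {u} → u < n → t ≤ rank u → nth 0 u (F t) ≡ nth 0 u f
  frame-before t {u} h r = trans (nth-frame t h) (cong (λ b → if b then nth 0 u g else nth 0 u f) (≥⇒<ᵇ≡false r))

  -- The vertex is recovered from its rank as the remainder modulo n.
  rank-injective : ∀ {u v} → u < n → v < n → rank u ≡ rank v → u ≡ v
  rank-injective {u} {v} u<n v<n h = trans (sym (mod u<n)) (trans (cong (λ r → (r % n) {{nz}}) h) (mod v<n))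
    where
    nz : NonZero n
    nz = >-nonZero (ℕ.≤-trans (s≤s z≤n) u<n)
    mod : ∀ {u} → u < n → (rank u % n) {{nz}} ≡ u
    mod {u} u<n = trans (cong (λ r → (r % n) {{nz}}) (ℕ.+-comm (nth 0 u cs * n) u))
      (trans ([m+kn]%n≡m%n u (nth 0 u cs) n {{nz}}) (m<n⇒m%n≡m {{nz}} u<n))

  -- Between times t and t + 1 only a vertex of rank t can change, and distinct vertices have
  -- distinct ranks.
  frame-near : ∀ t → Near n (F t) (F (suc t))
  frame-near t = near {n} {F t} {F (suc t)} λ u<n v<n du dv →
    rank-injective u<n v<n (trans (change u<n du) (sym (change v<n dv)))
    where
    change : ∀ {u} → u < n → nth 0 u (F t) ≢ nth 0 u (F (suc t)) → rank u ≡ t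
    change {u} u<n d with ℕ.<-cmp (rank u) t
    ... | tri≈ _ e _ = e
    ... | tri< l _ _ = ⊥-elim (d (trans (frame-after t u<n l) (sym (frame-after (suc t) u<n (ℕ.m≤n⇒m≤1+n l)))))
    ... | tri> _ _ l = ⊥-elim (d (trans (frame-before t u<n (ℕ.<⇒≤ l)) (sym (frame-before (suc t) u<n l))))

  module _ (fw : Word n k f) (gw : Word n k g) where

    frame-Word : ∀ t → Word n k (F t)
    frame-Word t = length-frame t , All.map⁺ (All.applyUpTo⁺₁ id n (λ {u} u<n → entry u (rank u <ᵇ t) u<n))
      where
      entry : ∀ u b → u < n → (if b then nth 0 u g else nth 0 u f) < k
      entry u true  u<n = nth-All-< (proj₂ gw) (subst (u <_) (sym (proj₁ gw)) u<n)
      entry u false u<n = nth-All-< (proj₂ fw) (subst (u <_) (sym (proj₁ fw)) u<n)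

    frame-first : F 0 ≡ f
    frame-first = nth-ext (trans (length-frame 0) (sym (proj₁ fw)))
      (λ v v< → frame-before 0 (subst (v <_) (length-frame 0) v<) z≤n)

    module _ {K} (cs<K : ∀ v → nth 0 v cs < K) where

      frame-last : F (K * n) ≡ g
      frame-last = nth-ext (trans (length-frame (K * n)) (sym (proj₁ gw)))
        (λ v v< → let v<n = subst (v <_) (length-frame (K * n)) v< in frame-after (K * n) v<n
          (ℕ.≤-trans (ℕ.+-monoʳ-< (nth 0 v cs * n) v<n)
            (ℕ.≤-trans (ℕ.≤-reflexive (ℕ.+-comm (nth 0 v cs * n) n)) (ℕ.*-monoˡ-≤ n (cs<K v)))))

      frames-walk : Walk (Near n) f g (map F (upTo (suc (K * n))))
      frames-walk = subst₂ (λ x y → Walk (Near n) x y (map F (upTo (suc (K * n))))) frame-first frame-last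
        (subst (Walk (Near n) (F 0) (F (K * n))) (sym (List.map-applyUpTo id F (suc (K * n))))
          (walk-applyUpTo F (K * n) frame-near))

module Guarantee (p κ : ℕ) (0<κ : 0 < κ) (I : Instance (suc p)) (regular : Regular (G I)) where

  open Concentration p κ 0<κ public using (q; K; 0<K; n₀; concentration)
  open Greedy q K (tables K) using (colouring; greedyPath)

  private
    E : List RawEdge
    E = rawEdges (Ψ (G I))

    vertices : RawEdge → List ℕ
    vertices e = members (n I) (proj₁ e)

    cs f g : List ℕ
    cs = colouring (map vertices E) (n I)
    f = rawAssignment (start I)
    g = rawAssignment (end I)

    F : ℕ → List ℕ
    F = frame (n I) cs (f , g)

    d : ℕ
    d = proj₁ regular

  edges-unique : All (λ e → Unique (vertices e)) E
  edges-unique = All.universal (λ e → members-unique (n I) (proj₁ e)) E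

  edges-inside : All (λ e → All (_< n I) (vertices e)) E
  edges-inside = All.universal (λ e → members-< (n I) (proj₁ e)) E

  edges-uniform : All (λ e → List.length (vertices e) ≡ q) E
  edges-uniform = rawEdges-All (Ψ (G I)) (λ {e} e∈ → trans (length-members e) (All.lookup (uniform (G I)) e∈))

  edges-regular : ∀ v → v < n I → sum (map (λ e → indicator v (vertices e)) E) ≡ d
  edges-regular v v<n = trans
    (cong (λ v → sum (map (λ e → indicator v (vertices e)) E)) (sym (Fin.toℕ-fromℕ< v<n)))
    (trans (degree-raw (fromℕ< v<n) (Ψ (G I))) (proj₂ regular (fromℕ< v<n)))

  cs<K : ∀ v → nth 0 v cs < K
  cs<K = nth-All 0<K (Analysis.colouring-<K q K (tables K) 0<K (tables-fair K) (tables-bounded K) (map vertices E)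
    (All.map⁺ edges-unique) (All.map⁺ edges-uniform) d (n I))

  -- Placed before the restriction to large n because the search on small instances takes this path
  -- as its base case.
  greedyPath-solves : Walk (Near (n I)) f g (greedyPath (rawInstance I)) ×
                      All (Word (n I) (k I)) (greedyPath (rawInstance I))
  greedyPath-solves =
    frames-walk {n I} {k I} cs f g (Word-raw (start I)) (Word-raw (end I)) cs<K ,
    All.map⁺ (All.universal (frame-Word {n I} {k I} cs f g (Word-raw (start I)) (Word-raw (end I))) (upTo (suc (K * n I))))

  module _ (n₀≤n : n₀ ≤ n I) where

    -- At time t < K n, with j = t / n, exactly the vertices of colour below j have been
    -- reassigned, together with some of colour j.
    frame-value : ∀ t → t < K * n I → κ * List.length E ≤ 2 ^ p * κ * satisfied (F t) E + 2 * List.length E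
    frame-value t t< = subst (λ s → κ * List.length E ≤ 2 ^ p * κ * s + 2 * List.length E) (sym (satisfied-sum (F t) E))
      (concentration E vertices (n I) d edges-unique edges-uniform edges-inside
        (λ v v<n → ℕ.≤-reflexive (edges-regular v v<n))
        (double-counting {n I} {k I} E (All.applyUpTo⁺₁ id (n I) (λ {v} v<n → edges-regular v v<n)) edges-uniform)
        n₀≤n j j<K (λ e → if circuitBit (F t) (proj₂ e) then 1 else 0)
        (rawEdges-All (Ψ (G I)) λ {e} e∈ → λ where
          (inj₁ low)  → cong (λ b → if b then 1 else 0) (edge-satisfied e∈ (end I) (end-sat I)
            (λ v v∈ → frame-after {n I} {k I} cs f g t (Fin.toℕ<n v) (before (All.lookup low (members-∈ e v∈)) (Fin.toℕ<n v))))
          (inj₂ high) → cong (λ b → if b then 1 else 0) (edge-satisfied e∈ (start I) (start-sat I)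
            (λ v v∈ → frame-before {n I} {k I} cs f g t (Fin.toℕ<n v) (after (All.lookup high (members-∈ e v∈)))))))
      where
      instance
        nz : NonZero (n I)
        nz = ≢-nonZero (λ n≡0 → ℕ.n≮0 (subst (t <_) (trans (cong (K *_) n≡0) (ℕ.*-zeroʳ K)) t<))
      j : ℕ
      j = t / n I
      j<K : j < K
      j<K = m<n*o⇒m/o<n t<
      before : ∀ {v} → nth 0 v cs < j → v < n I → rank {n I} {k I} cs f g v < t
      before {v} c<j v<n = ℕ.≤-trans (ℕ.+-monoʳ-< (nth 0 v cs * n I) v<n)
        (ℕ.≤-trans (ℕ.≤-reflexive (ℕ.+-comm (nth 0 v cs * n I) (n I)))
          (ℕ.≤-trans (ℕ.*-monoˡ-≤ (n I) c<j)
            (ℕ.≤-trans (ℕ.m≤n+m (j * n I) (t % n I)) (ℕ.≤-reflexive (sym (m≡m%n+[m/n]*n t (n I)))))))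
      after : ∀ {v} → j < nth 0 v cs → t ≤ rank {n I} {k I} cs f g v
      after {v} j<c = ℕ.≤-trans (ℕ.≤-reflexive (m≡m%n+[m/n]*n t (n I)))
        (ℕ.≤-trans (ℕ.+-monoˡ-≤ (j * n I) (ℕ.<⇒≤ (m%n<n t (n I))))
          (ℕ.≤-trans (ℕ.*-monoˡ-≤ (n I) j<c) (ℕ.m≤m+n (nth 0 v cs * n I) v)))
      edge-satisfied : ∀ {e} (e∈ : e ∈ edges (G I)) h → Satisfies (G I) h →
        (∀ v → v Subset.∈ e → nth 0 (toℕ v) (F t) ≡ nth 0 (toℕ v) (rawAssignment h)) →
        circuitBit (F t) (proj₂ (rawEdge (All.lookup (Ψ (G I)) e∈))) ≡ true
      edge-satisfied {e} e∈ h sat agree with raw-Word (frame-Word {n I} {k I} cs f g (Word-raw (start I)) (Word-raw (end I)) t)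
      ... | f′ , eq = trans (cong (λ f → circuitBit f (rawGates (proj₂ (All.lookup (Ψ (G I)) e∈)))) (sym eq))
        (trans (circuitBit-raw f′ (All.lookup (Ψ (G I)) e∈))
          (trans (circuit-cong (λ v v∈ → Fin.toℕ-injective (trans (sym (nth-raw f′ v))
              (trans (cong (nth 0 (toℕ v)) eq) (trans (agree v v∈) (nth-raw h v))))) (All.lookup (Ψ (G I)) e∈))
            (≡true (sat e∈))))

    greedyPath-value : All (λ h → κ * List.length E ≤ 2 ^ p * κ * satisfied h E + 2 * List.length E) (greedyPath (rawInstance I))
    greedyPath-value = All.map⁺ (All.applyUpTo⁺₁ id (suc (K * n I)) at)
      where
      at : ∀ {t} → t < suc (K * n I) → κ * List.length E ≤ 2 ^ p * κ * satisfied (F t) E + 2 * List.length E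
      at {t} (s≤s t≤) with ℕ.m≤n⇒m<n∨m≡n t≤
      ... | inj₁ t<   = frame-value t t<
      -- At the last time K n no colour class is in progress. The frame is the end assignment, which
      -- satisfies every hyperedge.
      ... | inj₂ refl = ℕ.≤-trans
        (ℕ.*-monoʳ-≤ κ (ℕ.≤-reflexive (sym (trans
          (cong (λ h → satisfied h E) (frame-last {n I} {k I} cs f g (Word-raw (start I)) (Word-raw (end I)) cs<K))
          (Satisfies-raw (G I) (end I) (end-sat I))))))
        (ℕ.≤-trans (ℕ.*-monoˡ-≤ (satisfied (F t) E) (ℕ.≤-trans (ℕ.≤-reflexive (sym (ℕ.*-identityˡ κ))) (ℕ.*-monoˡ-≤ κ (ℕ.m^n>0 2 p))))
          (ℕ.m≤m+n _ _))

-- Rational estimates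

fromℚᵘ-mono-≤ : ∀ {x y} → x ℚᵘ.≤ y → fromℚᵘ x ℚ.≤ fromℚᵘ y
fromℚᵘ-mono-≤ {x} {y} h = ℚ.toℚᵘ-cancel-≤ (begin
  toℚᵘ (fromℚᵘ x) ≃⟨ ℚ.toℚᵘ-fromℚᵘ x ⟩
  x               ≤⟨ h ⟩
  y               ≃⟨ ℚ.toℚᵘ-fromℚᵘ y ⟨
  toℚᵘ (fromℚᵘ y) ∎)
  where open ℚᵘ.≤-Reasoning

fromℚᵘ-≤-+ : ∀ {x y z} → x ℚᵘ.≤ y ℚᵘ.+ z → fromℚᵘ x ℚ.≤ fromℚᵘ y ℚ.+ fromℚᵘ z
fromℚᵘ-≤-+ {x} {y} {z} h = ℚ.toℚᵘ-cancel-≤ (begin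
  toℚᵘ (fromℚᵘ x)                      ≃⟨ ℚ.toℚᵘ-fromℚᵘ x ⟩
  x                                    ≤⟨ h ⟩
  y ℚᵘ.+ z                             ≃⟨ ℚᵘ.+-cong (ℚ.toℚᵘ-fromℚᵘ y) (ℚ.toℚᵘ-fromℚᵘ z) ⟨
  toℚᵘ (fromℚᵘ y) ℚᵘ.+ toℚᵘ (fromℚᵘ z) ≃⟨ ℚ.toℚᵘ-homo-+ (fromℚᵘ y) (fromℚᵘ z) ⟨
  toℚᵘ (fromℚᵘ y ℚ.+ fromℚᵘ z)         ∎)
  where open ℚᵘ.≤-Reasoning

fraction-mono : ∀ {s s′} m → s ≤ s′ → fraction s m ℚ.≤ fraction s′ m
fraction-mono zero    h = ℚ.≤-refl
fraction-mono {s} {s′} (suc m) h = fromℚᵘ-mono-≤ {mkℚᵘ (ι s) m} {mkℚᵘ (ι s′) m} (*≤* (ℤ.*-monoʳ-≤-nonNeg (ι suc m) (ℤ.+≤+ h)))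

fraction-≥0 : ∀ s m → 0ℚ ℚ.≤ fraction s m
fraction-≥0 s zero    = ℚ.<⇒≤ (ℚ.positive⁻¹ 1ℚ)
fraction-≥0 s (suc m) = fromℚᵘ-mono-≤ {mkℚᵘ (ι 0) 0} {mkℚᵘ (ι s) m} (*≤* (subst (ℤ._≤ ι s ℤ.* ι 1) (sym (ℤ.*-zeroˡ (ι suc m)))
  (subst (ℤ.0ℤ ℤ.≤_) (ℤ.pos-* s 1) (ℤ.+≤+ z≤n))))

fraction-≤1 : ∀ {s} m → s ≤ m → fraction s m ℚ.≤ 1ℚ
fraction-≤1 zero    h = ℚ.≤-refl
fraction-≤1 {s} (suc m) h = fromℚᵘ-mono-≤ {mkℚᵘ (ι s) m} {mkℚᵘ (ι 1) 0} (*≤*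
  (subst₂ ℤ._≤_ (ℤ.pos-* s 1) (ℤ.pos-* 1 (suc m))
    (ℤ.+≤+ (subst₂ _≤_ (sym (ℕ.*-identityʳ s)) (sym (ℕ.*-identityˡ (suc m))) h))))

1/ : (n : ℕ) .{{_ : ℕ.NonZero n}} → ℚ
1/ n = ι 1 ℚ./ n

-- Division by P κ m leaves the error 2/(P κ), which is at most 1/κ because P is at least 2. Without
-- hyperedges the value is 1 by convention, which already exceeds 1/P.
1/-≤-fraction : ∀ P κ {s} m .{{_ : ℕ.NonZero P}} .{{_ : ℕ.NonZero κ}} → 2 ≤ P →
                κ ℕ.* m ≤ P ℕ.* κ ℕ.* s ℕ.+ 2 ℕ.* m → 1/ P ℚ.≤ fraction s m ℚ.+ 1/ κ
1/-≤-fraction P@(suc P′) κ@(suc κ′) zero 2≤P h = ℚ.≤-trans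
  (fromℚᵘ-mono-≤ {mkℚᵘ (ι 1) P′} {mkℚᵘ (ι 1) 0} (*≤* (subst₂ ℤ._≤_ (ℤ.pos-* 1 1) (ℤ.pos-* 1 P)
    (ℤ.+≤+ (s≤s z≤n)))))
  (subst (ℚ._≤ 1ℚ ℚ.+ 1/ κ) (ℚ.+-identityʳ 1ℚ) (ℚ.+-monoʳ-≤ 1ℚ (fraction-≥0 1 κ)))
1/-≤-fraction P@(suc P′) κ@(suc κ′) {s} m@(suc m′) 2≤P h = fromℚᵘ-≤-+ {mkℚᵘ (ι 1) P′} {mkℚᵘ (ι s) m′} {mkℚᵘ (ι 1) κ′}
  (*≤* (subst₂ ℤ._≤_ (ℤ.pos-* 1 (m ℕ.* κ)) rhs (ℤ.+≤+ bound)))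
  where
  rhs : ι ((s ℕ.* κ ℕ.+ 1 ℕ.* m) ℕ.* P) ≡ (ι s ℤ.* ι κ ℤ.+ ι 1 ℤ.* ι m) ℤ.* ι P
  rhs = trans (ℤ.pos-* (s ℕ.* κ ℕ.+ 1 ℕ.* m) P) (cong (ℤ._* ι P)
    (trans (ℤ.pos-+ (s ℕ.* κ) (1 ℕ.* m)) (cong₂ ℤ._+_ (ℤ.pos-* s κ) (ℤ.pos-* 1 m))))
  bound : 1 ℕ.* (m ℕ.* κ) ≤ (s ℕ.* κ ℕ.+ 1 ℕ.* m) ℕ.* P
  bound = begin
    1 ℕ.* (m ℕ.* κ)              ≡⟨ solve 2 (λ m k → con 1 :* (m :* k) := k :* m) refl m κ ⟩
    κ ℕ.* m                      ≤⟨ h ⟩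
    P ℕ.* κ ℕ.* s ℕ.+ 2 ℕ.* m    ≤⟨ ℕ.+-monoʳ-≤ (P ℕ.* κ ℕ.* s) (ℕ.*-monoˡ-≤ m 2≤P) ⟩
    P ℕ.* κ ℕ.* s ℕ.+ P ℕ.* m    ≡⟨ solve 4 (λ P k s m → P :* k :* s :+ P :* m := (s :* k :+ con 1 :* m) :* P) refl P κ s m ⟩
    (s ℕ.* κ ℕ.+ 1 ℕ.* m) ℕ.* P  ∎
    where
    open ℕ.≤-Reasoning
    open +-*-Solver

-- The numerator of a positive rational is at least 1. This is why the denominator of δ can serve as
-- κ.
1/denominator-≤ : ∀ δ → 0ℚ ℚ.< δ → 1/ (ℚ.↧ₙ δ) ℚ.≤ δ
1/denominator-≤ δ 0<δ with ℚ.positive 0<δ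
1/denominator-≤ δ@(mkℚ +[1+ a ] d _) 0<δ | _ = subst (1/ (suc d) ℚ.≤_) (ℚ.fromℚᵘ-toℚᵘ δ)
  (fromℚᵘ-mono-≤ {mkℚᵘ (ι 1) d} {toℚᵘ δ} (*≤* (ℤ.*-monoʳ-≤-nonNeg (ι suc d) {ι 1} {+[1+ a ]} (ℤ.+≤+ (s≤s z≤n)))))

module _ {q n k} (G : CSP q n k) where

  seqVal-≥ : ∀ {r} f fs → All (λ f → r ℚ.≤ val G f) (f ∷ fs) → r ℚ.≤ seqVal G (f ∷ fs)
  seqVal-≥ f []       (h ∷ [])     = h
  seqVal-≥ f (g ∷ fs) (h ∷ hs) = ℚ.⊓-glb h (seqVal-≥ g fs hs)

  seqVal-≤ : ∀ {h} f fs → h ∈ f ∷ fs → seqVal G (f ∷ fs) ℚ.≤ val G h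
  seqVal-≤ f []       (here refl) = ℚ.≤-refl
  seqVal-≤ f (g ∷ fs) (here refl) = ℚ.p⊓q≤p (val G f) (seqVal G (g ∷ fs))
  seqVal-≤ f (g ∷ fs) (there h∈)  = ℚ.≤-trans (ℚ.p⊓q≤q (val G f) (seqVal G (g ∷ fs))) (seqVal-≤ g fs h∈)

  seqVal-≥0 : ∀ f⃗ → 0ℚ ℚ.≤ seqVal G f⃗
  seqVal-≥0 (f ∷ fs) = seqVal-≥ f fs (All.universal (λ f → fraction-≥0 _ (List.length (edges G))) (f ∷ fs))

  satisfied-≤ : ∀ f → satisfied f (rawEdges (Ψ G)) ≤ List.length (rawEdges (Ψ G))
  satisfied-≤ f = List.length-filter (Bool.T? ∘ (λ e → circuitBit f (proj₂ e))) (rawEdges (Ψ G))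

  seqVal-≤1 : ∀ f⃗ → seqVal G f⃗ ℚ.≤ 1ℚ
  seqVal-≤1 (f ∷ fs) = ℚ.≤-trans (seqVal-≤ f fs (here refl))
    (subst (ℚ._≤ 1ℚ) (sym (val-raw G f)) (fraction-≤1 _ (satisfied-≤ (rawAssignment f))))

minimum : ∀ {A : Set} (φ : A → ℕ) x xs → ∃[ y ] y ∈ x ∷ xs × All (λ z → φ y ≤ φ z) (x ∷ xs)
minimum φ x []       = x , here refl , ℕ.≤-refl ∷ []
minimum φ x (y ∷ xs) with minimum φ y xs
... | z , z∈ , zs with ℕ.≤-total (φ x) (φ z)
...   | inj₁ le = x , here refl , ℕ.≤-refl ∷ All.map (ℕ.≤-trans le) zs
...   | inj₂ ge = z , there z∈ , ge ∷ zs

enc-raws : ∀ {n k} (f⃗ : List⁺ (Assignment n k)) → enc (raws f⃗) ≡ encList (map encAssignment (List⁺.toList f⃗))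
enc-raws f⃗ = cong encList (trans (sym (List.map-∘ (List⁺.toList f⃗)))
  (List.map-cong enc-rawAssignment (List⁺.toList f⃗)))

-- An instance and its first-order form have the same encoding, and so have the two forms of a
-- sequence, so the program runs unchanged.
found : ∀ {q} {Promise : Instance q → Set} {Goal : (I : Instance q) → Sequence I → Set} {F : Raw → List (List ℕ)} →
        PolyTime F → (∀ I → Promise I → ∃[ f⃗ ] raws f⃗ ≡ F (rawInstance I) × Goal I f⃗) →
        FoundInPolynomialTime Promise Goal
found {F = F} P h = record { bodies = PolyTime.bodies P ; main = PolyTime.main P } , toPolynomial (PolyTime.time P) ,
  λ I pr → let f⃗ , eq , goal = h I pr ; c , run , c≤ = PolyTime.runs P (rawInstance I) in
    f⃗ , c ,
    subst₂ (λ s t → PolyTime.bodies P ∣ s ∷ᵛ []ᵛ ⊢ PolyTime.main P ⇓ t [ c ])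
      (enc-rawInstance I) (trans (cong enc (sym eq)) (enc-raws f⃗)) run ,
    subst (c ≤_) (sym (toPolynomial-⟨⟩ (PolyTime.time P) (size (encInstance I))))
      (subst (λ t → c ≤ ⟪ PolyTime.time P ⟫ (size t)) (enc-rawInstance I) c≤) ,
    goal
  where
  open import Data.Vec.Base using () renaming (_∷_ to _∷ᵛ_; [] to []ᵛ)

-- Choice of constants and proof of the theorem

module _ (p : ℕ) (1≤p : 1 ≤ p) (ε : ℝ) (0<ε : 0ᴿ <ᴿ ε) where

  private
    P δ-bound : ℕ
    P = 2 ^ p
    δ-bound = proj₁ (proj₂ (proj₂ 0<ε))

    instance
      P≢0 : ℕ.NonZero P
      P≢0 = ℕ.m^n≢0 2 p

    δ : ℚ
    δ = proj₁ 0<ε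

    0<δ : 0ℚ ℚ.< δ
    0<δ = proj₁ (proj₂ 0<ε)

    -- Positivity of ε supplies a positive rational δ below all its late approximations, so 1/κ is
    -- at most δ and hence at most those.
    κ : ℕ
    κ = ℚ.↧ₙ δ

    δ≤ε : ∀ i → δ-bound ≤ i → δ ℚ.≤ seq ε i
    δ≤ε i h = subst (ℚ._≤ seq ε i) (ℚ.+-identityˡ δ) (proj₂ (proj₂ (proj₂ 0<ε)) i h)

    ρ : ℕ → ℚ
    ρ i = 1/ P ℚ.- seq ε i

  open Concentration p κ (s≤s z≤n) using (q; K; n₀)
  open Greedy q K (tables K) using (greedyPath)
  open Search n₀ q K (tables K) using (search; bestPath)

  -- The number 1 + K n of frames.
  bound : Polynomial
  bound = 1 ∷ K ∷ []

  module _ (I : Instance q) (regular : Regular (G I)) where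

    open Guarantee p κ (s≤s z≤n) I regular using (greedyPath-solves; greedyPath-value)

    private
      E : List RawEdge
      E = rawEdges (Ψ (G I))

    greedy-sequence : n₀ ≤ n I → ∃[ f⃗ ] raws f⃗ ≡ greedyPath (rawInstance I) × IsReconfiguration I f⃗
                    × length f⃗ ≤ bound ⟨ n I ⟩ × (∀ i → δ-bound ≤ i → ρ i ℚ.≤ seqVal (G I) f⃗)
    greedy-sequence n₀≤n =
      let f⃗ , reconfigures , eq = walk⁻ {n I} {k I} {start I} {end I} (proj₁ greedyPath-solves) (proj₂ greedyPath-solves)
      in f⃗ , eq , reconfigures , ℕ.≤-reflexive (len f⃗ eq) , large f⃗ eq
      where
      len : ∀ f⃗ → raws f⃗ ≡ greedyPath (rawInstance I) → length f⃗ ≡ bound ⟨ n I ⟩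
      len f⃗ eq = trans (sym (List.length-map rawAssignment (List⁺.toList f⃗))) (trans (cong List.length eq)
        (trans (List.length-map _ (List.upTo (suc (K ℕ.* n I)))) (trans (List.length-upTo (suc (K ℕ.* n I)))
          (solve 2 (λ k n → con 1 :+ k :* n := con 1 :+ n :* (k :+ n :* con 0)) refl K (n I)))))
        where open +-*-Solver
      value : ∀ i → δ-bound ≤ i → ∀ h → κ ℕ.* List.length E ≤ P ℕ.* κ ℕ.* satisfied (rawAssignment h) E ℕ.+ 2 ℕ.* List.length E →
              ρ i ℚ.≤ val (G I) h
      value i i≥ h le = begin
        1/ P ℚ.- seq ε i                  ≤⟨ ℚ.+-monoˡ-≤ (ℚ.- seq ε i) (1/-≤-fraction P κ (List.length E) 2≤P le) ⟩
        (v ℚ.+ 1/ κ) ℚ.- seq ε i          ≤⟨ ℚ.+-monoˡ-≤ (ℚ.- seq ε i) (ℚ.+-monoʳ-≤ v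
                                               (ℚ.≤-trans (1/denominator-≤ δ 0<δ) (δ≤ε i i≥))) ⟩
        (v ℚ.+ seq ε i) ℚ.- seq ε i       ≡⟨ solve 2 (λ v e → (v :+ e) :- e := v) refl v (seq ε i) ⟩
        v                                 ≡⟨ val-raw (G I) h ⟨
        val (G I) h                       ∎
        where
        open ℚ.≤-Reasoning
        open ℚSolver.+-*-Solver
        v : ℚ
        v = fraction (satisfied (rawAssignment h) E) (List.length E)
        2≤P : 2 ≤ P
        2≤P = ℕ.^-monoʳ-≤ 2 1≤p
      large : ∀ f⃗ → raws f⃗ ≡ greedyPath (rawInstance I) → ∀ i → δ-bound ≤ i → ρ i ℚ.≤ seqVal (G I) f⃗
      large (f ∷ fs) eq i i≥ = seqVal-≥ (G I) f fs (All.map (λ {h} le → value i i≥ h le)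
        (All.map⁻ (subst (All (λ h → κ ℕ.* List.length E ≤ P ℕ.* κ ℕ.* satisfied h E ℕ.+ 2 ℕ.* List.length E)) (sym eq)
          (greedyPath-value n₀≤n))))

    best-sequence : n I ℕ.< n₀ → ∃[ f⃗ ] raws f⃗ ≡ search (rawInstance I) × IsReconfiguration I f⃗
                  × (∀ g⃗ → IsReconfiguration I g⃗ → seqVal (G I) g⃗ ℚ.≤ seqVal (G I) f⃗)
    best-sequence n<n₀ =
      let f⃗ , reconfigures , eq = walk⁻ {n I} {k I} {start I} {end I} (proj₁ (proj₁ correct)) (proj₂ (proj₁ correct))
      in f⃗ , eq , reconfigures , best f⃗ eq
      where
      correct = search-correct n₀ q K (tables K) {n I} {k I} {E} {rawAssignment (start I)} {rawAssignment (end I)}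
        (ℕ.<⇒≤ n<n₀) (Word-raw (start I)) (Word-raw (end I)) (Satisfies-raw (G I) (start I) (start-sat I)) greedyPath-solves
      search-best : ∀ g⃗ → IsReconfiguration I g⃗ → ∀ s → s ≤ List.length E →
                    All (λ h → s ≤ satisfied h E) (raws g⃗) → All (λ h → s ≤ satisfied h E) (search (rawInstance I))
      search-best g⃗ r s s≤ above =
        proj₂ correct {s} {raws g⃗} (s≤s s≤) (walk⁺ {f = start I} {end I} {g⃗} r , raws-Word g⃗) above
      best : ∀ f⃗ → raws f⃗ ≡ search (rawInstance I) → ∀ g⃗ → IsReconfiguration I g⃗ → seqVal (G I) g⃗ ℚ.≤ seqVal (G I) f⃗
      -- The threshold tried is the smallest number of hyperedges satisfied along the competing
      -- sequence, attained at h.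
      best (f ∷ fs) eq g⃗@(g ∷ gs) r = let h , h∈ , h≤ = minimum (λ h → satisfied (rawAssignment h) E) g gs in
        seqVal-≥ (G I) f fs (All.map (λ {f} le → begin
            seqVal (G I) g⃗                                           ≤⟨ seqVal-≤ (G I) g gs h∈ ⟩
            val (G I) h                                              ≡⟨ val-raw (G I) h ⟩
            fraction (satisfied (rawAssignment h) E) (List.length E) ≤⟨ fraction-mono (List.length E) le ⟩
            fraction (satisfied (rawAssignment f) E) (List.length E) ≡⟨ val-raw (G I) f ⟨
            val (G I) f                                              ∎)
          (All.map⁻ (subst (All (λ f → satisfied (rawAssignment h) E ≤ satisfied f E)) (sym eq)
            (search-best g⃗ r (satisfied (rawAssignment h) E) (satisfied-≤ (G I) (rawAssignment h)) (All.map⁺ h≤)))))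
        where open ℚ.≤-Reasoning

    ρ≤1 : ∀ i → δ-bound ≤ i → ρ i ℚ.≤ 1ℚ
    ρ≤1 i i≥ = ℚ.+-mono-≤ (1/P≤1 P) (ℚ.neg-antimono-≤ (ℚ.≤-trans (ℚ.<⇒≤ 0<δ) (δ≤ε i i≥)))
      where
      1/P≤1 : ∀ P .{{_ : ℕ.NonZero P}} → 1/ P ℚ.≤ 1ℚ
      1/P≤1 (suc P) = fraction-≤1 (suc P) (s≤s z≤n)

    -- As ε is positive, the late approximations of the factor are at most 1, so an optimal sequence
    -- meets it.
    best⇒approximate : ∀ f⃗ → (∀ g⃗ → IsReconfiguration I g⃗ → seqVal (G I) g⃗ ℚ.≤ seqVal (G I) f⃗) →
                       _IsApproximate_ {I = I} f⃗ (threshold q ε)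
    best⇒approximate f⃗ best g⃗ r η 0<η = δ-bound , λ i i≥ → begin
      ρ i ℚ.* seqVal (G I) g⃗       ≤⟨ ℚ.*-monoʳ-≤-nonNeg (seqVal (G I) g⃗) {{ℚ.nonNegative (seqVal-≥0 (G I) g⃗)}} (ρ≤1 i i≥) ⟩
      1ℚ ℚ.* seqVal (G I) g⃗        ≡⟨ ℚ.*-identityˡ (seqVal (G I) g⃗) ⟩
      seqVal (G I) g⃗               ≤⟨ best g⃗ r ⟩
      seqVal (G I) f⃗               ≡⟨ ℚ.+-identityʳ (seqVal (G I) f⃗) ⟨
      seqVal (G I) f⃗ ℚ.+ 0ℚ        ≤⟨ ℚ.+-monoʳ-≤ (seqVal (G I) f⃗) (ℚ.<⇒≤ 0<η) ⟩
      seqVal (G I) f⃗ ℚ.+ η         ∎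
      where open ℚ.≤-Reasoning

    -- No sequence has value above 1, so reaching the threshold in absolute terms already gives the
    -- factor.
    large⇒approximate : ∀ f⃗ → (∀ i → δ-bound ≤ i → ρ i ℚ.≤ seqVal (G I) f⃗) → _IsApproximate_ {I = I} f⃗ (threshold q ε)
    large⇒approximate f⃗ large g⃗ r η 0<η = δ-bound , λ i i≥ → begin
      ρ i ℚ.* seqVal (G I) g⃗               ≤⟨ ℚ.*-monoʳ-≤-nonNeg (seqVal (G I) g⃗) {{ℚ.nonNegative (seqVal-≥0 (G I) g⃗)}} (large i i≥) ⟩
      seqVal (G I) f⃗ ℚ.* seqVal (G I) g⃗    ≤⟨ ℚ.*-monoˡ-≤-nonNeg (seqVal (G I) f⃗) {{ℚ.nonNegative (seqVal-≥0 (G I) f⃗)}} (seqVal-≤1 (G I) g⃗) ⟩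
      seqVal (G I) f⃗ ℚ.* 1ℚ                ≡⟨ ℚ.*-identityʳ (seqVal (G I) f⃗) ⟩
      seqVal (G I) f⃗                       ≡⟨ ℚ.+-identityʳ (seqVal (G I) f⃗) ⟨
      seqVal (G I) f⃗ ℚ.+ 0ℚ                ≤⟨ ℚ.+-monoʳ-≤ (seqVal (G I) f⃗) (ℚ.<⇒≤ 0<η) ⟩
      seqVal (G I) f⃗ ℚ.+ η                 ∎
      where open ℚ.≤-Reasoning

    approximate-sequence : ∃[ f⃗ ] raws f⃗ ≡ bestPath (rawInstance I) × IsReconfiguration I f⃗
                         × _IsApproximate_ {I = I} f⃗ (threshold q ε)
    approximate-sequence = choose (n I ℕ.<ᵇ n₀) refl
      where
      choose : ∀ small? → (n I ℕ.<ᵇ n₀) ≡ small? →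
               ∃[ f⃗ ] raws f⃗ ≡ (if small? then search (rawInstance I) else greedyPath (rawInstance I)) × IsReconfiguration I f⃗
                    × _IsApproximate_ {I = I} f⃗ (threshold q ε)
      choose true  e = let f⃗ , eq , r , best = best-sequence (ℕ.<ᵇ⇒< (n I) n₀ (true-T e))
                       in f⃗ , eq , r , best⇒approximate f⃗ best
      choose false e = let f⃗ , eq , r , _ , large = greedy-sequence (ℕ.≮⇒≥ (λ lt → subst Bool.T e (ℕ.<⇒<ᵇ lt)))
                       in f⃗ , eq , r , large⇒approximate f⃗ large

  large-sequence : (I : Instance q) → Regular (G I) → n₀ ≤ n I →
                   ∃[ f⃗ ] raws f⃗ ≡ greedyPath (rawInstance I) × IsReconfiguration I f⃗
                        × length f⃗ ≤ bound ⟨ n I ⟩ × threshold q ε ≤ᴿ fromℚ (seqVal (G I) f⃗)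
  large-sequence I regular n₀≤n = let f⃗ , eq , r , len , large = greedy-sequence I regular n₀≤n in
    f⃗ , eq , r , len , λ η 0<η → δ-bound , λ i i≥ →
      ℚ.≤-trans (large i i≥) (ℚ.≤-trans (ℚ.≤-reflexive (sym (ℚ.+-identityʳ (seqVal (G I) f⃗))))
        (ℚ.+-monoʳ-≤ (seqVal (G I) f⃗) (ℚ.<⇒≤ 0<η)))

  greedy-program : PolyTime greedyPath
  greedy-program = Greedy.greedyPathᴾ q K (tables K)

  best-program : PolyTime bestPath
  best-program = Search.bestPathᴾ n₀ q K (tables K)

theorem1p4 : ∀ (q : ℕ) → 2 ≤ q →
    (∀ (ε : ℝ) → 0ᴿ <ᴿ ε → Σ ℕ λ n₀ → Σ Polynomial λ p →
    ((I : Instance q) → Regular (G I) → n₀ ≤ n I →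
    ∃[ f⃗ ] IsReconfiguration I f⃗
    × length f⃗ ≤ p ⟨ n I ⟩
    × threshold q ε ≤ᴿ fromℚ (seqVal (G I) f⃗))
    × FoundInPolynomialTime {q}
    (λ I → Regular (G I) × n₀ ≤ n I)
    (λ I f⃗ → IsReconfiguration I f⃗
    × length f⃗ ≤ p ⟨ n I ⟩
    × threshold q ε ≤ᴿ fromℚ (seqVal (G I) f⃗)))
    × (Σ ℝ λ ε₀ → 0ᴿ <ᴿ ε₀ × (∀ (ε : ℝ) → 0ᴿ <ᴿ ε → ε ≤ᴿ ε₀ →
    FoundInPolynomialTime {q}
    (λ I → Regular (G I))
    (λ I f⃗ → IsReconfiguration I f⃗
    × _IsApproximate_ {I = I} f⃗ (threshold q ε))))
theorem1p4 (suc p) (s≤s 1≤p) =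
  (λ ε 0<ε → Concentration.n₀ p (ℚ.↧ₙ (proj₁ 0<ε)) (s≤s z≤n) , bound p 1≤p ε 0<ε ,
    (λ I regular n₀≤n → let f⃗ , _ , goal = large-sequence p 1≤p ε 0<ε I regular n₀≤n in f⃗ , goal) ,
    found (greedy-program p 1≤p ε 0<ε) (λ I (regular , n₀≤n) → large-sequence p 1≤p ε 0<ε I regular n₀≤n)) ,
  fromℚ 1ℚ , (1ℚ , ℚ.positive⁻¹ 1ℚ , 0 , λ _ _ → ℚ.≤-refl) ,
  λ ε 0<ε _ → found (best-program p 1≤p ε 0<ε) (λ I regular → approximate-sequence p 1≤p ε 0<ε I regular)
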